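{- Let $n=rm\to\infty$, where $m=m(n)\ge 1$ and $r=r(n)\geq 3$ are integers. Then for any integer $d=d(n)$ with $0\le d\le m^{r-1}$ we have \[ H_r(d,m) = (1+o(1))\, \hat H_r(d,m), \qquad\text{where}\qquad \hat H_r(d,m) := \frac{\binom{m^{r-1}}{d}^{rm}}{\binom{m^r}{md}^{r-1}}. \]
   Context: The vertex set $[n]=\{1,\dots,n\}$ is partitioned into $r$ disjoint classes $V_1,\dots,V_r$, each of size $m$. An $(r,r)$-graph is an $r$-uniform hypergraph on $[n]$ in which every edge contains exactly one vertex from each class and there are no repeated edges. A hypergraph is $d$-regular if every vertex lies in exactly $d$ edges. $H_r(d,m)$ denotes the number of labelled $d$-regular $(r,r)$-graphs with these classes. -}

module Defs where

open import Data.Nat using (ℕ; zero; suc; _*_; _^_; _∸_; _≡ᵇ_)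
open import Data.Nat.Combinatorics using (_C_)
open import Data.Bool using (Bool)
open import Data.Fin using (Fin) renaming (_≟_ to _≟ᶠ_)
open import Data.Fin.Base using (Fin)
open import Data.List using (List; []; _∷_; [_]; _++_; map; concatMap; length; filter; filterᵇ; allFin)
open import Data.Bool.ListAction using (all)
open import Data.Integer using (+_)
open import Data.Rational using (ℚ; _/_)
open import Data.Vec using (Vec; lookup) renaming ([] to []ᵥ; _∷_ to _∷ᵥ_)

-- Classes V_1..V_r are identified with Fin r, and the vertices of each class
-- (of size m) with Fin m.  A possible edge (one vertex from each class) is
-- a vector e : Vec (Fin m) r, e[i] being its vertex in class V_i.

allEdges : (r m : ℕ) → List (Vec (Fin m) r)
allEdges zero    m = [ []ᵥ ]
allEdges (suc r) m = concatMap (λ v → map (v ∷ᵥ_) (allEdges r m)) (allFin m)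

-- All sublists of a list; for a duplicate-free list these are exactly its subsets,
-- each listed once.
subsets : ∀ {a} {A : Set a} → List A → List (List A)
subsets []       = [ [] ]
subsets (x ∷ xs) = subsets xs ++ map (x ∷_) (subsets xs)

-- An (r,r)-graph is a set of possible edges (no repeated edges).
-- Degree of vertex v of class i in edge set E.
degree : ∀ {r m} → List (Vec (Fin m) r) → Fin r → Fin m → ℕ
degree E i v = length (filter (λ e → lookup e i ≟ᶠ v) E)

isRegularᵇ : ∀ {r m} → ℕ → List (Vec (Fin m) r) → Bool
isRegularᵇ {r} {m} d E = all (λ i → all (λ v → degree E i v ≡ᵇ d) (allFin m)) (allFin r)

H : (r d m : ℕ) → ℕ
H r d m = length (filterᵇ (isRegularᵇ d) (subsets (allEdges r m)))

Hnum : (r d m : ℕ) → ℕ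
Hnum r d m = ((m ^ (r ∸ 1)) C d) ^ (r * m)

Hden : (r d m : ℕ) → ℕ
Hden r d m = ((m ^ r) C (m * d)) ^ (r ∸ 1)

ℕtoℚ : ℕ → ℚ
ℕtoℚ n = (+ n) / 1

{-# OPTIONS --safe #-}

-- Write n = m^(r-1). For a uniformly random set E of md possible edges let A_i be the event that
-- E is d-regular on the class V_i. Then P(A_i) = C(n,d)^m / C(nm,md), so the claim is that the r
-- events A_i are asymptotically independent. By complementation we may assume 2d ≤ n.
--
-- The vertices are prescribed degree d one after the other. Suppose that the classes before V_i are
-- regular and that b vertices of V_i are still free, α among them. Let D be the degree of α and let
-- C count the lines in direction i that meet E both in α and in another free vertex. Moving single
-- edges between α and the other free vertices gives, under the current conditional measure,
--   E[(bd - D - C) F(D+1)] = E[((b-1)D - C) F(D)]    for every function F.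
-- If C were replaced by D(bd - D)/n, this would be the Stein identity of the hypergeometric law which
-- D has when no other class is prescribed; with F the solution of the Stein equation, P(D = d)
-- therefore differs from the hypergeometric probability by a relative error O(E[D(bd - D) - nC]/(bdn)).
--
-- It remains to bound that expectation, i.e. to count the pairs of edges, one in α and one in another
-- free vertex, that agree in a set of classes. Requiring the pairs to agree in one class more divides
-- the expected number by exactly m if this class is free. If it is regular, let N_a be the edges at
-- its vertex a, and let an edge of N_a \ N_a' and one of N_a' \ N_a exchange their vertices. This
-- switching preserves all degrees and the number δ = |N_a \ N_a'|, and weighting it by 1/δ gives an
-- exact formula for the deviation from 1/m: it has a sign, and is small since δ = d - |N_a ∩ N_a'|
-- with N_a ∩ N_a' small on average, by the same argument. A vertex fixed while b are free costs a
-- relative error O(rm/(bn)), and the sum O(r² m^(2-r) log m) of these errors tends to 0 as rm → ∞.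

module Submission where

open import Defs
open import Data.Nat using (ℕ; _≤_; _*_; _^_; _∸_)
open import Data.Product using (Σ)
open import Data.Rational using (ℚ; 0ℚ; _<_; _-_; ∣_∣) renaming (_≤_ to _≤ℚ_; _*_ to _*ℚ_)
open import Algebra.Structures using (IsCommutativeRing)
open import Data.Bool as Bool using (Bool; true; false; not; _∧_; _∨_; if_then_else_)
open import Data.Bool.ListAction using (all)
open import Data.Empty using (⊥; ⊥-elim)
open import Data.Fin using (Fin; zero; suc; toℕ; fromℕ<) renaming (_≟_ to _≟ᶠ_)
import Data.Fin.Properties as Fin
import Data.Integer as ℤ
import Data.Integer.Properties as ℤ
open import Data.List using (List; []; _∷_; _++_; map; concatMap; length; filter; filterᵇ; allFin; cartesianProductWith)
import Data.List.Properties as List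
open import Data.List.Membership.Propositional using (_∈_; _∉_)
import Data.List.Membership.Propositional.Properties as Membership
open import Data.List.Membership.Propositional.Properties.WithK using (unique∧set⇒bag)
open import Data.List.Relation.Binary.BagAndSetEquality using (∼bag⇒↭)
open import Data.List.Relation.Binary.Permutation.Propositional as Perm using (_↭_)
open import Data.List.Relation.Unary.All as All using (All; []; _∷_)
import Data.List.Relation.Unary.All.Properties as All
open import Data.List.Relation.Unary.AllPairs using ([]; _∷_)
open import Data.List.Relation.Unary.Any using (here; there)
open import Data.List.Relation.Unary.Unique.Propositional using (Unique)
import Data.List.Relation.Unary.Unique.Propositional.Properties as Unique
open import Data.Maybe using (Maybe; just; nothing)
open import Data.Nat as ℕ using (zero; suc; z≤n; s≤s)
open import Data.Nat.Combinatorics using (_C_; nCk+nC[k+1]≡[n+1]C[k+1]; nC1≡n; k>n⇒nCk≡0; nCn≡1; nCk≡nC[n∸k])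
import Data.Nat.Properties as ℕ
import Data.Nat.Solver as ℕ
open import Data.Product using (_×_; _,_; proj₁; proj₂)
open import Data.Rational as ℚ using (1ℚ)
open import Data.Rational.Properties as ℚ using () renaming (≤-refl to ≤ℚ-refl; ≤-trans to ≤ℚ-trans; ≤-antisym to ≤ℚ-antisym; ≤-reflexive to ≡⇒≤; <⇒≤ to <ℚ⇒≤ℚ)
import Data.Rational.Unnormalised as ℚᵘ
import Data.Rational.Unnormalised.Properties as ℚᵘ
open import Data.Sum as Sum using (_⊎_; inj₁; inj₂)
open import Data.Vec using (Vec; []; _∷_; lookup; _[_]≔_)
open import Data.Vec.Properties as Vec using (≡-dec; lookup∘update; lookup∘update′; []≔-idempotent; []≔-lookup)
open import Function using (_∘_; id)
open import Function.Bundles using (mk⇔)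
open import Level using (0ℓ)
import Relation.Binary.Definitions as Tri
open import Relation.Binary.PropositionalEquality using (_≡_; _≢_; refl; sym; trans; cong; cong₂; subst; subst₂; module ≡-Reasoning)
open import Relation.Nullary using (Dec; yes; no; does; contradiction)
open import Relation.Nullary.Decidable using (dec-true; dec-false; ¬?)
open import Tactic.RingSolver using (solve-∀)
open import Tactic.RingSolver.Core.AlmostCommutativeRing using (AlmostCommutativeRing; fromCommutativeRing)

-- The event that α has degree d is rare, so an error measured against the total mass N of a stage
-- would be useless: it must be measured against the mass N′ of the edge sets in which α has degree
-- d. Two facts make this possible. The expectation of D(bd - D) - nC is nonnegative under every
-- reweighting by a nonnegative function of D, so a bound on the plain expectation controls it
-- against every bounded function of D. And the Stein solution F decreases everywhere except for one
-- upward jump at d. Its decrease per step is at most proportional to the hypergeometric weight at d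
-- and may meet the whole measure; its jump is large but meets only the edge sets with D = d, where
-- the same bound, applied with α already prescribed, is relative to N′. Both contributions then
-- have the same relative size. The estimates on agreeing pairs are not circular: the lower bound
-- needs control of common neighbourhoods, but that control rests on the upper bound alone, which
-- follows from the sign of the deviation.

infixl 6 _+_ _−_
infixl 7 _·_
infix 8 −_

-- The field operations are sealed so that unification treats them as
-- injective instead of unfolding the normalisation of fractions.
opaque
  _+_ _·_ _−_ : ℚ → ℚ → ℚ
  _+_ = ℚ._+_
  _·_ = ℚ._*_
  _−_ = ℚ._-_
  −_ : ℚ → ℚ
  −_ = ℚ.-_
  ι : ℕ → ℚ
  ι = ℕtoℚ
  -- With the convention inv 0 = 0.
  inv : ℚ → ℚ
  inv q with q ℚ.≟ 0ℚ
  ... | yes _ = 0ℚ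
  ... | no ne = ℚ.1/_ q {{ℚ.≢-nonZero ne}}

opaque
  unfolding _+_
  +-*-isCommutativeRing : IsCommutativeRing _≡_ _+_ _·_ −_ 0ℚ 1ℚ
  +-*-isCommutativeRing = ℚ.+-*-isCommutativeRing

0≟ : (x : ℚ) → Maybe (0ℚ ≡ x)
0≟ x with 0ℚ ℚ.≟ x
... | yes p = just p
... | no _ = nothing

ℚ-ring : AlmostCommutativeRing 0ℓ 0ℓ
ℚ-ring = fromCommutativeRing (record { isCommutativeRing = +-*-isCommutativeRing }) 0≟

open IsCommutativeRing +-*-isCommutativeRing public
  using (+-assoc; +-comm; +-identityˡ; +-identityʳ; *-assoc; *-comm; *-identityˡ; *-identityʳ; distribˡ; distribʳ)
  renaming (zeroˡ to *-zeroˡ; zeroʳ to *-zeroʳ)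

opaque
  unfolding _+_

  −-def : ∀ a b → a − b ≡ a + (− b)
  −-def a b = refl

  +-mono : ∀ {a b c d} → a ≤ℚ b → c ≤ℚ d → a + c ≤ℚ b + d
  +-mono = ℚ.+-mono-≤

  *-monoˡ : ∀ {a b c} → 0ℚ ≤ℚ c → a ≤ℚ b → c · a ≤ℚ c · b
  *-monoˡ {c = c} h = ℚ.*-monoˡ-≤-nonNeg c {{ℚ.nonNegative h}}

  *-cancelˡ : ∀ {a b c} → 0ℚ < c → c · a ≤ℚ c · b → a ≤ℚ b
  *-cancelˡ {c = c} h = ℚ.*-cancelˡ-≤-pos c {{ℚ.positive h}}

  *-pos : ∀ {a b} → 0ℚ < a → 0ℚ < b → 0ℚ < a · b
  *-pos {a} {b} ha hb = ℚ.positive⁻¹ _ {{ℚ.pos*pos⇒pos a {{ℚ.positive ha}} b {{ℚ.positive hb}}}}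

  *-inv : ∀ {q} → q ≢ 0ℚ → q · inv q ≡ 1ℚ
  *-inv {q} ne with q ℚ.≟ 0ℚ
  ... | yes e = contradiction e ne
  ... | no ne′ = ℚ.*-inverseʳ q {{ℚ.≢-nonZero ne′}}

  inv-nonneg : ∀ {q} → 0ℚ ≤ℚ q → 0ℚ ≤ℚ inv q
  inv-nonneg {q} h with q ℚ.≟ 0ℚ
  ... | yes _ = ℚ.≤-refl
  ... | no ne = ℚ.<⇒≤ (ℚ.positive⁻¹ _ {{ℚ.1/pos⇒pos q {{pos}}}})
    where pos : ℚ.Positive q
          pos = ℚ.nonNeg∧nonZero⇒pos q {{ℚ.nonNegative h}} {{ℚ.≢-nonZero ne}}

  ι-0 : ι 0 ≡ 0ℚ
  ι-0 = refl

  ι-1 : ι 1 ≡ 1ℚ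
  ι-1 = refl

  toℚᵘ-ι : ∀ n → ℚ.toℚᵘ (ι n) ℚᵘ.≃ ℚᵘ.mkℚᵘ (ℤ.+ n) 0
  toℚᵘ-ι n = ℚ.toℚᵘ-fromℚᵘ (ℚᵘ.mkℚᵘ (ℤ.+ n) 0)

  ι-+ : ∀ a b → ι (a ℕ.+ b) ≡ ι a + ι b
  ι-+ a b = ℚ.toℚᵘ-injective (ℚᵘ.≃-trans (toℚᵘ-ι (a ℕ.+ b)) (ℚᵘ.≃-sym (ℚᵘ.≃-trans (ℚ.toℚᵘ-homo-+ (ι a) (ι b))
    (ℚᵘ.≃-trans (ℚᵘ.+-cong (toℚᵘ-ι a) (toℚᵘ-ι b)) (ℚᵘ.*≡* (cong₂ ℤ._*_ (cong₂ ℤ._+_ (ℤ.*-identityʳ (ℤ.+ a)) (ℤ.*-identityʳ (ℤ.+ b))) refl))))))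

  ι-* : ∀ a b → ι (a * b) ≡ ι a · ι b
  ι-* a b = ℚ.toℚᵘ-injective (ℚᵘ.≃-trans (toℚᵘ-ι (a * b)) (ℚᵘ.≃-sym (ℚᵘ.≃-trans (ℚ.toℚᵘ-homo-* (ι a) (ι b))
    (ℚᵘ.≃-trans (ℚᵘ.*-cong (toℚᵘ-ι a) (toℚᵘ-ι b)) (ℚᵘ.*≡* (cong₂ ℤ._*_ (sym (ℤ.pos-* a b)) refl))))))

  ι-mono : ∀ {a b} → a ≤ b → ι a ≤ℚ ι b
  ι-mono {a} {b} h = ℚ.toℚᵘ-cancel-≤ (ℚᵘ.≤-respˡ-≃ (ℚᵘ.≃-sym (toℚᵘ-ι a)) (ℚᵘ.≤-respʳ-≃ (ℚᵘ.≃-sym (toℚᵘ-ι b))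
    (ℚᵘ.*≤* (ℤ.*-monoʳ-≤-nonNeg (ℤ.+ 1) (ℤ.+≤+ h)))))

  ι-inj : ∀ {a b} → ι a ≡ ι b → a ≡ b
  ι-inj {a} {b} e with ℚᵘ.≃-trans (ℚᵘ.≃-sym (toℚᵘ-ι a)) (ℚᵘ.≃-trans (ℚᵘ.≃-reflexive (cong ℚ.toℚᵘ e)) (toℚᵘ-ι b))
  ... | ℚᵘ.*≡* q = ℤ.+-injective (ℤ.*-cancelʳ-≡ (ℤ.+ a) (ℤ.+ b) (ℤ.+ 1) q)

  a−b+b : ∀ a b → (a − b) + b ≡ a
  a−b+b = solve-∀ ℚ-ring

  a+b−b : ∀ a b → (a + b) − b ≡ a
  a+b−b = solve-∀ ℚ-ring

  a−a : ∀ a → a − a ≡ 0ℚ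
  a−a = solve-∀ ℚ-ring

  a−[a−b] : ∀ a b → a − (a − b) ≡ b
  a−[a−b] = solve-∀ ℚ-ring

  ·-distribˡ-− : ∀ c a b → c · (a − b) ≡ c · a − c · b
  ·-distribˡ-− = solve-∀ ℚ-ring

  −-+ : ∀ a b → − (a + b) ≡ (− a) + (− b)
  −-+ = solve-∀ ℚ-ring

  +-interchange : ∀ a b c d → (a + b) + (c + d) ≡ (a + c) + (b + d)
  +-interchange = solve-∀ ℚ-ring

  suc-· : ∀ c l → c + l · c ≡ (1ℚ + l) · c
  suc-· = solve-∀ ℚ-ring

  1−1 : 1ℚ − 1ℚ ≡ 0ℚ
  1−1 = refl

  1−0 : 1ℚ − 0ℚ ≡ 1ℚ
  1−0 = refl

  −-0 : − 0ℚ ≡ 0ℚ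
  −-0 = refl

*-monoʳ : ∀ {a b c} → 0ℚ ≤ℚ c → a ≤ℚ b → a · c ≤ℚ b · c
*-monoʳ {a} {b} {c} h p = subst₂ _≤ℚ_ (*-comm c a) (*-comm c b) (*-monoˡ h p)

*-mono : ∀ {a b c d} → 0ℚ ≤ℚ a → 0ℚ ≤ℚ d → a ≤ℚ b → c ≤ℚ d → a · c ≤ℚ b · d
*-mono ha hd p q = ≤ℚ-trans (*-monoˡ ha q) (*-monoʳ hd p)

*-nonneg : ∀ {a b} → 0ℚ ≤ℚ a → 0ℚ ≤ℚ b → 0ℚ ≤ℚ a · b
*-nonneg {a} ha hb = subst₂ _≤ℚ_ (*-zeroʳ a) refl (*-monoˡ ha hb)

+-nonneg : ∀ {a b} → 0ℚ ≤ℚ a → 0ℚ ≤ℚ b → 0ℚ ≤ℚ a + b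
+-nonneg ha hb = subst₂ _≤ℚ_ (+-identityˡ 0ℚ) refl (+-mono ha hb)

0≤b−a : ∀ {a b} → a ≤ℚ b → 0ℚ ≤ℚ b − a
0≤b−a {a} {b} h = subst₂ _≤ℚ_ (trans (sym (−-def a a)) (a−a a)) (sym (−-def b a)) (+-mono h ≤ℚ-refl)

0≤b−a⇒a≤b : ∀ {a b} → 0ℚ ≤ℚ b − a → a ≤ℚ b
0≤b−a⇒a≤b {a} {b} h = subst₂ _≤ℚ_ (+-identityˡ a) (a−b+b b a) (+-mono h (≤ℚ-refl {a}))

a−b≤a : ∀ {a b} → 0ℚ ≤ℚ b → a − b ≤ℚ a
a−b≤a {a} {b} h = 0≤b−a⇒a≤b (subst (0ℚ ≤ℚ_) (sym (a−[a−b] a b)) h)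

*-cancelˡ-≡ : ∀ {a b c} → 0ℚ < c → c · a ≡ c · b → a ≡ b
*-cancelˡ-≡ h e = ≤ℚ-antisym (*-cancelˡ h (≡⇒≤ e)) (*-cancelˡ h (≡⇒≤ (sym e)))

0<⇒≢0 : ∀ {q} → 0ℚ < q → q ≢ 0ℚ
0<⇒≢0 h e = ℚ.<-irrefl (sym e) h

nonneg∧≢0⇒pos : ∀ {q} → 0ℚ ≤ℚ q → q ≢ 0ℚ → 0ℚ < q
nonneg∧≢0⇒pos {q} h ne = ℚ.positive⁻¹ q {{ℚ.nonNeg∧nonZero⇒pos q {{ℚ.nonNegative h}} {{ℚ.≢-nonZero ne}}}}

ι-nonneg : ∀ a → 0ℚ ≤ℚ ι a
ι-nonneg a = subst (_≤ℚ ι a) ι-0 (ι-mono z≤n)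

0≤1 : 0ℚ ≤ℚ 1ℚ
0≤1 = subst (0ℚ ≤ℚ_) ι-1 (ι-nonneg 1)

ι-cancel : ∀ {a b} → ι a ≤ℚ ι b → a ≤ b
ι-cancel {a} {b} h with ℕ.≤-total a b
... | inj₁ p = p
... | inj₂ p = ℕ.≤-reflexive (ι-inj (≤ℚ-antisym h (ι-mono p)))

ι-pos : ∀ {a} → 1 ≤ a → 0ℚ < ι a
ι-pos {a} h = nonneg∧≢0⇒pos (ι-nonneg a) λ e → ℕ.<⇒≢ h (sym (ι-inj (trans e (sym ι-0))))

ι-∸ : ∀ {a b} → b ≤ a → ι (a ∸ b) ≡ ι a − ι b
ι-∸ {a} {b} h = trans (sym (a+b−b _ _)) (cong (_− ι b) (trans (sym (ι-+ (a ∸ b) b)) (cong ι (ℕ.m∸n+n≡m h))))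

ι-suc : ∀ a → ι (suc a) ≡ 1ℚ + ι a
ι-suc a = trans (ι-+ 1 a) (cong (_+ ι a) ι-1)


opaque
  𝟙 : Bool → ℚ
  𝟙 true = 1ℚ
  𝟙 false = 0ℚ

  𝟙-true : 𝟙 true ≡ 1ℚ
  𝟙-true = refl

  𝟙-false : 𝟙 false ≡ 0ℚ
  𝟙-false = refl

  𝟙-nonneg : ∀ b → 0ℚ ≤ℚ 𝟙 b
  𝟙-nonneg true = 0≤1
  𝟙-nonneg false = ≤ℚ-refl

  𝟙-≤1 : ∀ b → 𝟙 b ≤ℚ 1ℚ
  𝟙-≤1 true = ≤ℚ-refl
  𝟙-≤1 false = 0≤1

  𝟙-∧ : ∀ a b → 𝟙 (a ∧ b) ≡ 𝟙 a · 𝟙 b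
  𝟙-∧ true b = sym (*-identityˡ _)
  𝟙-∧ false b = sym (*-zeroˡ _)

  𝟙-not : ∀ a → 𝟙 (not a) ≡ 1ℚ − 𝟙 a
  𝟙-not true = sym 1−1
  𝟙-not false = sym 1−0

  𝟙-idem : ∀ a → 𝟙 a · 𝟙 a ≡ 𝟙 a
  𝟙-idem true = *-identityˡ _
  𝟙-idem false = *-zeroˡ _


-- Finite sums over lists, vertices and cells

variable
  A B : Set

∑ : List A → (A → ℚ) → ℚ
∑ [] f = 0ℚ
∑ (x ∷ xs) f = f x + ∑ xs f

∑-cong : (xs : List A) {f g : A → ℚ} → (∀ x → f x ≡ g x) → ∑ xs f ≡ ∑ xs g
∑-cong [] h = refl
∑-cong (x ∷ xs) h = cong₂ _+_ (h x) (∑-cong xs h)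

∑-0 : (xs : List A) → ∑ xs (λ _ → 0ℚ) ≡ 0ℚ
∑-0 [] = refl
∑-0 (x ∷ xs) = trans (+-identityˡ _) (∑-0 xs)

∑-+ : (xs : List A) (f g : A → ℚ) → ∑ xs (λ x → f x + g x) ≡ ∑ xs f + ∑ xs g
∑-+ [] f g = sym (+-identityˡ 0ℚ)
∑-+ (x ∷ xs) f g = trans (cong (_ +_) (∑-+ xs f g)) (+-interchange (f x) (g x) (∑ xs f) (∑ xs g))

∑-*ˡ : (xs : List A) (c : ℚ) (f : A → ℚ) → ∑ xs (λ x → c · f x) ≡ c · ∑ xs f
∑-*ˡ [] c f = sym (*-zeroʳ c)
∑-*ˡ (x ∷ xs) c f = trans (cong (_ +_) (∑-*ˡ xs c f)) (sym (distribˡ c (f x) (∑ xs f)))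

∑-*ʳ : (xs : List A) (f : A → ℚ) (c : ℚ) → ∑ xs (λ x → f x · c) ≡ ∑ xs f · c
∑-*ʳ xs f c = trans (∑-cong xs (λ x → *-comm (f x) c)) (trans (∑-*ˡ xs c f) (*-comm c _))

∑-neg : (xs : List A) (f : A → ℚ) → ∑ xs (λ x → − f x) ≡ − ∑ xs f
∑-neg [] f = sym −-0
∑-neg (x ∷ xs) f = trans (cong (_ +_) (∑-neg xs f)) (sym (−-+ (f x) (∑ xs f)))

∑-− : (xs : List A) (f g : A → ℚ) → ∑ xs (λ x → f x − g x) ≡ ∑ xs f − ∑ xs g
∑-− xs f g = trans (∑-cong xs (λ x → −-def (f x) (g x))) (trans (∑-+ xs f (λ x → − g x)) (trans (cong (_ +_) (∑-neg xs g)) (sym (−-def _ _))))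

∑-mono : (xs : List A) {f g : A → ℚ} → (∀ x → f x ≤ℚ g x) → ∑ xs f ≤ℚ ∑ xs g
∑-mono [] h = ≤ℚ-refl
∑-mono (x ∷ xs) h = +-mono (h x) (∑-mono xs h)

∑-nonneg : (xs : List A) {f : A → ℚ} → (∀ x → 0ℚ ≤ℚ f x) → 0ℚ ≤ℚ ∑ xs f
∑-nonneg xs h = subst₂ _≤ℚ_ (∑-0 xs) refl (∑-mono xs h)

∑-swap : (xs : List A) (ys : List B) (f : A → B → ℚ) → ∑ xs (λ x → ∑ ys (f x)) ≡ ∑ ys (λ y → ∑ xs (λ x → f x y))
∑-swap [] ys f = sym (∑-0 ys)
∑-swap (x ∷ xs) ys f = trans (cong (_ +_) (∑-swap xs ys f)) (sym (∑-+ ys (f x) _))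

∑-++ : (xs ys : List A) (f : A → ℚ) → ∑ (xs ++ ys) f ≡ ∑ xs f + ∑ ys f
∑-++ [] ys f = sym (+-identityˡ _)
∑-++ (x ∷ xs) ys f = trans (cong (_ +_) (∑-++ xs ys f)) (sym (+-assoc (f x) (∑ xs f) (∑ ys f)))

∑-map : (h : A → B) (xs : List A) (f : B → ℚ) → ∑ (map h xs) f ≡ ∑ xs (f ∘ h)
∑-map h [] f = refl
∑-map h (x ∷ xs) f = cong (_ +_) (∑-map h xs f)

∑-concatMap : (h : A → List B) (xs : List A) (f : B → ℚ) → ∑ (concatMap h xs) f ≡ ∑ xs (λ x → ∑ (h x) f)
∑-concatMap h [] f = refl
∑-concatMap h (x ∷ xs) f = trans (∑-++ (h x) _ f) (cong (_ +_) (∑-concatMap h xs f))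

∑-const : (xs : List A) (c : ℚ) → ∑ xs (λ _ → c) ≡ ι (length xs) · c
∑-const [] c = sym (trans (cong (_· c) ι-0) (*-zeroˡ c))
∑-const (x ∷ xs) c = trans (cong (_ +_) (∑-const xs c)) (trans (suc-· c (ι (length xs))) (cong (_· c) (sym (ι-suc (length xs)))))

opaque
  unfolding 𝟙
  ∑-filter : (p : A → Bool) (xs : List A) → ∑ xs (𝟙 ∘ p) ≡ ι (length (filterᵇ p xs))
  ∑-filter p [] = sym ι-0
  ∑-filter p (x ∷ xs) with p x
  ... | true = trans (cong (_ +_) (∑-filter p xs)) (sym (ι-suc _))
  ... | false = trans (+-identityˡ _) (∑-filter p xs)

module _ (_≟_ : (x y : A) → Dec (x ≡ y)) where

  opaque
    unfolding 𝟙
    ∑-δ∉ : ∀ {y} {xs : List A} (f : A → ℚ) → All (y ≢_) xs → ∑ xs (λ x → 𝟙 (does (x ≟ y)) · f x) ≡ 0ℚ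
    ∑-δ∉ f [] = refl
    ∑-δ∉ {y} {x ∷ xs} f (p ∷ ps) rewrite dec-false (x ≟ y) (p ∘ sym) = trans (cong₂ _+_ (*-zeroˡ (f x)) (∑-δ∉ f ps)) (+-identityˡ 0ℚ)

    ∑-δ : ∀ {y} {xs : List A} (f : A → ℚ) → Unique xs → y ∈ xs → ∑ xs (λ x → 𝟙 (does (x ≟ y)) · f x) ≡ f y
    ∑-δ {y} {x ∷ xs} f (u ∷ us) (here refl) rewrite dec-true (x ≟ x) refl = trans (cong₂ _+_ (*-identityˡ (f x)) (∑-δ∉ f u)) (+-identityʳ _)
    ∑-δ {y} {x ∷ xs} f (u ∷ us) (there q) rewrite dec-false (x ≟ y) (All.lookup u q) = trans (cong₂ _+_ (*-zeroˡ (f x)) (∑-δ f us q)) (+-identityˡ _)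

allEdges≡ : ∀ r m → allEdges (suc r) m ≡ cartesianProductWith _∷_ (allFin m) (allEdges r m)
allEdges≡ r m = go (allFin m)
  where go : ∀ xs → concatMap (λ v → map (v ∷_) (allEdges r m)) xs ≡ cartesianProductWith _∷_ xs (allEdges r m)
        go [] = refl
        go (x ∷ xs) = cong (map (x ∷_) (allEdges r m) ++_) (go xs)

allEdges-unique : ∀ r m → Unique (allEdges r m)
allEdges-unique zero m = [] ∷ []
allEdges-unique (suc r) m = subst Unique (sym (allEdges≡ r m))
  (Unique.cartesianProductWith⁺ _∷_ Vec.∷-injective (Unique.allFin⁺ m) (allEdges-unique r m))

allEdges-complete : ∀ {r m} (c : Vec (Fin m) r) → c ∈ allEdges r m
allEdges-complete [] = here refl
allEdges-complete {suc r} {m} (v ∷ c) = subst (v ∷ c ∈_) (sym (allEdges≡ r m))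
  (Membership.∈-cartesianProductWith⁺ _∷_ (Membership.∈-allFin v) (allEdges-complete c))

∑-δᶠ : ∀ {m} (y : Fin m) (f : Fin m → ℚ) → ∑ (allFin m) (λ x → 𝟙 (does (x ≟ᶠ y)) · f x) ≡ f y
∑-δᶠ {m} y f = ∑-δ _≟ᶠ_ f (Unique.allFin⁺ m) (Membership.∈-allFin y)

∑-allEdges-suc : ∀ {r m} (g : Vec (Fin m) (suc r) → ℚ) →
  ∑ (allEdges (suc r) m) g ≡ ∑ (allFin m) (λ v → ∑ (allEdges r m) (λ c → g (v ∷ c)))
∑-allEdges-suc {r} {m} g = trans (∑-concatMap _ (allFin m) g) (∑-cong (allFin m) λ v → ∑-map (v ∷_) (allEdges r m) g)

length-allFin : ∀ m → length (allFin m) ≡ m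
length-allFin m = List.length-tabulate {n = m} id

-- Replacing the coordinate l forgets its old value, so every cell arises from exactly m pairs (c,
-- x).
∑-update : ∀ {r m} (l : Fin r) (g : Vec (Fin m) r → ℚ) →
  ∑ (allEdges r m) (λ c → ∑ (allFin m) (λ x → g (c [ l ]≔ x))) ≡ ι m · ∑ (allEdges r m) g
∑-update {suc r} {m} zero g = begin
  ∑ (allEdges (suc r) m) (λ c → ∑ (allFin m) (λ x → g (c [ zero ]≔ x)))
    ≡⟨ ∑-allEdges-suc {r} {m} (λ c → ∑ (allFin m) (λ x → g (c [ zero ]≔ x))) ⟩
  ∑ (allFin m) (λ v → ∑ (allEdges r m) (λ c → ∑ (allFin m) (λ x → g (x ∷ c))))
    ≡⟨ ∑-const (allFin m) _ ⟩
  ι (length (allFin m)) · ∑ (allEdges r m) (λ c → ∑ (allFin m) (λ x → g (x ∷ c)))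
    ≡⟨ cong₂ _·_ (cong ι (length-allFin m)) (trans (∑-swap (allEdges r m) (allFin m) _) (sym (∑-allEdges-suc g))) ⟩
  ι m · ∑ (allEdges (suc r) m) g ∎
  where open ≡-Reasoning
∑-update {suc r} {m} (suc l) g = begin
  ∑ (allEdges (suc r) m) (λ c → ∑ (allFin m) (λ x → g (c [ suc l ]≔ x)))
    ≡⟨ ∑-allEdges-suc {r} {m} (λ c → ∑ (allFin m) (λ x → g (c [ suc l ]≔ x))) ⟩
  ∑ (allFin m) (λ v → ∑ (allEdges r m) (λ c → ∑ (allFin m) (λ x → g (v ∷ (c [ l ]≔ x)))))
    ≡⟨ ∑-cong (allFin m) (λ v → ∑-update l (λ c → g (v ∷ c))) ⟩
  ∑ (allFin m) (λ v → ι m · ∑ (allEdges r m) (λ c → g (v ∷ c)))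
    ≡⟨ ∑-*ˡ (allFin m) (ι m) _ ⟩
  ι m · ∑ (allFin m) (λ v → ∑ (allEdges r m) (λ c → g (v ∷ c)))
    ≡⟨ cong (ι m ·_) (sym (∑-allEdges-suc g)) ⟩
  ι m · ∑ (allEdges (suc r) m) g ∎
  where open ≡-Reasoning

length-allEdges : ∀ r m → length (allEdges r m) ≡ m ^ r
length-allEdges r m = ι-inj (trans (e (allEdges r m)) (go r))
  where
  e : ∀ {A : Set} (xs : List A) → ι (length xs) ≡ ∑ xs (λ _ → 1ℚ)
  e xs = sym (trans (∑-const xs 1ℚ) (*-identityʳ _))
  go : ∀ r → ∑ (allEdges r m) (λ _ → 1ℚ) ≡ ι (m ^ r)
  go zero = trans (+-identityʳ 1ℚ) (sym ι-1)
  go (suc r) = trans (∑-allEdges-suc {r} {m} (λ _ → 1ℚ)) (trans (∑-const (allFin m) _)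
    (trans (cong₂ _·_ (cong ι (length-allFin m)) (go r)) (sym (ι-* m (m ^ r)))))

-- Sums over the subsets of a list

module Subsets {A : Set} (_≟_ : (x y : A) → Dec (x ≡ y)) where

  infixr 5 _⊕_

  _⊕_ : A → (A → Bool) → (A → Bool)
  (x ⊕ E) c = does (c ≟ x) ∨ E c

  ind : List A → (A → Bool)
  ind [] c = false
  ind (y ∷ ys) = y ⊕ ind ys

  -- Edge sets are predicates, and predicates that agree pointwise need not be propositionally
  -- equal; a functional that is to be transported along a bijection has to respect pointwise
  -- agreement.
  Ext : ((A → Bool) → ℚ) → Set
  Ext F = ∀ {E E′} → (∀ c → E c ≡ E′ c) → F E ≡ F E′

  𝕊 : List A → ((A → Bool) → ℚ) → ℚ
  𝕊 xs F = ∑ (subsets xs) (F ∘ ind)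

  𝕊-∷ : ∀ x xs F → 𝕊 (x ∷ xs) F ≡ 𝕊 xs F + 𝕊 xs (λ E → F (x ⊕ E))
  𝕊-∷ x xs F = trans (∑-++ (subsets xs) _ _) (cong (𝕊 xs F +_) (∑-map (x ∷_) (subsets xs) _))

  ⊕-comm : ∀ x y E c → (x ⊕ y ⊕ E) c ≡ (y ⊕ x ⊕ E) c
  ⊕-comm x y E c with does (c ≟ x) | does (c ≟ y)
  ... | true  | true  = refl
  ... | true  | false = refl
  ... | false | true  = refl
  ... | false | false = refl

  ⊕-ext : ∀ {F} x → Ext F → Ext (λ E → F (x ⊕ E))
  ⊕-ext x ext h = ext (λ c → cong (does (c ≟ x) ∨_) (h c))

  -- Together with `𝕊-map` this makes sums over edge sets invariant under involutions of the ground
  -- set, which is how every switching below acts.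
  𝕊-↭ : ∀ {xs ys F} → Ext F → xs ↭ ys → 𝕊 xs F ≡ 𝕊 ys F
  𝕊-↭ ext Perm.refl = refl
  𝕊-↭ {F = F} ext (Perm.prep {xs} {ys} x p) = trans (𝕊-∷ x xs F)
    (trans (cong₂ _+_ (𝕊-↭ ext p) (𝕊-↭ (⊕-ext x ext) p)) (sym (𝕊-∷ x ys F)))
  𝕊-↭ {F = F} ext (Perm.swap {xs} {ys} x y p) = begin
    𝕊 (x ∷ y ∷ xs) F
      ≡⟨ split x y xs ⟩
    (𝕊 xs F + 𝕊 xs (λ E → F (y ⊕ E))) + (𝕊 xs (λ E → F (x ⊕ E)) + 𝕊 xs (λ E → F (x ⊕ y ⊕ E)))
      ≡⟨ +-interchange _ _ _ _ ⟩
    (𝕊 xs F + 𝕊 xs (λ E → F (x ⊕ E))) + (𝕊 xs (λ E → F (y ⊕ E)) + 𝕊 xs (λ E → F (x ⊕ y ⊕ E)))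
      ≡⟨ cong₂ _+_ (cong₂ _+_ (𝕊-↭ ext p) (𝕊-↭ (⊕-ext x ext) p))
                   (cong₂ _+_ (𝕊-↭ (⊕-ext y ext) p)
                     (trans (∑-cong (subsets xs) (λ zs → ext (⊕-comm x y (ind zs)))) (𝕊-↭ (⊕-ext x (⊕-ext y ext)) p))) ⟩
    (𝕊 ys F + 𝕊 ys (λ E → F (x ⊕ E))) + (𝕊 ys (λ E → F (y ⊕ E)) + 𝕊 ys (λ E → F (y ⊕ x ⊕ E)))
      ≡⟨ sym (split y x ys) ⟩
    𝕊 (y ∷ x ∷ ys) F ∎
    where
    open ≡-Reasoning
    split : ∀ x y xs → 𝕊 (x ∷ y ∷ xs) F ≡
      (𝕊 xs F + 𝕊 xs (λ E → F (y ⊕ E))) + (𝕊 xs (λ E → F (x ⊕ E)) + 𝕊 xs (λ E → F (x ⊕ y ⊕ E)))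
    split x y xs = trans (𝕊-∷ x (y ∷ xs) F) (cong₂ _+_ (𝕊-∷ y xs F) (𝕊-∷ y xs (λ E → F (x ⊕ E))))
  𝕊-↭ ext (Perm.trans p q) = trans (𝕊-↭ ext p) (𝕊-↭ ext q)

  𝕊-map : ∀ (σ : A → A) → (∀ c → σ (σ c) ≡ c) → ∀ xs {F} → Ext F → 𝕊 (map σ xs) F ≡ 𝕊 xs (λ E → F (E ∘ σ))
  𝕊-map σ σσ [] ext = refl
  𝕊-map σ σσ (x ∷ xs) {F} ext = trans (𝕊-∷ (σ x) (map σ xs) F) (trans
    (cong₂ _+_ (𝕊-map σ σσ xs ext)
      (trans (𝕊-map σ σσ xs (⊕-ext (σ x) ext)) (∑-cong (subsets xs) (λ zs → ext (λ c → cong (_∨ ind zs (σ c)) (e c))))))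
    (sym (𝕊-∷ x xs (λ E → F (E ∘ σ)))))
    where e : ∀ c → does (c ≟ σ x) ≡ does (σ c ≟ x)
          e c with c ≟ σ x | σ c ≟ x
          ... | yes _ | yes _ = refl
          ... | no _  | no _  = refl
          ... | yes p | no q  = contradiction (trans (cong σ p) (σσ x)) q
          ... | no p  | yes q = contradiction (trans (sym (σσ c)) (cong σ q)) p

  opaque
    -- The transposition of u and u′. Composing E with it moves an edge from u to u′ or back when
    -- exactly one of them is present and changes nothing otherwise, so it is a bijection on all
    -- edge sets, without side conditions.
    τ : A → A → A → A
    τ u u′ c = if does (c ≟ u) then u′ else (if does (c ≟ u′) then u else c)

    τ-at : ∀ {u u′ c} → c ≡ u → τ u u′ c ≡ u′
    τ-at {u} {u′} {c} e rewrite dec-true (c ≟ u) e = refl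

    τ-at′ : ∀ {u u′ c} → c ≡ u′ → τ u u′ c ≡ u
    τ-at′ {u} {u′} {c} e with c ≟ u
    ... | yes p = trans (sym e) p
    ... | no _ rewrite dec-true (c ≟ u′) e = refl

    τ-off : ∀ {u u′ c} → c ≢ u → c ≢ u′ → τ u u′ c ≡ c
    τ-off {u} {u′} {c} p q rewrite dec-false (c ≟ u) p | dec-false (c ≟ u′) q = refl

    τ-invol : ∀ u u′ c → τ u u′ (τ u u′ c) ≡ c
    τ-invol u u′ c = by (c ≟ u) (c ≟ u′)
      where
      by : Dec (c ≡ u) → Dec (c ≡ u′) → τ u u′ (τ u u′ c) ≡ c
      by (yes p) _ = trans (τ-at′ (τ-at p)) (sym p)
      by (no p) (yes q) = trans (τ-at (τ-at′ q)) (sym q)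
      by (no p) (no q) = trans (cong (τ u u′) (τ-off p q)) (τ-off p q)

  opaque
    unfolding τ 𝟙
    -- The linear form is valid in all cases, including u = u′, so the effect of a move on degrees
    -- and sizes follows by summation.
    τ-𝟙 : ∀ (E : A → Bool) u u′ c →
      𝟙 (E (τ u u′ c)) ≡ 𝟙 (E c) + (𝟙 (does (c ≟ u)) − 𝟙 (does (c ≟ u′))) · (𝟙 (E u′) − 𝟙 (E u))
    τ-𝟙 E u u′ c with c ≟ u | c ≟ u′
    ... | yes refl | yes refl = e _
      where opaque
              unfolding _+_
              e : ∀ a → a ≡ a + (1ℚ − 1ℚ) · (a − a)
              e = solve-∀ ℚ-ring
    ... | yes refl | no _ = e _ _
      where opaque
              unfolding _+_
              e : ∀ a b → b ≡ a + (1ℚ − 0ℚ) · (b − a)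
              e = solve-∀ ℚ-ring
    ... | no _ | yes refl = e _ _
      where opaque
              unfolding _+_
              e : ∀ a b → b ≡ a + (0ℚ − 1ℚ) · (a − b)
              e = solve-∀ ℚ-ring
    ... | no _ | no _ = e _ _
      where opaque
              unfolding _+_
              e : ∀ a b → a ≡ a + (0ℚ − 0ℚ) · b
              e = solve-∀ ℚ-ring

  module _ {xs : List A} (uniq : Unique xs) (complete : ∀ c → c ∈ xs) where

    τ-↭ : ∀ u u′ → map (τ u u′) xs ↭ xs
    τ-↭ u u′ = ∼bag⇒↭ (unique∧set⇒bag (Unique.map⁺ inj uniq) uniq (λ {v} → mk⇔ (λ _ → complete v)
      (λ _ → subst (_∈ map (τ u u′) xs) (τ-invol u u′ v) (Membership.∈-map⁺ (τ u u′) (complete (τ u u′ v))))))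
      where inj : ∀ {x y} → τ u u′ x ≡ τ u u′ y → x ≡ y
            inj {x} {y} e = trans (sym (τ-invol u u′ x)) (trans (cong (τ u u′) e) (τ-invol u u′ y))

    𝕊-τ : ∀ u u′ {F} → Ext F → 𝕊 xs (λ E → F (E ∘ τ u u′)) ≡ 𝕊 xs F
    𝕊-τ u u′ ext = trans (sym (𝕊-map (τ u u′) (τ-invol u u′) xs ext)) (𝕊-↭ ext (τ-↭ u u′))

    ∑-τ : ∀ (E : A → Bool) u u′ (g : A → ℚ) →
      ∑ xs (λ c → 𝟙 (E (τ u u′ c)) · g c) ≡ ∑ xs (λ c → 𝟙 (E c) · g c) + (g u − g u′) · (𝟙 (E u′) − 𝟙 (E u))
    ∑-τ E u u′ g = begin
      ∑ xs (λ c → 𝟙 (E (τ u u′ c)) · g c)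
        ≡⟨ ∑-cong xs (λ c → trans (cong (_· g c) (τ-𝟙 E u u′ c)) (e _ _ _ _ _)) ⟩
      ∑ xs (λ c → 𝟙 (E c) · g c + (𝟙 (does (c ≟ u)) · (g c · D) − 𝟙 (does (c ≟ u′)) · (g c · D)))
        ≡⟨ trans (∑-+ xs _ _) (cong (_ +_) (∑-− xs _ _)) ⟩
      ∑ xs (λ c → 𝟙 (E c) · g c) + (∑ xs (λ c → 𝟙 (does (c ≟ u)) · (g c · D)) − ∑ xs (λ c → 𝟙 (does (c ≟ u′)) · (g c · D)))
        ≡⟨ cong (_ +_) (cong₂ _−_ (∑-δ _≟_ (λ c → g c · D) uniq (complete u)) (∑-δ _≟_ (λ c → g c · D) uniq (complete u′))) ⟩
      ∑ xs (λ c → 𝟙 (E c) · g c) + (g u · D − g u′ · D)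
        ≡⟨ cong (_ +_) (sym (e′ _ _ _)) ⟩
      ∑ xs (λ c → 𝟙 (E c) · g c) + (g u − g u′) · D ∎
      where
      open ≡-Reasoning
      D = 𝟙 (E u′) − 𝟙 (E u)
      opaque
        unfolding _+_
        e : ∀ a b c d g → (a + (b − c) · d) · g ≡ a · g + (b · (g · d) − c · (g · d))
        e = solve-∀ ℚ-ring
        e′ : ∀ a b d → (a − b) · d ≡ a · d − b · d
        e′ = solve-∀ ℚ-ring

∑-congᴬ : {P : A → Set} {xs : List A} {f g : A → ℚ} → All P xs → (∀ x → P x → f x ≡ g x) → ∑ xs f ≡ ∑ xs g
∑-congᴬ [] h = refl
∑-congᴬ (p ∷ ps) h = cong₂ _+_ (h _ p) (∑-congᴬ ps h)

∑-monoᴬ : {P : A → Set} {xs : List A} {f g : A → ℚ} → All P xs → (∀ x → P x → f x ≤ℚ g x) → ∑ xs f ≤ℚ ∑ xs g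
∑-monoᴬ [] h = ≤ℚ-refl
∑-monoᴬ (p ∷ ps) h = +-mono (h _ p) (∑-monoᴬ ps h)

opaque
  unfolding 𝟙
  ∑-filter? : {P : A → Set} (P? : ∀ x → Dec (P x)) (xs : List A) (g : A → ℚ) →
    ∑ (filter P? xs) g ≡ ∑ xs (λ x → 𝟙 (does (P? x)) · g x)
  ∑-filter? P? [] g = refl
  ∑-filter? P? (x ∷ xs) g with P? x
  ... | yes _ = cong₂ _+_ (sym (*-identityˡ _)) (∑-filter? P? xs g)
  ... | no _ = trans (sym (+-identityˡ _)) (cong₂ _+_ (sym (*-zeroˡ _)) (∑-filter? P? xs g))

0·≡0· : ∀ {a} x y → a ≡ 0ℚ → a · x ≡ a · y
0·≡0· x y refl = trans (*-zeroˡ x) (sym (*-zeroˡ y))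

lookup-[]≔ : ∀ {n} (c : Vec A n) l x → lookup (c [ l ]≔ x) l ≡ x
lookup-[]≔ c l x = lookup∘update l c x

does-sym : ∀ {n} (x y : Fin n) → does (x ≟ᶠ y) ≡ does (y ≟ᶠ x)
does-sym x y with x ≟ᶠ y | y ≟ᶠ x
... | yes _ | yes _ = refl
... | no _  | no _  = refl
... | yes p | no q  = contradiction (sym p) q
... | no p  | yes q = contradiction (sym q) p

-- Cells, unnormalised expectations, and degrees

module Space (r m : ℕ) where

  Cell : Set
  Cell = Vec (Fin m) r

  _≟ᶜ_ : (x y : Cell) → Dec (x ≡ y)
  _≟ᶜ_ = ≡-dec _≟ᶠ_

  open Subsets _≟ᶜ_ public

  cells : List Cell
  cells = allEdges r m

  opaque
    -- Unnormalised: the expectation of 1 is the total weight. Counts of edge sets are thus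
    -- expectations too, and nothing is ever divided by a total weight that might vanish.
    𝔼 : ((Cell → Bool) → ℚ) → ((Cell → Bool) → ℚ) → ℚ
    𝔼 ω X = 𝕊 cells (λ E → ω E · X E)

    𝔼-cong : ∀ {ω X Y} → (∀ E → X E ≡ Y E) → 𝔼 ω X ≡ 𝔼 ω Y
    𝔼-cong {ω} h = ∑-cong (subsets cells) (λ ys → cong (ω (ind ys) ·_) (h (ind ys)))

    -- Conditioning enters in this form: identities that use prescribed degrees have to hold only
    -- where the weight does not vanish.
    𝔼-supp : ∀ {ω X Y} → (∀ E → ω E ≡ 0ℚ ⊎ X E ≡ Y E) → 𝔼 ω X ≡ 𝔼 ω Y
    𝔼-supp {ω} {X} {Y} h = ∑-cong (subsets cells) (λ ys → go (ind ys) (h (ind ys)))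
      where go : ∀ E → ω E ≡ 0ℚ ⊎ X E ≡ Y E → ω E · X E ≡ ω E · Y E
            go E (inj₁ e) = 0·≡0· _ _ e
            go E (inj₂ e) = cong (ω E ·_) e

    𝔼-mono : ∀ {ω X Y} → (∀ E → 0ℚ ≤ℚ ω E) → (∀ E → ω E ≡ 0ℚ ⊎ X E ≤ℚ Y E) → 𝔼 ω X ≤ℚ 𝔼 ω Y
    𝔼-mono {ω} {X} {Y} nn h = ∑-mono (subsets cells) (λ ys → go (ind ys) (h (ind ys)))
      where go : ∀ E → ω E ≡ 0ℚ ⊎ X E ≤ℚ Y E → ω E · X E ≤ℚ ω E · Y E
            go E (inj₁ e) = ≡⇒≤ (0·≡0· _ _ e)
            go E (inj₂ e) = *-monoˡ (nn E) e

    𝔼-+ : ∀ {ω} X Y → 𝔼 ω (λ E → X E + Y E) ≡ 𝔼 ω X + 𝔼 ω Y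
    𝔼-+ {ω} X Y = trans (∑-cong (subsets cells) (λ ys → distribˡ _ _ _)) (∑-+ (subsets cells) _ _)

    𝔼-− : ∀ {ω} X Y → 𝔼 ω (λ E → X E − Y E) ≡ 𝔼 ω X − 𝔼 ω Y
    𝔼-− {ω} X Y = trans (∑-cong (subsets cells) (λ ys → ·-distribˡ-− _ _ _)) (∑-− (subsets cells) _ _)

    𝔼-· : ∀ {ω} c X → 𝔼 ω (λ E → c · X E) ≡ c · 𝔼 ω X
    𝔼-· {ω} c X = trans (∑-cong (subsets cells) (λ ys → e _ _ _)) (∑-*ˡ (subsets cells) c _)
      where opaque
              unfolding _+_
              e : ∀ w c x → w · (c · x) ≡ c · (w · x)
              e = solve-∀ ℚ-ring

    𝔼-∑ : ∀ {ω} {B : Set} (xs : List B) (X : B → (Cell → Bool) → ℚ) → 𝔼 ω (λ E → ∑ xs (λ x → X x E)) ≡ ∑ xs (λ x → 𝔼 ω (X x))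
    𝔼-∑ {ω} xs X = trans (∑-cong (subsets cells) (λ ys → sym (∑-*ˡ xs _ _))) (∑-swap (subsets cells) xs _)

    𝔼-τ : ∀ {ω X} u u′ → Ext (λ E → ω E · X E) → 𝔼 (λ E → ω (E ∘ τ u u′)) (λ E → X (E ∘ τ u u′)) ≡ 𝔼 ω X
    𝔼-τ u u′ ext = 𝕊-τ (allEdges-unique r m) allEdges-complete u u′ ext

    𝔼-weight : ∀ {ω ω′ X Y} → (∀ E → ω E · X E ≡ ω′ E · Y E) → 𝔼 ω X ≡ 𝔼 ω′ Y
    𝔼-weight h = ∑-cong (subsets cells) (λ ys → h (ind ys))

  𝔼-nonneg : ∀ {ω X} → (∀ E → 0ℚ ≤ℚ ω E) → (∀ E → ω E ≡ 0ℚ ⊎ 0ℚ ≤ℚ X E) → 0ℚ ≤ℚ 𝔼 ω X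
  𝔼-nonneg {ω} nn h = subst₂ _≤ℚ_ (trans (𝔼-· 0ℚ (λ _ → 0ℚ)) (*-zeroˡ _)) refl
    (𝔼-mono {ω} nn (λ E → Sum.map₂ (λ p → subst₂ _≤ℚ_ (sym (*-zeroˡ 0ℚ)) refl p) (h E)))

  module _ {k : Fin r} {a a′ : Fin m} (a≢a′ : a ≢ a′) where

    ≔-≢ : ∀ {e f : Cell} → lookup e k ≡ a → e ≢ f [ k ]≔ a′
    ≔-≢ {e} {f} p q = a≢a′ (trans (sym p) (trans (cong (λ c → lookup c k) q) (lookup-[]≔ f k a′)))

    ≔-inj : ∀ {e f : Cell} → lookup e k ≡ a → lookup f k ≡ a → e [ k ]≔ a′ ≡ f [ k ]≔ a′ → e ≡ f
    ≔-inj {e} {f} p q eq = trans (sym (back p)) (trans (cong (_[ k ]≔ a) eq) (back q))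
      where back : ∀ {e : Cell} → lookup e k ≡ a → (e [ k ]≔ a′) [ k ]≔ a ≡ e
            back {e} p = trans ([]≔-idempotent e k) (trans (cong (e [ k ]≔_) (sym p)) ([]≔-lookup e k))

  at : Fin r → Fin m → Cell → ℚ
  at l v c = 𝟙 (does (lookup c l ≟ᶠ v))

  opaque
    unfolding 𝟙
    at-yes : ∀ {l v c} → lookup c l ≡ v → at l v c ≡ 1ℚ
    at-yes {l} {v} {c} e rewrite dec-true (lookup c l ≟ᶠ v) e = refl

    at-no : ∀ {l v c} → lookup c l ≢ v → at l v c ≡ 0ℚ
    at-no {l} {v} {c} e rewrite dec-false (lookup c l ≟ᶠ v) e = refl

  at-update : ∀ {l l′ x v} {c : Cell} → l′ ≢ l → at l′ v (c [ l ]≔ x) ≡ at l′ v c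
  at-update {l} {l′} {x} {v} {c} ne = cong (λ y → 𝟙 (does (y ≟ᶠ v))) (lookup∘update′ ne c x)

  -- The vertex v of class l, as the list of the cells containing it.
  hyper : Fin r → Fin m → List Cell
  hyper l v = filter (λ c → lookup c l ≟ᶠ v) cells

  hyper-at : ∀ l v → All (λ c → lookup c l ≡ v) (hyper l v)
  hyper-at l v = All.all-filter (λ c → lookup c l ≟ᶠ v) cells

  ∑-hyper : ∀ l v g → ∑ (hyper l v) g ≡ ∑ cells (λ c → at l v c · g c)
  ∑-hyper l v g = ∑-filter? (λ c → lookup c l ≟ᶠ v) cells g

  ∑-hyper-all : ∀ l g → ∑ (allFin m) (λ v → ∑ (hyper l v) g) ≡ ∑ cells g
  ∑-hyper-all l g = trans (∑-cong (allFin m) (λ v → ∑-hyper l v g)) (trans (∑-swap (allFin m) cells _)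
    (∑-cong cells (λ c → trans (∑-cong (allFin m) (λ v → cong (_· g c) (cong 𝟙 (does-sym (lookup c l) v)))) (∑-δᶠ (lookup c l) (λ _ → g c)))))

  ∑-hyper-update : ∀ l v g → ι m · ∑ (hyper l v) g ≡ ∑ cells (λ c → g (c [ l ]≔ v))
  ∑-hyper-update l v g = trans (cong (ι m ·_) (∑-hyper l v g)) (trans (sym (∑-update l (λ c → at l v c · g c)))
    (∑-cong cells (λ c → trans (∑-cong (allFin m) (λ x → cong (λ y → 𝟙 (does (y ≟ᶠ v)) · g (c [ l ]≔ x)) (lookup-[]≔ c l x)))
      (∑-δᶠ v (λ x → g (c [ l ]≔ x))))))

  ι-m-pos : Fin m → 0ℚ < ι m
  ι-m-pos v = ι-pos (ℕ.≤-trans (s≤s z≤n) (Fin.toℕ<n v))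

  -- Moving the l-th coordinate is a bijection from the cells at v to those at v′. Multiplied by m,
  -- both sides become the same sum over all cells.
  ∑-hyper-move : ∀ l v v′ g → ∑ (hyper l v) (λ c → g (c [ l ]≔ v′)) ≡ ∑ (hyper l v′) g
  ∑-hyper-move l v v′ g = *-cancelˡ-≡ (ι-m-pos v) (trans (∑-hyper-update l v (λ c → g (c [ l ]≔ v′)))
    (trans (∑-cong cells (λ c → cong g ([]≔-idempotent c l))) (sym (∑-hyper-update l v′ g))))

  hyper-unique : ∀ l v → Unique (hyper l v)
  hyper-unique l v = Unique.filter⁺ (λ c → lookup c l ≟ᶠ v) (allEdges-unique r m)

  ∈-hyper : ∀ {l v c} → lookup c l ≡ v → c ∈ hyper l v
  ∈-hyper {l} {v} e = Membership.∈-filter⁺ (λ c → lookup c l ≟ᶠ v) (allEdges-complete _) e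

  ∑-δ-hyper : ∀ {l v e} (g : Cell → ℚ) → lookup e l ≡ v → ∑ (hyper l v) (λ c → 𝟙 (does (c ≟ᶜ e)) · g c) ≡ g e
  ∑-δ-hyper {l} {v} g p = ∑-δ _≟ᶜ_ g (hyper-unique l v) (∈-hyper p)

  deg : (Cell → Bool) → Fin r → Fin m → ℕ
  deg E l v = length (filterᵇ (λ c → E c ∧ does (lookup c l ≟ᶠ v)) cells)

  size : (Cell → Bool) → ℕ
  size E = length (filterᵇ E cells)

  ι-deg : ∀ E l v → ι (deg E l v) ≡ ∑ cells (λ c → 𝟙 (E c) · at l v c)
  ι-deg E l v = trans (sym (∑-filter _ cells)) (∑-cong cells (λ c → 𝟙-∧ (E c) _))

  ι-deg′ : ∀ E l v → ι (deg E l v) ≡ ∑ (hyper l v) (𝟙 ∘ E)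
  ι-deg′ E l v = trans (ι-deg E l v) (trans (∑-cong cells (λ c → *-comm _ _)) (sym (∑-hyper l v _)))

  ι-size : ∀ E → ι (size E) ≡ ∑ cells (𝟙 ∘ E)
  ι-size E = sym (∑-filter E cells)

  ι-size-deg : ∀ E l → ι (size E) ≡ ∑ (allFin m) (λ v → ι (deg E l v))
  ι-size-deg E l = trans (ι-size E) (trans (sym (∑-hyper-all l _)) (∑-cong (allFin m) (λ v → sym (ι-deg′ E l v))))

  deg-ext : ∀ {E E′} → (∀ c → E c ≡ E′ c) → ∀ l v → deg E l v ≡ deg E′ l v
  deg-ext h l v = ι-inj (trans (ι-deg _ l v) (trans (∑-cong cells (λ c → cong (λ b → 𝟙 b · at l v c) (h c))) (sym (ι-deg _ l v))))

  size-ext : ∀ {E E′} → (∀ c → E c ≡ E′ c) → size E ≡ size E′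
  size-ext h = ι-inj (trans (ι-size _) (trans (∑-cong cells (λ c → cong 𝟙 (h c))) (sym (ι-size _))))

  ι-deg-τ : ∀ E u u′ l v → ι (deg (E ∘ τ u u′) l v) ≡ ι (deg E l v) + (at l v u − at l v u′) · (𝟙 (E u′) − 𝟙 (E u))
  ι-deg-τ E u u′ l v = trans (ι-deg _ l v) (trans (∑-τ (allEdges-unique r m) allEdges-complete E u u′ (at l v)) (cong₂ _+_ (sym (ι-deg E l v)) refl))

  opaque
    unfolding _+_
    cancel-τ : ∀ a b c → a + (b − b) · c ≡ a
    cancel-τ = solve-∀ ℚ-ring

  deg-τ-same : ∀ E u u′ l v → at l v u ≡ at l v u′ → deg (E ∘ τ u u′) l v ≡ deg E l v
  deg-τ-same E u u′ l v e = ι-inj (trans (ι-deg-τ E u u′ l v) (trans (cong (λ z → _ + (z − _) · _) e) (cancel-τ _ _ _)))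

  size-τ : ∀ E u u′ → size (E ∘ τ u u′) ≡ size E
  size-τ E u u′ = ι-inj (trans (ι-size _) (trans (∑-cong cells (λ c → sym (*-identityʳ _)))
    (trans (∑-τ (allEdges-unique r m) allEdges-complete E u u′ (λ _ → 1ℚ)) (trans (cancel-τ _ _ _)
    (trans (∑-cong cells (λ c → *-identityʳ _)) (sym (ι-size _)))))))

-- Pairs of edges, and agreement in a free class

module Steps (r m : ℕ) where
  open Space r m public

  -- A weight on pairs of cells that has not looked at class k yet. Independence of the k-th
  -- coordinates and the vanishing diagonal together force two weighted cells to stay different
  -- however their k-th coordinates change, so one can be moved in class k without touching the
  -- other.
  record Kernel (k : Fin r) (κ : Cell → Cell → ℚ) : Set where
    field
      indepˡ : ∀ e f x → κ (e [ k ]≔ x) f ≡ κ e f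
      indepʳ : ∀ e f x → κ e (f [ k ]≔ x) ≡ κ e f
      diag : ∀ e → κ e e ≡ 0ℚ
      nonneg : ∀ e f → 0ℚ ≤ℚ κ e f

    diag′ : ∀ {e f} x → κ e f ≢ 0ℚ → f ≢ e [ k ]≔ x
    diag′ {e} {f} x ne eq = ne (trans (cong (κ e) eq) (trans (indepʳ e e x) (diag e)))

  same : Fin r → Cell → Cell → ℚ
  same k e f = at k (lookup f k) e

  ∑∑ : (Cell → Cell → ℚ) → ℚ
  ∑∑ h = ∑ cells (λ e → ∑ cells (h e))

  pairs : (Cell → Cell → ℚ) → (Cell → Bool) → ℚ
  pairs κ E = ∑∑ (λ e f → κ e f · (𝟙 (E e) · 𝟙 (E f)))

  _∩same_ : (Cell → Cell → ℚ) → Fin r → Cell → Cell → ℚ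
  (κ ∩same k) e f = κ e f · same k e f

  𝔼-pairs : ∀ ω κ → 𝔼 ω (pairs κ) ≡ ∑∑ (λ e f → κ e f · 𝔼 ω (λ E → 𝟙 (E e) · 𝟙 (E f)))
  𝔼-pairs ω κ = trans (𝔼-∑ cells _) (∑-cong cells (λ e → trans (𝔼-∑ cells _) (∑-cong cells (λ f → 𝔼-· (κ e f) _))))

  -- Holds for the conditional measures when neither x nor y has a prescribed degree.
  FreeMove : ((Cell → Bool) → ℚ) → Fin r → Fin m → Fin m → Set
  FreeMove ω l x y = ∀ E c → lookup c l ≡ x → ω (E ∘ τ c (c [ l ]≔ y)) ≡ ω E

  pair-ext : ∀ {ω} → Ext ω → ∀ e f → Ext (λ E → ω E · (𝟙 (E e) · 𝟙 (E f)))
  pair-ext ext e f h = cong₂ _·_ (ext h) (cong₂ (λ x y → 𝟙 x · 𝟙 y) (h e) (h f))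

  free-pair : ∀ {ω l x y} → Ext ω → FreeMove ω l x y → ∀ {e f} → lookup e l ≡ x → f ≢ e → f ≢ e [ l ]≔ y →
    𝔼 ω (λ E → 𝟙 (E (e [ l ]≔ y)) · 𝟙 (E f)) ≡ 𝔼 ω (λ E → 𝟙 (E e) · 𝟙 (E f))
  free-pair {ω} {l} {x} {y} ext free {e} {f} p q q′ = trans
    (𝔼-weight (λ E → cong₂ _·_ (sym (free E e p)) (cong₂ (λ u v → 𝟙 (E u) · 𝟙 (E v)) (sym (τ-at refl)) (sym (τ-off q q′)))))
    (𝔼-τ {ω} {λ E → 𝟙 (E e) · 𝟙 (E f)} e (e [ l ]≔ y) (pair-ext ext e f))

  -- The expected weight of a pair does not change when e moves within class k. All m positions are
  -- therefore equally likely, and exactly one of them agrees with f.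
  free-step : ∀ {ω k κ} → Ext ω → (∀ x y → FreeMove ω k x y) → Kernel k κ →
    ι m · 𝔼 ω (pairs (κ ∩same k)) ≡ 𝔼 ω (pairs κ)
  free-step {ω} {k} {κ} ext free K = begin
    ι m · 𝔼 ω (pairs (κ ∩same k))
      ≡⟨ cong (ι m ·_) (trans (𝔼-pairs ω (κ ∩same k)) (∑-swap cells cells _)) ⟩
    ι m · ∑ cells (λ f → ∑ cells (λ e → κ e f · same k e f · T e f))
      ≡⟨ sym (∑-*ˡ cells (ι m) _) ⟩
    ∑ cells (λ f → ι m · ∑ cells (λ e → κ e f · same k e f · T e f))
      ≡⟨ ∑-cong cells (λ f → trans (sym (∑-update k _)) (∑-cong cells (λ e → trans (∑-cong (allFin m) (λ x → inner e f x)) (∑-δᶠ (lookup f k) _)))) ⟩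
    ∑ cells (λ f → ∑ cells (λ e → κ e f · T e f))
      ≡⟨ trans (∑-swap cells cells _) (sym (𝔼-pairs ω κ)) ⟩
    𝔼 ω (pairs κ) ∎
    where
    open ≡-Reasoning
    open Kernel K
    T : Cell → Cell → ℚ
    T e f = 𝔼 ω (λ E → 𝟙 (E e) · 𝟙 (E f))
    move : ∀ e f x → κ e f · T (e [ k ]≔ x) f ≡ κ e f · T e f
    move e f x with κ e f ℚ.≟ 0ℚ
    ... | yes z = 0·≡0· _ _ z
    ... | no nz = cong (κ e f ·_) (free-pair ext (free (lookup e k) x) refl
      (λ q → diag′ (lookup e k) nz (trans q (sym ([]≔-lookup e k)))) (diag′ x nz))
    opaque
      unfolding _+_
      swap₃ : ∀ a b c → a · b · c ≡ b · (a · c)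
      swap₃ = solve-∀ ℚ-ring
    inner : ∀ e f x → κ (e [ k ]≔ x) f · same k (e [ k ]≔ x) f · T (e [ k ]≔ x) f ≡ 𝟙 (does (x ≟ᶠ lookup f k)) · (κ e f · T e f)
    inner e f x = trans (cong₂ (λ a b → a · b · T (e [ k ]≔ x) f) (indepˡ e f x) (cong (λ y → 𝟙 (does (y ≟ᶠ lookup f k))) (lookup-[]≔ e k x)))
      (trans (swap₃ _ _ _) (cong (_ ·_) (move e f x)))

  -- The edges that two vertices of one class do not share

  module Switch (k : Fin r) (d : ℕ) (a a′ : Fin m) where

    common : (Cell → Bool) → ℚ
    common E = ∑ (hyper k a) (λ u → 𝟙 (E u) · 𝟙 (E (u [ k ]≔ a′)))

    -- For a cell u at a these indicate that u is an edge and its copy at a′ is not, and the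
    -- reverse. Elements of N_a and N_a′ are thus indexed by the same cells, those at a.
    gain loss : (Cell → Bool) → Cell → ℚ
    gain E u = 𝟙 (E u) · (1ℚ − 𝟙 (E (u [ k ]≔ a′)))
    loss E u = (1ℚ − 𝟙 (E u)) · 𝟙 (E (u [ k ]≔ a′))

    -- The number δ, provided that a and a′ have degree d. Its definition depends on E through
    -- `common` only.
    excess : (Cell → Bool) → ℚ
    excess E = ι d − common E

    common-ext : ∀ {E E′} → (∀ c → E c ≡ E′ c) → common E ≡ common E′
    common-ext h = ∑-cong (hyper k a) (λ u → cong₂ (λ x y → 𝟙 x · 𝟙 y) (h _) (h _))

    gain-ext : ∀ {E E′} → (∀ c → E c ≡ E′ c) → ∀ u → gain E u ≡ gain E′ u
    gain-ext h u = cong₂ (λ x y → 𝟙 x · (1ℚ − 𝟙 y)) (h _) (h _)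

    loss-ext : ∀ {E E′} → (∀ c → E c ≡ E′ c) → ∀ u → loss E u ≡ loss E′ u
    loss-ext h u = cong₂ (λ x y → (1ℚ − 𝟙 x) · 𝟙 y) (h _) (h _)

    𝟙-compl-nonneg : ∀ b → 0ℚ ≤ℚ 1ℚ − 𝟙 b
    𝟙-compl-nonneg b = 0≤b−a (𝟙-≤1 b)

    gain-nonneg : ∀ E u → 0ℚ ≤ℚ gain E u
    gain-nonneg E u = *-nonneg (𝟙-nonneg _) (𝟙-compl-nonneg (E (u [ k ]≔ a′)))

    loss-nonneg : ∀ E u → 0ℚ ≤ℚ loss E u
    loss-nonneg E u = *-nonneg (𝟙-compl-nonneg (E u)) (𝟙-nonneg _)

    private opaque
      unfolding _+_
      e₁ : ∀ x y → x · (1ℚ − y) ≡ x − x · y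
      e₁ = solve-∀ ℚ-ring
      e₂ : ∀ x y → (1ℚ − x) · y ≡ y − x · y
      e₂ = solve-∀ ℚ-ring
      e₃ : ∀ x y → x · (1ℚ − y) − (1ℚ − x) · y ≡ x − y
      e₃ = solve-∀ ℚ-ring
      e₄ : ∀ x y → x · (x · y) ≡ (x · x) · y
      e₄ = solve-∀ ℚ-ring
      e₅ : ∀ x y → x · ((1ℚ − x) · y) ≡ (x − x · x) · y
      e₅ = solve-∀ ℚ-ring

    gain−loss : ∀ E u → gain E u − loss E u ≡ 𝟙 (E u) − 𝟙 (E (u [ k ]≔ a′))
    gain−loss E u = e₃ _ _

    𝟙·gain : ∀ E u → 𝟙 (E u) · gain E u ≡ gain E u
    𝟙·gain E u = trans (e₄ _ _) (cong (_· (1ℚ − 𝟙 (E (u [ k ]≔ a′)))) (𝟙-idem (E u)))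

    𝟙·loss : ∀ E u → 𝟙 (E u) · loss E u ≡ 0ℚ
    𝟙·loss E u = trans (e₅ _ _) (trans (cong (λ z → (𝟙 (E u) − z) · 𝟙 (E (u [ k ]≔ a′))) (𝟙-idem (E u))) (trans (cong (_· 𝟙 (E (u [ k ]≔ a′))) (a−a _)) (*-zeroˡ _)))

    ∑-gain : ∀ E → ∑ (hyper k a) (gain E) ≡ ι (deg E k a) − common E
    ∑-gain E = trans (∑-cong (hyper k a) (λ u → e₁ _ _)) (trans (∑-− (hyper k a) _ _) (cong (_− common E) (sym (ι-deg′ E k a))))

    ∑-loss : ∀ E → ∑ (hyper k a) (loss E) ≡ ι (deg E k a′) − common E
    ∑-loss E = trans (∑-cong (hyper k a) (λ u → e₂ _ _)) (trans (∑-− (hyper k a) _ _)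
      (cong (_− common E) (trans (∑-hyper-move k a a′ (𝟙 ∘ E)) (sym (ι-deg′ E k a′)))))

    module _ (a≢a′ : a ≢ a′) where

      τ₂ : ∀ (E : Cell → Bool) {u v} → lookup u k ≡ a → lookup v k ≡ a → u ≢ v → E (τ v (v [ k ]≔ a′) u) ≡ E u
      τ₂ E p q ne = cong E (τ-off ne (≔-≢ a≢a′ p))

      τ₂′ : ∀ (E : Cell → Bool) {u v} → lookup u k ≡ a → lookup v k ≡ a → u ≢ v → E (τ v (v [ k ]≔ a′) (u [ k ]≔ a′)) ≡ E (u [ k ]≔ a′)
      τ₂′ E p q ne = cong E (τ-off (λ z → ≔-≢ a≢a′ q (sym z)) (λ z → ne (≔-inj a≢a′ p q z)))

      -- The transposition exchanges the two factors of a single summand and touches no other one.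
      -- Hence δ survives each half of the switching, and a weight depending on δ can be carried
      -- along.
      common-τ : ∀ E {v} → lookup v k ≡ a → common (E ∘ τ v (v [ k ]≔ a′)) ≡ common E
      common-τ E {v} q = ∑-congᴬ (hyper-at k a) (λ u p → go u p (u ≟ᶜ v))
        where
        go : ∀ u → lookup u k ≡ a → Dec (u ≡ v) →
          𝟙 (E (τ v (v [ k ]≔ a′) u)) · 𝟙 (E (τ v (v [ k ]≔ a′) (u [ k ]≔ a′))) ≡ 𝟙 (E u) · 𝟙 (E (u [ k ]≔ a′))
        go u p (yes refl) = trans (cong₂ (λ x y → 𝟙 (E x) · 𝟙 (E y)) (τ-at refl) (τ-at′ refl)) (*-comm _ _)
        go u p (no ne) = cong₂ (λ x y → 𝟙 x · 𝟙 y) (τ₂ E p q ne) (τ₂′ E p q ne)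

∑-≡0 : {A : Set} {xs : List A} {f : A → ℚ} → (∀ x → 0ℚ ≤ℚ f x) → ∑ xs f ≡ 0ℚ → All (λ x → f x ≡ 0ℚ) xs
∑-≡0 {xs = []} nn e = []
∑-≡0 {xs = x ∷ xs} {f} nn e = ≤ℚ-antisym (≤ℚ-trans (subst₂ _≤ℚ_ (+-identityʳ _) refl (+-mono ≤ℚ-refl (∑-nonneg xs nn))) (≡⇒≤ e)) (nn x)
  ∷ ∑-≡0 nn (≤ℚ-antisym (≤ℚ-trans (subst₂ _≤ℚ_ (+-identityˡ _) refl (+-mono (nn x) ≤ℚ-refl)) (≡⇒≤ e)) (∑-nonneg xs nn))

-- The weighted switching and its exact deviation formula

module Switching (r m : ℕ) where
  open Steps r m public

  -- Exactly what the switching argument uses about the measure: regularity on its support, and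
  -- invariance under those double moves that are genuine exchanges.
  record Regular (ω : (Cell → Bool) → ℚ) (k : Fin r) (d : ℕ) : Set where
    field
      regular : ∀ E → ω E ≡ 0ℚ ⊎ (∀ v → deg E k v ≡ d)
      switch : ∀ {a a′} → a ≢ a′ → ∀ E f g → lookup f k ≡ a → lookup g k ≡ a → f ≢ g →
        E f ≡ true → E (f [ k ]≔ a′) ≡ false → E g ≡ false → E (g [ k ]≔ a′) ≡ true →
        ω ((E ∘ τ f (f [ k ]≔ a′)) ∘ τ g (g [ k ]≔ a′)) ≡ ω E

  module SwitchStep {ω k d} (ext : Ext ω) (nn : ∀ E → 0ℚ ≤ℚ ω E) (R : Regular ω k d) {κ} (K : Kernel k κ)
                    {a a′ : Fin m} (a≢a′ : a ≢ a′) where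
    open Regular R
    open Kernel K
    open Switch k d a a′ public

    ψ : (Cell → Bool) → ℚ
    ψ E = inv (excess E)

    ψ-ext : ∀ {E E′} → (∀ c → E c ≡ E′ c) → ψ E ≡ ψ E′
    ψ-ext h = cong (λ z → inv (ι d − z)) (common-ext h)

    private
      opaque
        unfolding _+_ 𝟙
        -- Only when f can leave a and g can arrive there do the two weights have to agree; in every
        -- other case a factor of the product is 0.
        by-cases : ∀ w w′ p x b₁ b₂ b₃ b₄ → (b₁ ≡ true → b₂ ≡ false → b₃ ≡ false → b₄ ≡ true → w′ ≡ w) →
          w′ · (p · (x · ((𝟙 b₁ · (1ℚ − 𝟙 b₂)) · ((1ℚ − 𝟙 b₃) · 𝟙 b₄)))) ≡ w · (p · (x · ((𝟙 b₁ · (1ℚ − 𝟙 b₂)) · ((1ℚ − 𝟙 b₃) · 𝟙 b₄))))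
        by-cases w w′ p x true false false true h = cong (_· _) (h refl refl refl refl)
        by-cases w w′ p x false b₂ b₃ b₄ h = e w w′ p x (1ℚ − 𝟙 b₂) ((1ℚ − 𝟙 b₃) · 𝟙 b₄)
          where e : ∀ w w′ p x y z → w′ · (p · (x · ((0ℚ · y) · z))) ≡ w · (p · (x · ((0ℚ · y) · z)))
                e = solve-∀ ℚ-ring
        by-cases w w′ p x true true b₃ b₄ h = e w w′ p x ((1ℚ − 𝟙 b₃) · 𝟙 b₄)
          where e : ∀ w w′ p x z → w′ · (p · (x · ((1ℚ · (1ℚ − 1ℚ)) · z))) ≡ w · (p · (x · ((1ℚ · (1ℚ − 1ℚ)) · z)))
                e = solve-∀ ℚ-ring
        by-cases w w′ p x true false true b₄ h = e w w′ p x (𝟙 b₄)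
          where e : ∀ w w′ p x z → w′ · (p · (x · ((1ℚ · (1ℚ − 0ℚ)) · ((1ℚ − 1ℚ) · z)))) ≡ w · (p · (x · ((1ℚ · (1ℚ − 0ℚ)) · ((1ℚ − 1ℚ) · z))))
                e = solve-∀ ℚ-ring
        by-cases w w′ p x true false false false h = e w w′ p x
          where e : ∀ w w′ p x → w′ · (p · (x · ((1ℚ · (1ℚ − 0ℚ)) · ((1ℚ − 0ℚ) · 0ℚ)))) ≡ w · (p · (x · ((1ℚ · (1ℚ − 0ℚ)) · ((1ℚ − 0ℚ) · 0ℚ))))
                e = solve-∀ ℚ-ring

    -- Both f and g move between the vertices a and a′, in opposite directions, so all degrees survive.
    triple : ∀ {e f g} → lookup e k ≡ a → lookup f k ≡ a → lookup g k ≡ a → e ≢ f → e ≢ g →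
      𝔼 ω (λ E → ψ E · (𝟙 (E e) · (gain E f · loss E g))) ≡ 𝔼 ω (λ E → ψ E · (𝟙 (E e) · (loss E f · gain E g)))
    triple {e} {f} {g} pe pf pg e≢f e≢g with f ≟ᶜ g
    ... | yes refl = 𝔼-cong (λ E → cong (λ z → ψ E · (𝟙 (E e) · z)) (*-comm _ _))
    ... | no f≢g = sym (trans (sym (𝔼-τ {ω} {X} g g′ extX))
                     (trans (sym (𝔼-τ {λ E → ω (E ∘ τ g g′)} {λ E → X (E ∘ τ g g′)} f f′ (λ h → extX (λ c → h (τ g g′ c)))))
                       (𝔼-weight pointwise)))
      where
      f′ = f [ k ]≔ a′
      g′ = g [ k ]≔ a′
      X : (Cell → Bool) → ℚ
      X E = ψ E · (𝟙 (E e) · (loss E f · gain E g))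
      extX : Ext (λ E → ω E · X E)
      extX h = cong₂ _·_ (ext h) (cong₂ _·_ (ψ-ext h) (cong₂ _·_ (cong 𝟙 (h e)) (cong₂ _·_ (loss-ext h f) (gain-ext h g))))
      g≢f : g ≢ f
      g≢f z = f≢g (sym z)
      pointwise : ∀ E → ω ((E ∘ τ f f′) ∘ τ g g′) · X ((E ∘ τ f f′) ∘ τ g g′) ≡ ω E · (ψ E · (𝟙 (E e) · (gain E f · loss E g)))
      pointwise E = trans (cong (ω E₂ ·_) X≡) (by-cases (ω E) (ω E₂) (ψ E) (𝟙 (E e)) (E f) (E f′) (E g) (E g′) (switch a≢a′ E f g pf pg f≢g))
        where
        E₁ = E ∘ τ f f′
        E₂ = E₁ ∘ τ g g′
        loss≡ : loss E₂ f ≡ gain E f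
        loss≡ = trans (cong₂ (λ x y → (1ℚ − 𝟙 x) · 𝟙 y)
          (trans (τ₂ a≢a′ E₁ pf pg f≢g) (cong E (τ-at refl))) (trans (τ₂′ a≢a′ E₁ pf pg f≢g) (cong E (τ-at′ refl)))) (*-comm _ _)
        gain≡ : gain E₂ g ≡ loss E g
        gain≡ = trans (cong₂ (λ x y → 𝟙 x · (1ℚ − 𝟙 y))
          (trans (cong E₁ (τ-at refl)) (τ₂′ a≢a′ E pg pf g≢f)) (trans (cong E₁ (τ-at′ refl)) (τ₂ a≢a′ E pg pf g≢f))) (*-comm _ _)
        X≡ : X E₂ ≡ ψ E · (𝟙 (E e) · (gain E f · loss E g))
        X≡ = cong₂ _·_ (cong (λ z → inv (ι d − z)) (trans (common-τ a≢a′ E₁ pg) (common-τ a≢a′ E pf)))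
          (cong₂ _·_ (cong 𝟙 (trans (τ₂ a≢a′ E₁ pe pg e≢g) (τ₂ a≢a′ E pe pf e≢f))) (cong₂ _·_ loss≡ gain≡))

    ∑ₐ : (Cell → ℚ) → ℚ
    ∑ₐ = ∑ (hyper k a)

    -- With e an edge at a, U takes f from N_a outside N_a′ and U′ takes f from N_a′ outside N_a; V
    -- is the part of U′ in which e also lies outside N_a′.
    U U′ V : (Cell → Bool) → ℚ
    U E = ∑ₐ λ e → ∑ₐ λ f → κ e f · (𝟙 (E e) · gain E f)
    U′ E = ∑ₐ λ e → ∑ₐ λ f → κ e f · (𝟙 (E e) · loss E f)
    V E = ∑ₐ λ e → ∑ₐ λ f → κ e f · (gain E e · loss E f)

    private
      H-at = hyper-at k a
      opaque
        unfolding _+_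
        r₁ : ∀ κ p x g l → κ · (p · (x · (g · l))) ≡ ((κ · (x · g)) · p) · l
        r₁ = solve-∀ ℚ-ring
        r₂ : ∀ κ p x l g δ → κ · ((1ℚ − δ) · (p · (x · (l · g)))) ≡ ((κ · (x · l)) · p) · g − δ · (((κ · (x · l)) · p) · g)
        r₂ = solve-∀ ℚ-ring
        r₃ : ∀ κ p x l g → ((κ · (x · l)) · p) · g ≡ p · (κ · ((x · g) · l))
        r₃ = solve-∀ ℚ-ring
        r₄ : ∀ u p s → (u · p) · s ≡ u · (s · p)
        r₄ = solve-∀ ℚ-ring
        r₅ : ∀ κ p x g l → κ · (p · (x · (g · l))) ≡ (κ · (p · g)) · (x · l)
        r₅ = solve-∀ ℚ-ring
        r₆ : ∀ κ z → κ · ((1ℚ − 1ℚ) · z) ≡ 0ℚ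
        r₆ = solve-∀ ℚ-ring
        r₇ : ∀ κ z → κ · ((1ℚ − 0ℚ) · z) ≡ κ · z
        r₇ = solve-∀ ℚ-ring

    -- For g = e the left side vanishes, because e is an edge and cannot be a loss, while the right
    -- side need not vanish. The terms removed here are the only asymmetry of the switching; summed
    -- up, they are V.
    weighted : ∀ {e f g} → lookup e k ≡ a → lookup f k ≡ a → lookup g k ≡ a →
      κ e f · 𝔼 ω (λ E → ψ E · (𝟙 (E e) · (gain E f · loss E g))) ≡
      κ e f · ((1ℚ − 𝟙 (does (g ≟ᶜ e))) · 𝔼 ω (λ E → ψ E · (𝟙 (E e) · (loss E f · gain E g))))
    weighted {e} {f} {g} pe pf pg = go (κ e f ℚ.≟ 0ℚ) (g ≟ᶜ e)
      where
      Zl = 𝔼 ω (λ E → ψ E · (𝟙 (E e) · (gain E f · loss E g)))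
      Zr = 𝔼 ω (λ E → ψ E · (𝟙 (E e) · (loss E f · gain E g)))
      go : Dec (κ e f ≡ 0ℚ) → (q : Dec (g ≡ e)) → κ e f · Zl ≡ κ e f · ((1ℚ − 𝟙 (does q)) · Zr)
      go (yes z) q = 0·≡0· _ _ z
      go (no nz) (yes refl) = trans (trans (cong (κ e f ·_) zero′) (*-zeroʳ _)) (sym (trans (cong (λ b → κ e f · ((1ℚ − b) · Zr)) 𝟙-true) (r₆ _ _)))
        where zero′ : Zl ≡ 0ℚ
              zero′ = trans (𝔼-cong (λ E → trans (trans (sym (*-identityˡ _)) (trans (r₅ 1ℚ (ψ E) (𝟙 (E e)) (gain E f) (loss E e)) (cong (_ ·_) (𝟙·loss E e)))) (trans (*-zeroʳ _) (sym (*-zeroˡ 0ℚ)))))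
                (trans (𝔼-· 0ℚ (λ _ → 0ℚ)) (*-zeroˡ _))
      go (no nz) (no g≢e) = trans (cong (κ e f ·_) (triple pe pf pg e≢f (λ z → g≢e (sym z)))) (sym (trans (cong (λ b → κ e f · ((1ℚ − b) · Zr)) 𝟙-false) (r₇ _ _)))
        where e≢f : e ≢ f
              e≢f z = nz (trans (cong (κ e) (sym z)) (diag e))

    lhs : ∀ E → ∑ₐ (λ e → ∑ₐ (λ f → ∑ₐ (λ g → κ e f · (ψ E · (𝟙 (E e) · (gain E f · loss E g)))))) ≡ U E · (∑ₐ (loss E) · ψ E)
    lhs E = trans (∑-cong (hyper k a) (λ e → trans (∑-cong (hyper k a) (λ f → trans (∑-cong (hyper k a) (λ g → r₁ _ _ _ _ _)) (∑-*ˡ (hyper k a) _ _)))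
        (trans (∑-*ʳ (hyper k a) _ _) (cong (_· ∑ₐ (loss E)) (∑-*ʳ (hyper k a) _ (ψ E))))))
      (trans (∑-*ʳ (hyper k a) _ _) (trans (cong (_· ∑ₐ (loss E)) (∑-*ʳ (hyper k a) _ (ψ E))) (r₄ _ _ _)))

    rhs : ∀ E → ∑ₐ (λ e → ∑ₐ (λ f → ∑ₐ (λ g → κ e f · ((1ℚ − 𝟙 (does (g ≟ᶜ e))) · (ψ E · (𝟙 (E e) · (loss E f · gain E g))))))) ≡
      U′ E · (∑ₐ (gain E) · ψ E) − ψ E · V E
    rhs E = trans (∑-congᴬ H-at (λ e pe → trans (∑-cong (hyper k a) (λ f → trans (∑-cong (hyper k a) (λ g → r₂ _ _ _ _ _ _))
          (trans (∑-− (hyper k a) _ _) (cong₂ _−_ (∑-*ˡ (hyper k a) _ _)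
            (trans (∑-δ-hyper (λ g → κ e f · (𝟙 (E e) · loss E f) · ψ E · gain E g) pe)
              (trans (r₃ _ _ _ _ _) (cong (λ z → ψ E · (κ e f · (z · loss E f))) (𝟙·gain E e))))))))
        (trans (∑-− (hyper k a) _ _) (cong₂ _−_ (trans (∑-*ʳ (hyper k a) _ _) (cong (_· ∑ₐ (gain E)) (∑-*ʳ (hyper k a) _ (ψ E)))) (∑-*ˡ (hyper k a) (ψ E) _)))))
      (trans (∑-− (hyper k a) _ _) (cong₂ _−_ (trans (∑-*ʳ (hyper k a) _ _) (trans (cong (_· ∑ₐ (gain E)) (∑-*ʳ (hyper k a) _ (ψ E))) (r₄ _ _ _))) (∑-*ˡ (hyper k a) (ψ E) _)))

    -- When the excess vanishes there are no gains or losses at all, so the junk value of ψ is harmless.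
    cancel : ∀ {E} (t : Cell → ℚ) (h : Cell → Cell → ℚ) → (∀ u → 0ℚ ≤ℚ t u) → ∑ₐ t ≡ excess E → {s : ℚ} → s ≡ excess E →
      (∑ₐ λ e → ∑ₐ λ f → κ e f · (h e f · t f)) · (s · ψ E) ≡ ∑ₐ λ e → ∑ₐ λ f → κ e f · (h e f · t f)
    cancel {E} t h tnn tsum {s} se with excess E ℚ.≟ 0ℚ
    ... | no ne = trans (cong (_ ·_) (trans (cong (_· ψ E) se) (*-inv ne))) (*-identityʳ _)
    ... | yes z = trans (cong (_· (s · ψ E)) zz) (trans (*-zeroˡ _) (sym zz))
      where zz : (∑ₐ λ e → ∑ₐ λ f → κ e f · (h e f · t f)) ≡ 0ℚ
            zz = trans (∑-cong (hyper k a) (λ e → trans (∑-congᴬ (∑-≡0 {xs = hyper k a} tnn (trans tsum z))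
                   (λ f tz → trans (cong (λ z → κ e f · (h e f · z)) tz) (trans (cong (κ e f ·_) (*-zeroʳ _)) (*-zeroʳ _)))) (∑-0 (hyper k a)))) (∑-0 (hyper k a))

    gains : ∀ E → (∀ v → deg E k v ≡ d) → ∑ₐ (gain E) ≡ excess E
    gains E h = trans (∑-gain E) (cong (λ n → ι n − common E) (h a))

    losses : ∀ E → (∀ v → deg E k v ≡ d) → ∑ₐ (loss E) ≡ excess E
    losses E h = trans (∑-loss E) (cong (λ n → ι n − common E) (h a′))

    𝔼-triple : ∀ (X : Cell → Cell → Cell → (Cell → Bool) → ℚ) →
      ∑ₐ (λ e → ∑ₐ (λ f → ∑ₐ (λ g → 𝔼 ω (X e f g)))) ≡ 𝔼 ω (λ E → ∑ₐ (λ e → ∑ₐ (λ f → ∑ₐ (λ g → X e f g E))))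
    𝔼-triple X = sym (trans (𝔼-∑ (hyper k a) _) (∑-cong (hyper k a) (λ e → trans (𝔼-∑ (hyper k a) _) (∑-cong (hyper k a) (λ f → 𝔼-∑ (hyper k a) _)))))

    -- Sum the switching identity over e, f and g. Regularity of a and a′ makes the sum over g equal
    -- to δ on both sides, where the weight `ψ` = 1/δ cancels it; only the excluded terms g = e keep
    -- their weight.
    U≡U′ : 𝔼 ω U ≡ 𝔼 ω U′ − 𝔼 ω (λ E → ψ E · V E)
    U≡U′ = begin
      𝔼 ω U
        ≡⟨ 𝔼-supp (λ E → Sum.map₂ (λ h → sym (cancel (gain E) (λ e f → 𝟙 (E e)) (gain-nonneg E) (gains E h) (losses E h))) (regular E)) ⟩
      𝔼 ω (λ E → U E · (∑ₐ (loss E) · ψ E))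
        ≡⟨ trans (𝔼-cong (λ E → sym (lhs E))) (sym (𝔼-triple _)) ⟩
      ∑ₐ (λ e → ∑ₐ (λ f → ∑ₐ (λ g → 𝔼 ω (λ E → κ e f · (ψ E · (𝟙 (E e) · (gain E f · loss E g)))))))
        ≡⟨ ∑-congᴬ H-at (λ e pe → ∑-congᴬ H-at (λ f pf → ∑-congᴬ H-at (λ g pg → trans (𝔼-· _ _) (trans (weighted pe pf pg)
             (trans (cong (κ e f ·_) (sym (𝔼-· _ _))) (sym (𝔼-· _ _))))))) ⟩
      ∑ₐ (λ e → ∑ₐ (λ f → ∑ₐ (λ g → 𝔼 ω (λ E → κ e f · ((1ℚ − 𝟙 (does (g ≟ᶜ e))) · (ψ E · (𝟙 (E e) · (loss E f · gain E g))))))))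
        ≡⟨ trans (𝔼-triple _) (𝔼-cong rhs) ⟩
      𝔼 ω (λ E → U′ E · (∑ₐ (gain E) · ψ E) − ψ E · V E)
        ≡⟨ trans (𝔼-− _ _) (cong (_− 𝔼 ω (λ E → ψ E · V E)) (𝔼-supp (λ E → Sum.map₂ (λ h → cancel (loss E) (λ e f → 𝟙 (E e)) (loss-nonneg E) (losses E h) (gains E h)) (regular E)))) ⟩
      𝔼 ω U′ − 𝔼 ω (λ E → ψ E · V E) ∎
      where open ≡-Reasoning

-- Agreement in a regular class: sign and size of the deviation

module RegularSteps (r m : ℕ) where
  open Switching r m public

  qpair : Fin r → (Cell → Cell → ℚ) → Fin m → Fin m → (Cell → Bool) → ℚ
  qpair k κ a a′ E = ∑ (hyper k a) λ e → ∑ (hyper k a′) λ f → κ e f · (𝟙 (E e) · 𝟙 (E f))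

  qpair-all : ∀ k κ E → ∑ (allFin m) (λ a → ∑ (allFin m) (λ a′ → qpair k κ a a′ E)) ≡ pairs κ E
  qpair-all k κ E = trans (∑-cong (allFin m) (λ a → trans (∑-swap (allFin m) (hyper k a) _) (∑-cong (hyper k a) (λ e → ∑-hyper-all k _)))) (∑-hyper-all k _)

  private opaque
    unfolding _+_
    same-reorder : ∀ κ s t → κ · s · t ≡ s · (κ · t)
    same-reorder = solve-∀ ℚ-ring
    e₆ : ∀ κ x l g → κ · (x · l) − κ · (x · g) ≡ κ · (x · (− (g − l)))
    e₆ = solve-∀ ℚ-ring
    e₇ : ∀ κ x y z → κ · (x · (− (y − z))) ≡ κ · (x · z) − κ · (x · y)
    e₇ = solve-∀ ℚ-ring
    e₈ : ∀ a b c → a ≡ b − c → b − a ≡ c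
    e₈ a b c h = trans (cong (λ z → b − z) h) (a−[a−b] b c)
    e₉ : ∀ x c y → (x + c) · y ≡ x · y + c · y
    e₉ = solve-∀ ℚ-ring

  same-yes : ∀ {k a e f} → lookup f k ≡ a → same k e f ≡ at k a e
  same-yes {k} {e = e} p = cong (λ v → at k v e) p

  qpair-diag : ∀ k κ E → ∑ (allFin m) (λ a → qpair k κ a a E) ≡ pairs (κ ∩same k) E
  qpair-diag k κ E = begin
    ∑ (allFin m) (λ a → ∑ (hyper k a) λ e → ∑ (hyper k a) λ f → κ e f · (𝟙 (E e) · 𝟙 (E f)))
      ≡⟨ ∑-cong (allFin m) (λ a → trans (∑-swap (hyper k a) (hyper k a) _) (∑-congᴬ (hyper-at k a) (λ f p →
           trans (∑-hyper k a _) (∑-cong cells (λ e → trans (cong (_· (κ e f · (𝟙 (E e) · 𝟙 (E f)))) (sym (same-yes {e = e} {f} p))) (sym (same-reorder _ _ _))))))) ⟩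
    ∑ (allFin m) (λ a → ∑ (hyper k a) λ f → ∑ cells λ e → κ e f · same k e f · (𝟙 (E e) · 𝟙 (E f)))
      ≡⟨ ∑-hyper-all k _ ⟩
    ∑ cells (λ f → ∑ cells λ e → κ e f · same k e f · (𝟙 (E e) · 𝟙 (E f)))
      ≡⟨ ∑-swap cells cells _ ⟩
    pairs (κ ∩same k) E ∎
    where open ≡-Reasoning

  ne : Fin m → Fin m → ℚ
  ne a a′ = 1ℚ − 𝟙 (does (a ≟ᶠ a′))

  -- The number of ordered pairs of distinct cells of E that differ exactly in class k.
  parallel : Fin r → (Cell → Bool) → ℚ
  parallel k E = ∑ (allFin m) λ a → ∑ (allFin m) λ a′ → ne a a′ · ∑ (hyper k a) (λ u → 𝟙 (E u) · 𝟙 (E (u [ k ]≔ a′)))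

  module _ {ω k d} (ext : Ext ω) (nn : ∀ E → 0ℚ ≤ℚ ω E) (R : Regular ω k d) {κ} (K : Kernel k κ) where
    open Kernel K
    open Regular R

    -- If the k-th vertices of the two edges were independent, every deficit would be 0. Summed over
    -- a and a′, the pairs with distinct positions and the m-fold diagonal combine to the deviation
    -- from 1/m.
    deficit : Fin m → Fin m → ℚ
    deficit a a′ = 𝔼 ω (qpair k κ a a′) − 𝔼 ω (qpair k κ a a)

    deficit-∑ : ∑ (allFin m) (λ a → ∑ (allFin m) (deficit a)) ≡ 𝔼 ω (pairs κ) − ι m · 𝔼 ω (pairs (κ ∩same k))
    deficit-∑ = trans (∑-cong (allFin m) (λ a → ∑-− (allFin m) _ _)) (trans (∑-− (allFin m) _ _) (cong₂ _−_
        (trans (∑-cong (allFin m) (λ a → sym (𝔼-∑ (allFin m) _))) (trans (sym (𝔼-∑ (allFin m) _)) (𝔼-cong (qpair-all k κ))))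
        (trans (∑-cong (allFin m) (λ a → trans (∑-const (allFin m) _) (cong (λ n → ι n · 𝔼 ω (qpair k κ a a)) (length-allFin m))))
          (trans (∑-*ˡ (allFin m) (ι m) _) (cong (ι m ·_) (trans (sym (𝔼-∑ (allFin m) _)) (𝔼-cong (qpair-diag k κ))))))))

    module _ {a a′ : Fin m} (a≢a′ : a ≢ a′) where
      open SwitchStep ext nn R K a≢a′

      -- Edges shared by a and a′ cancel in the difference, and `κ` does not see whether f sits at a
      -- or at a′.
      U′−U : ∀ E → U′ E − U E ≡ qpair k κ a a′ E − qpair k κ a a E
      U′−U E = begin
        U′ E − U E
          ≡⟨ trans (sym (∑-− (hyper k a) _ _)) (∑-cong (hyper k a) (λ e → trans (sym (∑-− (hyper k a) _ _)) (∑-cong (hyper k a) (λ f →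
               trans (e₆ _ _ _ _) (trans (cong (λ z → κ e f · (𝟙 (E e) · (− z))) (gain−loss E f)) (e₇ _ _ _ _)))))) ⟩
        ∑ₐ (λ e → ∑ₐ (λ f → κ e f · (𝟙 (E e) · 𝟙 (E (f [ k ]≔ a′))) − κ e f · (𝟙 (E e) · 𝟙 (E f))))
          ≡⟨ trans (∑-cong (hyper k a) (λ e → ∑-− (hyper k a) _ _)) (∑-− (hyper k a) _ _) ⟩
        ∑ₐ (λ e → ∑ₐ (λ f → κ e f · (𝟙 (E e) · 𝟙 (E (f [ k ]≔ a′))))) − qpair k κ a a E
          ≡⟨ cong (_− qpair k κ a a E) (∑-cong (hyper k a) (λ e → trans (∑-cong (hyper k a) (λ f → cong (_· (𝟙 (E e) · 𝟙 (E (f [ k ]≔ a′)))) (sym (indepʳ e f a′))))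
               (∑-hyper-move k a a′ (λ f → κ e f · (𝟙 (E e) · 𝟙 (E f)))))) ⟩
        qpair k κ a a′ E − qpair k κ a a E ∎
        where open ≡-Reasoning

      deficit≡ : deficit a a′ ≡ 𝔼 ω (λ E → ψ E · V E)
      deficit≡ = trans (sym (𝔼-− _ _)) (trans (𝔼-cong (λ E → sym (U′−U E))) (trans (𝔼-− _ _) (e₈ _ _ _ U≡U′)))

      V-nonneg : ∀ E → 0ℚ ≤ℚ V E
      V-nonneg E = ∑-nonneg (hyper k a) (λ e → ∑-nonneg (hyper k a) (λ f → *-nonneg (nonneg e f) (*-nonneg (gain-nonneg E e) (loss-nonneg E f))))

      excess-nonneg : ∀ E → (∀ v → deg E k v ≡ d) → 0ℚ ≤ℚ excess E
      excess-nonneg E h = subst (0ℚ ≤ℚ_) (gains E h) (∑-nonneg (hyper k a) (gain-nonneg E))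

      deficit-nonneg : 0ℚ ≤ℚ deficit a a′
      deficit-nonneg = subst (0ℚ ≤ℚ_) (sym deficit≡) (𝔼-nonneg nn (λ E → Sum.map₂ (λ h → *-nonneg (inv-nonneg (excess-nonneg E h)) (V-nonneg E)) (regular E)))

      gain≤𝟙 : ∀ E u → gain E u ≤ℚ 𝟙 (E u)
      gain≤𝟙 E u = subst (gain E u ≤ℚ_) (*-identityʳ _) (*-monoˡ (𝟙-nonneg _) (a−b≤a (𝟙-nonneg _)))

      loss≤𝟙 : ∀ E u → loss E u ≤ℚ 𝟙 (E (u [ k ]≔ a′))
      loss≤𝟙 E u = subst (loss E u ≤ℚ_) (*-identityˡ _) (*-monoʳ (𝟙-nonneg _) (a−b≤a (𝟙-nonneg _)))

      V≤qpair : ∀ E → V E ≤ℚ qpair k κ a a′ E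
      V≤qpair E = ≤ℚ-trans (∑-mono (hyper k a) (λ e → ∑-mono (hyper k a) (λ f → *-monoˡ (nonneg e f)
          (*-mono (gain-nonneg E e) (𝟙-nonneg _) (gain≤𝟙 E e) (loss≤𝟙 E f)))))
        (≡⇒≤ (∑-cong (hyper k a) (λ e → trans (∑-cong (hyper k a) (λ f → cong (_· (𝟙 (E e) · 𝟙 (E (f [ k ]≔ a′)))) (sym (indepʳ e f a′))))
               (∑-hyper-move k a a′ (λ f → κ e f · (𝟙 (E e) · 𝟙 (E f)))))))

      module _ {B : ℚ} (B-nonneg : 0ℚ ≤ℚ B) (bound : ∀ f → ∑ (hyper k a) (λ e → κ e f) ≤ℚ B) where

        -- There are δ choices of f in N_a′ outside N_a, and each is related to cells e of total
        -- weight at most B. The factor δ will cancel the weight 1/δ.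
        V≤B : ∀ E → (∀ v → deg E k v ≡ d) → V E ≤ℚ B · excess E
        V≤B E h = ≤ℚ-trans (≡⇒≤ (∑-swap (hyper k a) (hyper k a) _)) (≤ℚ-trans (∑-mono (hyper k a) (λ f →
            ≤ℚ-trans (∑-mono (hyper k a) (λ e → ≤ℚ-trans (*-monoˡ (nonneg e f) (*-monoʳ (loss-nonneg E f) (≤ℚ-trans (gain≤𝟙 E e) (𝟙-≤1 _))))
              (≡⇒≤ (cong (κ e f ·_) (*-identityˡ _)))))
              (≤ℚ-trans (≡⇒≤ (∑-*ʳ (hyper k a) _ _)) (*-monoʳ (loss-nonneg E f) (bound f)))))
          (≡⇒≤ (trans (∑-*ˡ (hyper k a) B _) (cong (B ·_) (losses E h)))))

        excess·ψ : ∀ E → (∀ v → deg E k v ≡ d) → (x : ℚ) → 0ℚ ≤ℚ x → excess E · (ψ E · x) ≤ℚ x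
        excess·ψ E h x nnx with excess E ℚ.≟ 0ℚ
        ... | no nz = ≡⇒≤ (trans (sym (*-assoc _ _ _)) (trans (cong (_· x) (*-inv nz)) (*-identityˡ x)))
        ... | yes z = ≤ℚ-trans (≡⇒≤ (trans (cong (_· (ψ E · x)) z) (*-zeroˡ _))) nnx

        -- With δ the excess and c = d − δ the number of common neighbours, d/δ = 1 + c/δ.
        deficit-bound : ι d · deficit a a′ ≤ℚ 𝔼 ω (qpair k κ a a′) + B · 𝔼 ω common
        deficit-bound = subst₂ _≤ℚ_ (trans (𝔼-· _ _) (cong (ι d ·_) (sym deficit≡))) (trans (𝔼-+ _ _) (cong (𝔼 ω (qpair k κ a a′) +_) (𝔼-· _ _)))
          (𝔼-mono nn (λ E → Sum.map₂ (λ h → ≤ℚ-trans (≡⇒≤ (trans (cong (_· (ψ E · V E)) (sym (a−b+b (ι d) (common E)))) (e₉ _ _ _)))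
            (+-mono (≤ℚ-trans (excess·ψ E h (V E) (V-nonneg E)) (V≤qpair E)) (≤ℚ-trans (*-monoˡ (common-nonneg E)
                (≤ℚ-trans (*-monoˡ (inv-nonneg (excess-nonneg E h)) (V≤B E h)) (≤ℚ-trans (≡⇒≤ (shuffle _ _ _)) (excess·ψ E h B B-nonneg))))
              (≡⇒≤ (*-comm _ _))))) (regular E)))
          where
          opaque
            unfolding _+_
            shuffle : ∀ p b x → p · (b · x) ≡ x · (p · b)
            shuffle = solve-∀ ℚ-ring
          common-nonneg : ∀ E → 0ℚ ≤ℚ common E
          common-nonneg E = ∑-nonneg (hyper k a) (λ u → *-nonneg (𝟙-nonneg _) (𝟙-nonneg _))

    private
      deficit-diag : ∀ a → deficit a a ≡ 0ℚ
      deficit-diag a = a−a _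

    -- By the exact formula each deficit is the expectation of a nonnegative quantity.
    regular-step-≤ : ι m · 𝔼 ω (pairs (κ ∩same k)) ≤ℚ 𝔼 ω (pairs κ)
    regular-step-≤ = 0≤b−a⇒a≤b (subst (0ℚ ≤ℚ_) deficit-∑ (∑-nonneg (allFin m) (λ a → ∑-nonneg (allFin m) (λ a′ → go a a′ (a ≟ᶠ a′)))))
      where go : ∀ a a′ → Dec (a ≡ a′) → 0ℚ ≤ℚ deficit a a′
            go a a′ (yes refl) = ≡⇒≤ (sym (deficit-diag a))
            go a a′ (no n) = deficit-nonneg n

    -- Sums `deficit-bound` over all ordered pairs of vertices; the common neighbourhoods of
    -- distinct vertices add up to `parallel k`.
    regular-step-≥ : ∀ {B} → 0ℚ ≤ℚ B → (∀ a f → ∑ (hyper k a) (λ e → κ e f) ≤ℚ B) →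
      ι d · (𝔼 ω (pairs κ) − ι m · 𝔼 ω (pairs (κ ∩same k))) ≤ℚ 𝔼 ω (pairs κ) + B · 𝔼 ω (parallel k)
    regular-step-≥ {B} Bnn bound = subst₂ _≤ℚ_
      (trans (∑-cong (allFin m) (λ a → ∑-*ˡ (allFin m) (ι d) _)) (trans (∑-*ˡ (allFin m) (ι d) _) (cong (ι d ·_) deficit-∑)))
      (trans (∑-cong (allFin m) (λ a → ∑-+ (allFin m) _ _)) (trans (∑-+ (allFin m) _ _) (cong₂ _+_
        (trans (∑-cong (allFin m) (λ a → sym (𝔼-∑ (allFin m) _))) (trans (sym (𝔼-∑ (allFin m) _)) (𝔼-cong (qpair-all k κ))))
        (trans (∑-cong (allFin m) (λ a → ∑-*ˡ (allFin m) B _)) (trans (∑-*ˡ (allFin m) B _) (cong (B ·_)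
          (trans (∑-cong (allFin m) (λ a → trans (∑-cong (allFin m) (λ a′ → sym (𝔼-· _ _))) (sym (𝔼-∑ (allFin m) _)))) (sym (𝔼-∑ (allFin m) _)))))))))
      (∑-mono (allFin m) (λ a → ∑-mono (allFin m) (λ a′ → go a a′ (a ≟ᶠ a′))))
      where
      c : Fin m → Fin m → (Cell → Bool) → ℚ
      c a a′ E = ∑ (hyper k a) (λ u → 𝟙 (E u) · 𝟙 (E (u [ k ]≔ a′)))
      qpair-nonneg : ∀ a a′ E → 0ℚ ≤ℚ qpair k κ a a′ E
      qpair-nonneg a a′ E = ∑-nonneg (hyper k a) (λ e → ∑-nonneg (hyper k a′) (λ f → *-nonneg (nonneg e f) (*-nonneg (𝟙-nonneg _) (𝟙-nonneg _))))
      c-nonneg : ∀ a a′ E → 0ℚ ≤ℚ c a a′ E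
      c-nonneg a a′ E = ∑-nonneg (hyper k a) (λ u → *-nonneg (𝟙-nonneg _) (𝟙-nonneg _))
      go : ∀ a a′ → (q : Dec (a ≡ a′)) → ι d · deficit a a′ ≤ℚ 𝔼 ω (qpair k κ a a′) + B · ((1ℚ − 𝟙 (does q)) · 𝔼 ω (c a a′))
      go a a′ (yes refl) = ≤ℚ-trans (≡⇒≤ (trans (cong (ι d ·_) (deficit-diag a)) (*-zeroʳ _)))
        (+-nonneg (𝔼-nonneg nn (λ E → inj₂ (qpair-nonneg a a E))) (*-nonneg Bnn (*-nonneg (0≤b−a (𝟙-≤1 _)) (𝔼-nonneg nn (λ E → inj₂ (c-nonneg a a E))))))
      go a a′ (no n) = ≤ℚ-trans (deficit-bound n Bnn (bound a)) (≡⇒≤ (cong (λ z → 𝔼 ω (qpair k κ a a′) + B · z)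
        (sym (trans (cong (_· 𝔼 ω (c a a′)) (trans (cong (λ z → 1ℚ − z) 𝟙-false) 1−0)) (*-identityˡ _)))))

others : ∀ {r} → Fin r → List (Fin r) → List (Fin r)
others i = filter (λ l → ¬? (l ≟ᶠ i))

length-others : ∀ {r} {i : Fin r} {xs} → Unique xs → i ∈ xs → suc (length (others i xs)) ≡ length xs
length-others {i = i} {xs} u q = ι-inj (begin
  ι (suc (length (others i xs)))
    ≡⟨ trans (ι-suc _) (+-comm _ _) ⟩
  ι (length (others i xs)) + 1ℚ
    ≡⟨ cong₂ _+_ (trans (sym (*-identityʳ _)) (trans (sym (∑-const (others i xs) 1ℚ)) (∑-filter? (λ l → ¬? (l ≟ᶠ i)) xs (λ _ → 1ℚ)))) (sym (∑-δ _≟ᶠ_ (λ _ → 1ℚ) u q)) ⟩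
  ∑ xs (λ l → 𝟙 (not (does (l ≟ᶠ i))) · 1ℚ) + ∑ xs (λ l → 𝟙 (does (l ≟ᶠ i)) · 1ℚ)
    ≡⟨ trans (sym (∑-+ xs _ _)) (trans (∑-cong xs (λ l → trans (cong (λ z → z · 1ℚ + 𝟙 (does (l ≟ᶠ i)) · 1ℚ) (𝟙-not _)) (e _))) (∑-const xs 1ℚ)) ⟩
  ι (length xs) · 1ℚ
    ≡⟨ *-identityʳ _ ⟩
  ι (length xs) ∎)
  where
  open ≡-Reasoning
  opaque
    unfolding _+_
    e : ∀ x → (1ℚ − x) · 1ℚ + x · 1ℚ ≡ 1ℚ
    e = solve-∀ ℚ-ring

others-≢ : ∀ {r} (i : Fin r) xs → All (_≢ i) (others i xs)
others-≢ i xs = All.all-filter (λ l → ¬? (l ≟ᶠ i)) xs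

others-unique : ∀ {r} (i : Fin r) {xs} → Unique xs → Unique (others i xs)
others-unique i = Unique.filter⁺ (λ l → ¬? (l ≟ᶠ i))

∈-others : ∀ {r} {i l : Fin r} {xs} → l ∈ xs → l ≢ i → l ∈ others i xs
∈-others {i = i} = Membership.∈-filter⁺ (λ l → ¬? (l ≟ᶠ i))

-- Agreement in many classes

module Chains (r m : ℕ) where
  open RegularSteps r m public

  κs : (Cell → Cell → ℚ) → List (Fin r) → Cell → Cell → ℚ
  κs κ [] = κ
  κs κ (k ∷ L) = κs κ L ∩same k

  same-nonneg : ∀ k e f → 0ℚ ≤ℚ same k e f
  same-nonneg k e f = 𝟙-nonneg _

  same-indepˡ : ∀ {k l} → l ≢ k → ∀ e f x → same l (e [ k ]≔ x) f ≡ same l e f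
  same-indepˡ {k} {l} ne e f x = at-update {k} {l} {x} {lookup f l} {e} ne

  same-indepʳ : ∀ {k l} → l ≢ k → ∀ e f x → same l e (f [ k ]≔ x) ≡ same l e f
  same-indepʳ ne e f x = cong (λ v → at _ v e) (lookup∘update′ ne f x)

  ∩same-kernel : ∀ {k l κ} → l ≢ k → Kernel k κ → Kernel k (κ ∩same l)
  ∩same-kernel ne K = record
    { indepˡ = λ e f x → cong₂ _·_ (indepˡ e f x) (same-indepˡ ne e f x)
    ; indepʳ = λ e f x → cong₂ _·_ (indepʳ e f x) (same-indepʳ ne e f x)
    ; diag = λ e → trans (cong (_· _) (diag e)) (*-zeroˡ _)
    ; nonneg = λ e f → *-nonneg (nonneg e f) (same-nonneg _ e f)
    }
    where open Kernel K

  κs-kernel : ∀ {k κ L} → All (k ≢_) L → Kernel k κ → Kernel k (κs κ L)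
  κs-kernel [] K = K
  κs-kernel (p ∷ ps) K = ∩same-kernel (λ z → p (sym z)) (κs-kernel ps K)

  pw : List (Fin r) → ℚ
  pw [] = 1ℚ
  pw (k ∷ L) = ι m · pw L

  pw≡ : ∀ L → pw L ≡ ι (m ^ length L)
  pw≡ [] = sym ι-1
  pw≡ (k ∷ L) = trans (cong (ι m ·_) (pw≡ L)) (sym (ι-* m _))

  pw-nonneg : ∀ L → 0ℚ ≤ℚ pw L
  pw-nonneg L = subst (0ℚ ≤ℚ_) (sym (pw≡ L)) (ι-nonneg _)

  module Chain {ω : (Cell → Bool) → ℚ} {d : ℕ} (ext : Ext ω) (nn : ∀ E → 0ℚ ≤ℚ ω E)
               {κ : Cell → Cell → ℚ} where

    Good : Fin r → Set
    Good k = Kernel k κ × (Regular ω k d ⊎ (∀ x y → FreeMove ω k x y))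

    step-≤ : ∀ {k κ} → Kernel k κ → Regular ω k d ⊎ (∀ x y → FreeMove ω k x y) → ι m · 𝔼 ω (pairs (κ ∩same k)) ≤ℚ 𝔼 ω (pairs κ)
    step-≤ K (inj₁ R) = regular-step-≤ ext nn R K
    step-≤ K (inj₂ F) = ≡⇒≤ (free-step ext F K)

    chain-≤ : ∀ {L} → Unique L → All Good L → pw L · 𝔼 ω (pairs (κs κ L)) ≤ℚ 𝔼 ω (pairs κ)
    chain-≤ [] [] = ≡⇒≤ (*-identityˡ _)
    chain-≤ {k ∷ L} (u ∷ us) ((K , s) ∷ gs) = ≤ℚ-trans (≡⇒≤ (e _ _ _)) (≤ℚ-trans (*-monoˡ (pw-nonneg L) (step-≤ (κs-kernel u K) s)) (chain-≤ us gs))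
      where opaque
              unfolding _+_
              e : ∀ a b c → a · b · c ≡ b · (a · c)
              e = solve-∀ ℚ-ring

    module _ (m-pos : 0ℚ < ι m) (β : ℚ) (β-nonneg : 0ℚ ≤ℚ β) where

      Bounded : Fin r → Set
      Bounded k = ∀ a f → ∑ (hyper k a) (λ e → κ e f) ≤ℚ β

      ∑-hyper-same : ∀ {k l L} → l ≢ k → Kernel l (κs κ L) → ∀ a f →
        ι m · ∑ (hyper k a) (λ e → κs κ (l ∷ L) e f) ≡ ∑ (hyper k a) (λ e → κs κ L e f)
      ∑-hyper-same {k} {l} {L} ne K a f = begin
        ι m · ∑ (hyper k a) (λ e → κs κ L e f · same l e f)
          ≡⟨ cong (ι m ·_) (trans (∑-hyper k a _) (∑-cong cells (λ e → e₁ _ _ _))) ⟩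
        ι m · ∑ cells (λ e → at l (lookup f l) e · (at k a e · κs κ L e f))
          ≡⟨ cong (ι m ·_) (sym (∑-hyper l (lookup f l) _)) ⟩
        ι m · ∑ (hyper l (lookup f l)) (λ e → at k a e · κs κ L e f)
          ≡⟨ ∑-hyper-update l (lookup f l) _ ⟩
        ∑ cells (λ e → at k a (e [ l ]≔ lookup f l) · κs κ L (e [ l ]≔ lookup f l) f)
          ≡⟨ ∑-cong cells (λ e → cong₂ _·_ (at-update {l} {k} {lookup f l} {a} {e} (λ z → ne (sym z))) (Kernel.indepˡ K e f _)) ⟩
        ∑ cells (λ e → at k a e · κs κ L e f)
          ≡⟨ sym (∑-hyper k a _) ⟩
        ∑ (hyper k a) (λ e → κs κ L e f) ∎
        where
        open ≡-Reasoning
        opaque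
          unfolding _+_
          e₁ : ∀ a b c → a · (b · c) ≡ c · (a · b)
          e₁ = solve-∀ ℚ-ring

      -- Each required agreement thins out the cells related to f by exactly m. So the constant B of
      -- `regular-step-≥` shrinks at the same rate as the number of pairs.
      ∑-hyper-κs : ∀ {k L} → All (k ≢_) L → Unique L → All Good L → Bounded k → ∀ a f →
        pw L · ∑ (hyper k a) (λ e → κs κ L e f) ≤ℚ β
      ∑-hyper-κs [] [] [] b a f = ≤ℚ-trans (≡⇒≤ (*-identityˡ _)) (b a f)
      ∑-hyper-κs {k} {l ∷ L} (p ∷ ps) (u ∷ us) ((K , _) ∷ gs) b a f = ≤ℚ-trans
        (≡⇒≤ (trans (e (ι m) (pw L) _) (cong (pw L ·_) (∑-hyper-same {k} {l} {L} (λ z → p (sym z)) (κs-kernel u K) a f))))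
        (∑-hyper-κs ps us gs b a f)
        where opaque
                unfolding _+_
                e : ∀ a b c → a · b · c ≡ b · (a · c)
                e = solve-∀ ℚ-ring

      pw-pos : ∀ L → 0ℚ < pw L
      pw-pos [] = nonneg∧≢0⇒pos 0≤1 (λ ())
      pw-pos (k ∷ L) = *-pos m-pos (pw-pos L)

      -- The difference telescopes over the classes. A free class costs nothing. For a regular class
      -- the power of m in front of its step cancels against B, which is `β` divided by that power,
      -- and `chain-≤` takes its pairs back to the pairs of `κ`; so all regular classes cost the
      -- same.
      chain-≥ : ∀ {L Y} → Unique L → All Good L → All Bounded L →
        All (λ k → Regular ω k d → β · 𝔼 ω (parallel k) ≤ℚ Y) L → 0ℚ ≤ℚ Y →
        ι d · (𝔼 ω (pairs κ) − pw L · 𝔼 ω (pairs (κs κ L))) ≤ℚ ι (length L) · (𝔼 ω (pairs κ) + Y)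
      chain-≥ {Y = Y} [] [] [] [] Ynn = ≡⇒≤ (trans (e (ι d) (𝔼 ω (pairs κ)) (𝔼 ω (pairs κ) + Y)) (cong (_· (𝔼 ω (pairs κ) + Y)) (sym ι-0)))
        where opaque
                unfolding _+_
                e : ∀ d p z → d · (p − 1ℚ · p) ≡ 0ℚ · z
                e = solve-∀ ℚ-ring
      chain-≥ {k ∷ L} {Y} (u ∷ us) ((K , s) ∷ gs) (b ∷ bs) (y ∷ ys) Ynn = ≤ℚ-trans
        (≡⇒≤ (e₁ (ι d) (𝔼 ω (pairs κ)) (pw L) Pₗ (ι m) Pₖ))
        (≤ℚ-trans (+-mono (chain-≥ us gs bs ys Ynn) (one s))
          (≡⇒≤ (trans (e₂ (ι (length L)) _) (cong (_· (𝔼 ω (pairs κ) + Y)) (sym (ι-suc (length L)))))))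
        where
        Pₗ = 𝔼 ω (pairs (κs κ L))
        Pₖ = 𝔼 ω (pairs (κs κ (k ∷ L)))
        nz = 0<⇒≢0 (pw-pos L)
        Bₗ = inv (pw L) · β
        pairs-nonneg : 0ℚ ≤ℚ 𝔼 ω (pairs κ)
        pairs-nonneg = 𝔼-nonneg nn (λ E → inj₂ (∑-nonneg cells (λ e → ∑-nonneg cells (λ f → *-nonneg (Kernel.nonneg K e f) (*-nonneg (𝟙-nonneg _) (𝟙-nonneg _))))))
        opaque
          unfolding _+_
          e₁ : ∀ d p w a m b → d · (p − m · w · b) ≡ d · (p − w · a) + w · (d · (a − m · b))
          e₁ = solve-∀ ℚ-ring
          e₂ : ∀ l z → l · z + z ≡ (1ℚ + l) · z
          e₂ = solve-∀ ℚ-ring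
          e₃ : ∀ w d a → w · (d · (a − a)) ≡ 0ℚ
          e₃ = solve-∀ ℚ-ring
          e₄ : ∀ w p v b q → w · (p + v · b · q) ≡ w · p + (w · v) · (b · q)
          e₄ = solve-∀ ℚ-ring
        bound : ∀ a f → ∑ (hyper k a) (λ e → κs κ L e f) ≤ℚ Bₗ
        bound a f = *-cancelˡ (pw-pos L) (≤ℚ-trans (∑-hyper-κs u us gs b a f)
          (≡⇒≤ (sym (trans (sym (*-assoc _ _ _)) (trans (cong (_· β) (*-inv nz)) (*-identityˡ β))))))
        one : Regular ω k d ⊎ (∀ x y → FreeMove ω k x y) → pw L · (ι d · (Pₗ − ι m · Pₖ)) ≤ℚ 𝔼 ω (pairs κ) + Y
        one (inj₂ F) = ≤ℚ-trans (≡⇒≤ (trans (cong (λ z → pw L · (ι d · (Pₗ − z))) (free-step ext F (κs-kernel u K))) (e₃ _ _ _))) (+-nonneg pairs-nonneg Ynn)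
        one (inj₁ R) = ≤ℚ-trans (*-monoˡ (pw-nonneg L) (regular-step-≥ ext nn R (κs-kernel u K) (*-nonneg (inv-nonneg (pw-nonneg L)) β-nonneg) bound))
          (≤ℚ-trans (≡⇒≤ (e₄ (pw L) Pₗ (inv (pw L)) β _)) (+-mono (chain-≤ us gs)
            (≤ℚ-trans (≡⇒≤ (trans (cong (_· (β · 𝔼 ω (parallel k))) (*-inv nz)) (*-identityˡ _))) (y R))))

all-cong : {A : Set} (xs : List A) {p q : A → Bool} → (∀ x → p x ≡ q x) → all p xs ≡ all q xs
all-cong [] h = refl
all-cong (x ∷ xs) h = cong₂ _∧_ (h x) (all-cong xs h)

∧-true : ∀ {a b} → a ∧ b ≡ true → a ≡ true × b ≡ true
∧-true {true} {true} _ = refl , refl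

all-∈ : {A : Set} {xs : List A} {p : A → Bool} → all p xs ≡ true → ∀ {x} → x ∈ xs → p x ≡ true
all-∈ {xs = x ∷ xs} h (here refl) = proj₁ (∧-true h)
all-∈ {xs = x ∷ xs} h (there q) = all-∈ (proj₂ (∧-true {_} h)) q

∈-all : {A : Set} {xs : List A} {p : A → Bool} → (∀ {x} → x ∈ xs → p x ≡ true) → all p xs ≡ true
∈-all {xs = []} h = refl
∈-all {xs = x ∷ xs} h = cong₂ _∧_ (h (here refl)) (∈-all (λ q → h (there q)))

≡ᵇ-sound : ∀ {a b} → (a ℕ.≡ᵇ b) ≡ true → a ≡ b
≡ᵇ-sound {a} {b} h = ℕ.≡ᵇ⇒≡ a b (subst Bool.T (sym h) _)

≡ᵇ-complete : ∀ {a b} → a ≡ b → (a ℕ.≡ᵇ b) ≡ true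
≡ᵇ-complete {zero} refl = refl
≡ᵇ-complete {suc a} refl = ≡ᵇ-complete {a} refl

bool-≡ : ∀ {a b} → (a ≡ true → b ≡ true) → (b ≡ true → a ≡ true) → a ≡ b
bool-≡ {true} {true} f g = refl
bool-≡ {false} {false} f g = refl
bool-≡ {true} {false} f g = sym (f refl)
bool-≡ {false} {true} f g = g refl

lookup-ext : ∀ {A : Set} {n} {u v : Vec A n} → (∀ l → lookup u l ≡ lookup v l) → u ≡ v
lookup-ext {u = u} {v} h = trans (sym (Vec.tabulate∘lookup u)) (trans (Vec.tabulate-cong h) (Vec.tabulate∘lookup v))

-- The conditional measures with some degrees prescribed

module Weights (r m d : ℕ) where
  open Chains r m public

  Fix : Set
  Fix = Fin r → Fin m → Bool

  -- The size md is a condition of its own because it does not follow from the degrees before some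
  -- class is complete; it determines the total degree of the free vertices of the current class.
  good : Fix → (Cell → Bool) → Bool
  good fix E = all (λ l → all (λ v → not (fix l v) ∨ (deg E l v ℕ.≡ᵇ d)) (allFin m)) (allFin r) ∧ (size E ℕ.≡ᵇ m * d)

  Satisfies : Fix → (Cell → Bool) → Set
  Satisfies fix E = (∀ l v → fix l v ≡ true → deg E l v ≡ d) × size E ≡ m * d

  good-sound : ∀ {fix E} → good fix E ≡ true → Satisfies fix E
  good-sound {fix} {E} h = (λ l v q → ≡ᵇ-sound (go (fix l v) q (all-∈ (all-∈ (proj₁ (∧-true h)) (Membership.∈-allFin l)) (Membership.∈-allFin v))))
      , ≡ᵇ-sound (proj₂ (∧-true {all _ (allFin r)} h))
    where go : ∀ b {c} → b ≡ true → not b ∨ c ≡ true → c ≡ true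
          go true _ h = h

  good-complete : ∀ {fix E} → Satisfies fix E → good fix E ≡ true
  good-complete {fix} {E} (h , s) = cong₂ _∧_
      (∈-all {xs = allFin r} {λ l → all (λ v → not (fix l v) ∨ (deg E l v ℕ.≡ᵇ d)) (allFin m)}
        (λ {l} _ → ∈-all {xs = allFin m} {λ v → not (fix l v) ∨ (deg E l v ℕ.≡ᵇ d)} (λ {v} _ → go l v (fix l v) refl))) (≡ᵇ-complete s)
    where go : ∀ l v b → fix l v ≡ b → not b ∨ (deg E l v ℕ.≡ᵇ d) ≡ true
          go l v true q = ≡ᵇ-complete (h l v q)
          go l v false q = refl

  good-cong : ∀ {fix E E′} → (∀ l v → fix l v ≡ true → deg E l v ≡ deg E′ l v) → size E ≡ size E′ → good fix E ≡ good fix E′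
  good-cong {fix} {E} {E′} h s = bool-≡
    (λ g → good-complete {fix} {E′} ((λ l v q → trans (sym (h l v q)) (proj₁ (good-sound {fix} {E} g) l v q)) , trans (sym s) (proj₂ (good-sound {fix} {E} g))))
    (λ g → good-complete {fix} {E} ((λ l v q → trans (h l v q) (proj₁ (good-sound {fix} {E′} g) l v q)) , trans s (proj₂ (good-sound {fix} {E′} g))))

  weight : Fix → (Cell → Bool) → ℚ
  weight fix E = 𝟙 (good fix E)

  weight-nonneg : ∀ fix E → 0ℚ ≤ℚ weight fix E
  weight-nonneg fix E = 𝟙-nonneg _

  weight-supp : ∀ fix E → weight fix E ≡ 0ℚ ⊎ Satisfies fix E
  weight-supp fix E with good fix E in eq
  ... | true = inj₂ (good-sound {fix} {E} eq)
  ... | false = inj₁ 𝟙-false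

  weight-ext : ∀ fix → Ext (weight fix)
  weight-ext fix h = cong 𝟙 (good-cong {fix} (λ l v _ → deg-ext h l v) (size-ext h))

  deg-move-other : ∀ E c l y l′ v → l′ ≢ l → deg (E ∘ τ c (c [ l ]≔ y)) l′ v ≡ deg E l′ v
  deg-move-other E c l y l′ v ne = deg-τ-same E c (c [ l ]≔ y) l′ v (sym (at-update {l} {l′} {y} {v} {c} ne))

  deg-move-same : ∀ E c l y v → v ≢ lookup c l → v ≢ y → deg (E ∘ τ c (c [ l ]≔ y)) l v ≡ deg E l v
  deg-move-same E c l y v p q = deg-τ-same E c (c [ l ]≔ y) l v
    (trans (at-no {l} {v} {c} (λ z → p (sym z))) (sym (at-no {l} {v} {c [ l ]≔ y} (λ z → q (trans (sym z) (lookup-[]≔ c l y))))))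

  free-weight : ∀ fix {l x y} → fix l x ≡ false → fix l y ≡ false → FreeMove (weight fix) l x y
  free-weight fix {l} {x} {y} fx fy E c p = cong 𝟙 (good-cong {fix} go (size-τ E c (c [ l ]≔ y)))
    where
    go : ∀ l′ v → fix l′ v ≡ true → deg (E ∘ τ c (c [ l ]≔ y)) l′ v ≡ deg E l′ v
    go l′ v t with l′ ≟ᶠ l
    ... | no ne = deg-move-other E c l y l′ v ne
    ... | yes refl = deg-move-same E c l y v (λ z → tf t (trans (cong (fix l) (trans z p)) fx)) (λ z → tf t (trans (cong (fix l) z) fy))
      where tf : ∀ {b} → b ≡ true → b ≡ false → ⊥
            tf refl ()

  module _ {k a a′} (a≢a′ : a ≢ a′) (E : Cell → Bool) {f g : Cell} (pf : lookup f k ≡ a) (pg : lookup g k ≡ a) (f≢g : f ≢ g)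
           (Ef : E f ≡ true) (Ef′ : E (f [ k ]≔ a′) ≡ false) (Eg : E g ≡ false) (Eg′ : E (g [ k ]≔ a′) ≡ true) where

    deg-switch : ∀ l v → deg ((E ∘ τ f (f [ k ]≔ a′)) ∘ τ g (g [ k ]≔ a′)) l v ≡ deg E l v
    deg-switch l v with l ≟ᶠ k
    ... | no ne = trans (deg-move-other (E ∘ τ f (f [ k ]≔ a′)) g k a′ l v ne) (deg-move-other E f k a′ l v ne)
    ... | yes refl = ι-inj (begin
      ι (deg (E₁ ∘ τ g g′) k v)
        ≡⟨ ι-deg-τ E₁ g g′ k v ⟩
      ι (deg E₁ k v) + (at k v g − at k v g′) · (𝟙 (E₁ g′) − 𝟙 (E₁ g))
        ≡⟨ cong₂ _+_ (ι-deg-τ E f f′ k v) (cong₂ _·_ (cong₂ _−_ (at≡ g f (trans pg (sym pf))) (at≡ g′ f′ (trans (lookup-[]≔ g k a′) (sym (lookup-[]≔ f k a′)))))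
             (cong₂ (λ x y → 𝟙 x − 𝟙 y) (trans (Switch.τ₂′ k d a a′ a≢a′ E pg pf (λ z → f≢g (sym z))) Eg′) (trans (Switch.τ₂ k d a a′ a≢a′ E pg pf (λ z → f≢g (sym z))) Eg))) ⟩
      ι (deg E k v) + (at k v f − at k v f′) · (𝟙 (E f′) − 𝟙 (E f)) + (at k v f − at k v f′) · (𝟙 true − 𝟙 false)
        ≡⟨ cong (λ z → ι (deg E k v) + (at k v f − at k v f′) · z + (at k v f − at k v f′) · (𝟙 true − 𝟙 false)) (cong₂ (λ x y → 𝟙 x − 𝟙 y) Ef′ Ef) ⟩
      ι (deg E k v) + (at k v f − at k v f′) · (𝟙 false − 𝟙 true) + (at k v f − at k v f′) · (𝟙 true − 𝟙 false)
        ≡⟨ e _ _ _ _ ⟩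
      ι (deg E k v) ∎)
      where
      open ≡-Reasoning
      f′ = f [ k ]≔ a′
      g′ = g [ k ]≔ a′
      E₁ = E ∘ τ f f′
      at≡ : ∀ c c′ → lookup c k ≡ lookup c′ k → at k v c ≡ at k v c′
      at≡ c c′ = cong (λ y → 𝟙 (does (y ≟ᶠ v)))
      opaque
        unfolding _+_
        e : ∀ a b x y → a + b · (x − y) + b · (y − x) ≡ a
        e = solve-∀ ℚ-ring

    size-switch : size ((E ∘ τ f (f [ k ]≔ a′)) ∘ τ g (g [ k ]≔ a′)) ≡ size E
    size-switch = trans (size-τ (E ∘ τ f (f [ k ]≔ a′)) g (g [ k ]≔ a′)) (size-τ E f (f [ k ]≔ a′))

  -- A factor g(D) is absorbed into the measure. Moves in classes other than i and double moves in
  -- regular classes leave D unchanged, so the agreement inequalities apply to biased measures as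
  -- well.
  biased : Fix → Fin r → Fin m → (ℕ → ℚ) → (Cell → Bool) → ℚ
  biased fix i α g E = weight fix E · g (deg E i α)

  module Biased (fix : Fix) (i : Fin r) (α : Fin m) (g : ℕ → ℚ) (g-nonneg : ∀ t → 0ℚ ≤ℚ g t) where

    ω : (Cell → Bool) → ℚ
    ω = biased fix i α g

    ω-nonneg : ∀ E → 0ℚ ≤ℚ ω E
    ω-nonneg E = *-nonneg (weight-nonneg fix E) (g-nonneg _)

    ω-ext : Ext ω
    ω-ext h = cong₂ _·_ (weight-ext fix h) (cong g (deg-ext h i α))

    ω-supp : ∀ E → ω E ≡ 0ℚ ⊎ Satisfies fix E
    ω-supp E = Sum.map₁ (λ z → trans (cong (_· g (deg E i α)) z) (*-zeroˡ _)) (weight-supp fix E)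

    ω-free : ∀ {l x y} → l ≢ i → fix l x ≡ false → fix l y ≡ false → FreeMove ω l x y
    ω-free {l} {x} {y} ne fx fy E c p = cong₂ _·_ (free-weight fix fx fy E c p) (cong g (deg-move-other E c l y i α (λ z → ne (sym z))))

    ω-regular : ∀ {k} → (∀ v → fix k v ≡ true) → Regular ω k d
    ω-regular {k} h = record
      { regular = λ E → Sum.map₂ (λ s v → proj₁ s k v (h v)) (ω-supp E)
      ; switch = λ a≢a′ E f g′ pf pg ne e₁ e₂ e₃ e₄ → cong₂ _·_
          (cong 𝟙 (good-cong {fix} (λ l v _ → deg-switch a≢a′ E pf pg ne e₁ e₂ e₃ e₄ l v) (size-switch a≢a′ E pf pg ne e₁ e₂ e₃ e₄)))
          (cong g (deg-switch a≢a′ E pf pg ne e₁ e₂ e₃ e₄ i α))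
      }

  sames : List (Fin r) → Cell → Cell → ℚ
  sames L = κs (λ _ _ → 1ℚ) L

  κs-sames : ∀ κ L e f → κs κ L e f ≡ κ e f · sames L e f
  κs-sames κ [] e f = sym (*-identityʳ _)
  κs-sames κ (k ∷ L) e f = trans (cong (_· same k e f) (κs-sames κ L e f)) (*-assoc _ _ _)

  sames-agree : ∀ L e f → (∀ {l} → l ∈ L → lookup e l ≡ lookup f l) → sames L e f ≡ 1ℚ
  sames-agree [] e f h = refl
  sames-agree (l ∷ L) e f h = trans (cong₂ _·_ (sames-agree L e f (λ q → h (there q))) (at-yes {l} {lookup f l} {e} (h (here refl)))) (*-identityˡ _)

  sames-differ : ∀ L e f → sames L e f ≡ 0ℚ ⊎ (∀ {l} → l ∈ L → lookup e l ≡ lookup f l)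
  sames-differ [] e f = inj₂ λ ()
  sames-differ (k ∷ L) e f with lookup e k ≟ᶠ lookup f k | sames-differ L e f
  ... | no ne | _ = inj₁ (trans (cong (sames L e f ·_) 𝟙-false) (*-zeroʳ _))
  ... | yes _ | inj₁ z = inj₁ (trans (cong (_· 𝟙 true) z) (*-zeroˡ _))
  ... | yes p | inj₂ h = inj₂ λ { (here refl) → p ; (there q) → h q }

  at·sames : ∀ {k L} → (∀ {l} → l ∈ L → l ≢ k) → (∀ {l} → l ≢ k → l ∈ L) → ∀ x e f →
    at k x e · sames L e f ≡ 𝟙 (does (e ≟ᶜ (f [ k ]≔ x)))
  at·sames {k} {L} sound complete x e f with e ≟ᶜ (f [ k ]≔ x)
  ... | yes refl = trans (cong₂ _·_ (at-yes {k} {x} {f [ k ]≔ x} (lookup-[]≔ f k x)) (sames-agree L (f [ k ]≔ x) f (λ q → lookup∘update′ (sound q) f x)))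
          (trans (*-identityˡ _) (sym 𝟙-true))
  ... | no ne with lookup e k ≟ᶠ x | sames-differ L e f
  ... | no _ | _ = trans (cong (_· sames L e f) 𝟙-false) (trans (*-zeroˡ _) (sym 𝟙-false))
  ... | yes _ | inj₁ z = trans (cong (𝟙 true ·_) z) (trans (*-zeroʳ _) (sym 𝟙-false))
  ... | yes p | inj₂ h = contradiction (lookup-ext go) ne
    where go : ∀ l → lookup e l ≡ lookup (f [ k ]≔ x) l
          go l with l ≟ᶠ k
          ... | yes refl = trans p (sym (lookup-[]≔ f k x))
          ... | no q = trans (h (complete q)) (sym (lookup∘update′ q f x))

  ∑-δᶜ : ∀ e (g : Cell → ℚ) → ∑ cells (λ c → 𝟙 (does (c ≟ᶜ e)) · g c) ≡ g e
  ∑-δᶜ e g = ∑-δ _≟ᶜ_ g (allEdges-unique r m) (allEdges-complete e)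

  ∑-sames : ∀ {k L} → (∀ {l} → l ∈ L → l ≢ k) → (∀ {l} → l ≢ k → l ∈ L) → ∀ f (g : Cell → ℚ) →
    ∑ cells (λ e → sames L e f · g e) ≡ ∑ (allFin m) (λ x → g (f [ k ]≔ x))
  ∑-sames {k} {L} sound complete f g = trans (sym (∑-hyper-all k _)) (∑-cong (allFin m) (λ x →
    trans (∑-hyper k x _) (trans (∑-cong cells (λ e → trans (sym (*-assoc _ _ _)) (cong (_· g e) (at·sames sound complete x e f)))) (∑-δᶜ _ g))))

  -- Agreement in the current class i belongs to the starting kernel rather than to the chain, since
  -- class i is neither regular nor wholly free.
  parallel-pairs : ∀ {i k L} → (∀ {l} → l ∈ i ∷ L → l ≢ k) → (∀ {l} → l ≢ k → l ∈ i ∷ L) → ∀ E →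
    parallel k E ≡ pairs (κs (λ e f → (1ℚ − same k e f) · same i e f) L) E
  parallel-pairs {i} {k} {L} sound complete E = sym (begin
    ∑ cells (λ e → ∑ cells (λ f → κs base L e f · (𝟙 (E e) · 𝟙 (E f))))
      ≡⟨ ∑-swap cells cells _ ⟩
    ∑ cells (λ f → ∑ cells (λ e → κs base L e f · (𝟙 (E e) · 𝟙 (E f))))
      ≡⟨ ∑-cong cells (λ f → trans (∑-cong cells (λ e → trans (cong (_· (𝟙 (E e) · 𝟙 (E f))) (κs-sames base L e f)) (reorder _ _ _ _)))
           (trans (∑-sames sound complete f _) (∑-cong (allFin m) (λ x → cong₂ _·_ (cong (λ z → 1ℚ − 𝟙 z) (trans (cong (λ y → does (y ≟ᶠ lookup f k)) (lookup-[]≔ f k x)) (does-sym x _))) (*-comm _ _))))) ⟩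
    ∑ cells (λ f → ∑ (allFin m) (λ x → ne (lookup f k) x · (𝟙 (E f) · 𝟙 (E (f [ k ]≔ x)))))
      ≡⟨ sym (∑-hyper-all k _) ⟩
    ∑ (allFin m) (λ a → ∑ (hyper k a) (λ f → ∑ (allFin m) (λ x → ne (lookup f k) x · (𝟙 (E f) · 𝟙 (E (f [ k ]≔ x))))))
      ≡⟨ ∑-cong (allFin m) (λ a → trans (∑-congᴬ (hyper-at k a) (λ f p → cong (λ a → ∑ (allFin m) (λ x → ne a x · (𝟙 (E f) · 𝟙 (E (f [ k ]≔ x))))) p))
           (trans (∑-swap (hyper k a) (allFin m) _) (∑-cong (allFin m) (λ x → ∑-*ˡ (hyper k a) (ne a x) _)))) ⟩
    parallel k E ∎)
    where
    open ≡-Reasoning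
    base : Cell → Cell → ℚ
    base e f = (1ℚ − same k e f) · same i e f
    opaque
      unfolding _+_
      reorder : ∀ n s t z → n · s · t · z ≡ t · s · (n · z)
      reorder = solve-∀ ℚ-ring

-- One stage: agreeing pairs between α and the other free vertices

module Stage (r m d : ℕ) (i : Fin r) where
  open Weights r m d public

  -- Ensures that every class other than the current one admits either the regular or the free step.
  Uniform : Fix → Set
  Uniform fix = ∀ l → l ≢ i → (∀ v → fix l v ≡ true) ⊎ (∀ v → fix l v ≡ false)

  rest : List (Fin r)
  rest = others i (allFin r)

  rest-unique : Unique rest
  rest-unique = others-unique i (Unique.allFin⁺ r)

  D : (Cell → Bool) → Fin m → ℚ
  D E v = ι (deg E i v)

  module _ (fix : Fix) (uniform : Uniform fix) (α : Fin m) (g : ℕ → ℚ) (g-nonneg : ∀ t → 0ℚ ≤ℚ g t) where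
    open Biased fix i α g g-nonneg

    good-class : ∀ {κ l} → l ≢ i → Kernel l κ → Chain.Good {ω} {d} ω-ext ω-nonneg {κ} l
    good-class {l = l} ne K = K , Sum.map ω-regular (λ h x y → ω-free ne (h x) (h y)) (uniform l ne)

  module Base (α : Fin m) (S : Fin m → Bool) (Sα : S α ≡ false) where

    -- Pairs with one cell at α and one at a vertex of S. It looks at class i alone, and the
    -- diagonal vanishes because α is outside S.
    base : Cell → Cell → ℚ
    base e f = at i α e · 𝟙 (S (lookup f i))

    base-kernel : ∀ {k} → k ≢ i → Kernel k base
    base-kernel {k} ne = record
      { indepˡ = λ e f x → cong (_· 𝟙 (S (lookup f i))) (at-update {k} {i} {x} {α} {e} (λ z → ne (sym z)))
      ; indepʳ = λ e f x → cong (λ y → at i α e · 𝟙 (S y)) (lookup∘update′ (λ z → ne (sym z)) f x)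
      ; diag = diag
      ; nonneg = λ e f → *-nonneg (𝟙-nonneg _) (𝟙-nonneg _)
      }
      where diag : ∀ e → base e e ≡ 0ℚ
            diag e with lookup e i ≟ᶠ α
            ... | yes p = trans (cong (𝟙 true ·_) (trans (cong 𝟙 (trans (cong S p) Sα)) 𝟙-false)) (*-zeroʳ _)
            ... | no _ = trans (cong (_· 𝟙 (S (lookup e i))) 𝟙-false) (*-zeroˡ _)

    common : (Cell → Bool) → ℚ
    common E = ∑ cells (λ f → 𝟙 (S (lookup f i)) · (𝟙 (E (f [ i ]≔ α)) · 𝟙 (E f)))

    total : (Cell → Bool) → ℚ
    total E = ∑ (allFin m) (λ v → 𝟙 (S v) · D E v)

    -- Agreement with f in every class but i leaves a single cell at α, so the sum over e collapses
    -- and the number C of lines remains.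
    common≡ : ∀ E → pairs (κs base rest) E ≡ common E
    common≡ E = trans (∑-swap cells cells _) (∑-cong cells (λ f → trans (∑-cong cells (λ e →
        trans (cong (_· (𝟙 (E e) · 𝟙 (E f))) (trans (κs-sames base rest e f) (trans (e₁ _ _ _) (cong (𝟙 (S (lookup f i)) ·_) (at·sames sound complete α e f)))))
          (e₂ _ _ _)))
      (∑-δᶜ (f [ i ]≔ α) (λ e → 𝟙 (S (lookup f i)) · (𝟙 (E e) · 𝟙 (E f))))))
      where
      sound : ∀ {l} → l ∈ rest → l ≢ i
      sound q = All.lookup (others-≢ i (allFin r)) q
      complete : ∀ {l} → l ≢ i → l ∈ rest
      complete ne = ∈-others (Membership.∈-allFin _) ne
      opaque
        unfolding _+_
        e₁ : ∀ a s t → a · s · t ≡ s · (a · t)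
        e₁ = solve-∀ ℚ-ring
        e₂ : ∀ s δ x → s · δ · x ≡ δ · (s · x)
        e₂ = solve-∀ ℚ-ring

    pairs-base : ∀ E → pairs base E ≡ D E α · total E
    pairs-base E = begin
      ∑ cells (λ e → ∑ cells (λ f → at i α e · 𝟙 (S (lookup f i)) · (𝟙 (E e) · 𝟙 (E f))))
        ≡⟨ ∑-cong cells (λ e → trans (∑-cong cells (λ f → e₁ _ _ _ _)) (∑-*ˡ cells _ _)) ⟩
      ∑ cells (λ e → (at i α e · 𝟙 (E e)) · ∑ cells (λ f → 𝟙 (S (lookup f i)) · 𝟙 (E f)))
        ≡⟨ ∑-*ʳ cells _ _ ⟩
      ∑ cells (λ e → at i α e · 𝟙 (E e)) · ∑ cells (λ f → 𝟙 (S (lookup f i)) · 𝟙 (E f))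
        ≡⟨ cong₂ _·_ (trans (sym (∑-hyper i α _)) (sym (ι-deg′ E i α))) (trans (sym (∑-hyper-all i _)) (∑-cong (allFin m) (λ v →
             trans (∑-congᴬ (hyper-at i v) (λ f p → cong (λ y → 𝟙 (S y) · 𝟙 (E f)) p)) (trans (∑-*ˡ (hyper i v) _ _) (cong (𝟙 (S v) ·_) (sym (ι-deg′ E i v))))))) ⟩
      D E α · total E ∎
      where
      open ≡-Reasoning
      opaque
        unfolding _+_
        e₁ : ∀ a s x y → a · s · (x · y) ≡ (a · x) · (s · y)
        e₁ = solve-∀ ℚ-ring

    module _ (fix : Fix) (uniform : Uniform fix) (g : ℕ → ℚ) (g-nonneg : ∀ t → 0ℚ ≤ℚ g t) where
      open Biased fix i α g g-nonneg

      good-rest : All (Chain.Good {ω} {d} ω-ext ω-nonneg {base}) rest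
      good-rest = All.map (λ ne → good-class fix uniform α g g-nonneg ne (base-kernel ne)) (others-≢ i (allFin r))

      common-≤ : ι (m ^ length rest) · 𝔼 ω common ≤ℚ 𝔼 ω (λ E → D E α · total E)
      common-≤ = subst₂ _≤ℚ_ (cong₂ _·_ (pw≡ rest) (𝔼-cong common≡)) (𝔼-cong pairs-base)
        (Chain.chain-≤ ω-ext ω-nonneg rest-unique good-rest)

  module Unbiased (fix : Fix) (uniform : Uniform fix) (α : Fin m) where
    open Biased fix i α (λ _ → 1ℚ) (λ _ → 0≤1) public

    N : ℚ
    N = 𝔼 ω (λ _ → 1ℚ)

    N-nonneg : 0ℚ ≤ℚ N
    N-nonneg = 𝔼-nonneg ω-nonneg (λ _ → inj₂ 0≤1)

    𝔼-const : ∀ c → 𝔼 ω (λ _ → c) ≡ c · N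
    𝔼-const c = trans (𝔼-cong (λ _ → sym (*-identityʳ c))) (𝔼-· c (λ _ → 1ℚ))

    free : Fin m → ℚ
    free v = 𝟙 (not (fix i v))

    frees : ℚ
    frees = ∑ (allFin m) free

    move-free : ∀ {x y} → fix i x ≡ false → fix i y ≡ false → FreeMove ω i x y
    move-free fx fy E c p = cong (_· 1ℚ) (free-weight fix fx fy E c p)

    frees-pos : ∀ {v} → fix i v ≡ false → 0ℚ < frees
    frees-pos {v} fv = ℚ.<-≤-trans (nonneg∧≢0⇒pos 0≤1 (λ ())) (≤ℚ-trans (≡⇒≤ (sym (trans (∑-δᶠ v free) (trans (cong (λ b → 𝟙 (not b)) fv) 𝟙-true))))
      (∑-mono (allFin m) (λ x → ≤ℚ-trans (*-monoʳ (𝟙-nonneg _) (𝟙-≤1 _)) (≡⇒≤ (*-identityˡ _)))))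

    D-all : ∀ E → Satisfies fix E → ∑ (allFin m) (D E) ≡ ι m · ι d
    D-all E (_ , s) = trans (sym (ι-size-deg E i)) (trans (cong ι s) (ι-* m d))

    -- Prescribed vertices use up d of the md edges each. Writing a summand as (D - d) + d · [free]
    -- covers both kinds of vertices at once.
    D-free : ∀ E → Satisfies fix E → ∑ (allFin m) (λ v → free v · D E v) ≡ ι d · frees
    D-free E (h , s) = begin
      ∑ (allFin m) (λ v → free v · D E v)
        ≡⟨ ∑-cong (allFin m) (λ v → go v (fix i v) refl) ⟩
      ∑ (allFin m) (λ v → (D E v − ι d) + ι d · free v)
        ≡⟨ trans (∑-+ (allFin m) _ _) (cong₂ _+_ (trans (∑-− (allFin m) _ _) (cong₂ _−_ (D-all E (h , s)) (trans (∑-const (allFin m) _) (cong (λ n → ι n · ι d) (length-allFin m))))) (∑-*ˡ (allFin m) (ι d) _)) ⟩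
      (ι m · ι d − ι m · ι d) + ι d · frees
        ≡⟨ trans (cong (_+ ι d · frees) (a−a _)) (+-identityˡ _) ⟩
      ι d · frees ∎
      where
      open ≡-Reasoning
      opaque
        unfolding _+_
        e₁ : ∀ x d → 1ℚ · x ≡ (x − d) + d · 1ℚ
        e₁ = solve-∀ ℚ-ring
        e₀ : ∀ d → 0ℚ · d ≡ (d − d) + d · 0ℚ
        e₀ = solve-∀ ℚ-ring
      go : ∀ v b → fix i v ≡ b → 𝟙 (not b) · D E v ≡ (D E v − ι d) + ι d · 𝟙 (not b)
      go v true q = trans (cong (λ z → 𝟙 false · ι z) (h i v q)) (trans (cong (_· ι d) 𝟙-false) (trans (e₀ (ι d))
        (cong₂ (λ x y → (ι x − ι d) + ι d · y) (sym (h i v q)) (sym 𝟙-false))))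
      go v false q = trans (cong (_· D E v) 𝟙-true) (trans (e₁ _ (ι d)) (cong (λ y → (D E v − ι d) + ι d · y) (sym 𝟙-true)))

    average : ∀ {v} → fix i v ≡ false → (X : Fin m → ℚ) → (∀ v′ → fix i v′ ≡ false → X v′ ≡ X v) → ∑ (allFin m) (λ v′ → free v′ · X v′) ≡ frees · X v
    average {v} fv X h = trans (∑-cong (allFin m) (λ v′ → go v′ (fix i v′) refl)) (∑-*ʳ (allFin m) _ _)
      where go : ∀ v′ b → fix i v′ ≡ b → 𝟙 (not b) · X v′ ≡ 𝟙 (not b) · X v
            go v′ true q = trans (cong (_· X v′) 𝟙-false) (trans (*-zeroˡ _) (sym (trans (cong (_· X v) 𝟙-false) (*-zeroˡ _))))
            go v′ false q = cong (𝟙 true ·_) (h v′ q)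

    𝔼D : Fin m → ℚ
    𝔼D v = 𝔼 ω (λ E → D E v)

    𝔼D-hyper : ∀ v → 𝔼D v ≡ ∑ (hyper i v) (λ e → 𝔼 ω (λ E → 𝟙 (E e)))
    𝔼D-hyper v = trans (𝔼-cong (λ E → ι-deg′ E i v)) (𝔼-∑ (hyper i v) _)

    𝔼D-free : ∀ {v v′} → fix i v ≡ false → fix i v′ ≡ false → 𝔼D v′ ≡ 𝔼D v
    𝔼D-free {v} {v′} fv fv′ = trans (𝔼D-hyper v′) (trans (sym (∑-hyper-move i v v′ _)) (trans (∑-congᴬ (hyper-at i v) (λ e p →
        trans (𝔼-weight (λ E → cong₂ _·_ (sym (move-free fv fv′ E e p)) (cong (λ c → 𝟙 (E c)) (sym (τ-at refl)))))
          (𝔼-τ {ω} {λ E → 𝟙 (E e)} e (e [ i ]≔ v′) (λ h → cong₂ _·_ (ω-ext h) (cong 𝟙 (h e)))))) (sym (𝔼D-hyper v))))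

    -- A prescribed vertex has degree d outright; the free ones have equal means by symmetry, and
    -- their total is d for each of them.
    𝔼D≡ : ∀ v → 𝔼D v ≡ ι d · N
    𝔼D≡ v = go (fix i v) refl
      where
      go : ∀ b → fix i v ≡ b → 𝔼D v ≡ ι d · N
      go true q = trans (𝔼-supp (λ E → Sum.map₂ (λ s → cong ι (proj₁ s i v q)) (ω-supp E))) (𝔼-const (ι d))
      go false q = *-cancelˡ-≡ (frees-pos q) (trans (sym (average q 𝔼D (λ v′ q′ → 𝔼D-free q q′)))
        (trans (trans (∑-cong (allFin m) (λ v′ → sym (𝔼-· (free v′) _))) (sym (𝔼-∑ (allFin m) _)))
          (trans (𝔼-supp (λ E → Sum.map₂ (D-free E) (ω-supp E))) (trans (𝔼-const _) (e _ _ _)))))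
        where opaque
                unfolding _+_
                e : ∀ d f n → d · f · n ≡ f · (d · n)
                e = solve-∀ ℚ-ring

    module _ (k : Fin r) (k≢i : k ≢ i) where

      nk : Cell → Cell → ℚ
      nk e f = 1ℚ − same k e f

      nk-nonneg : ∀ e f → 0ℚ ≤ℚ nk e f
      nk-nonneg e f = 0≤b−a (𝟙-≤1 _)

      Q : Fin m → Fin m → (Cell → Bool) → ℚ
      Q = qpair i nk

      Q-≤ : ∀ v v′ E → Q v v′ E ≤ℚ D E v · D E v′
      Q-≤ v v′ E = ≤ℚ-trans (∑-mono (hyper i v) (λ e → ∑-mono (hyper i v′) (λ f →
          ≤ℚ-trans (*-monoʳ (*-nonneg (𝟙-nonneg _) (𝟙-nonneg _)) (a−b≤a (𝟙-nonneg _))) (≡⇒≤ (*-identityˡ _)))))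
        (≡⇒≤ (trans (∑-cong (hyper i v) (λ e → ∑-*ˡ (hyper i v′) _ _)) (trans (∑-*ʳ (hyper i v) _ _) (cong₂ _·_ (sym (ι-deg′ E i v)) (sym (ι-deg′ E i v′))))))

      𝔼Q : Fin m → Fin m → ℚ
      𝔼Q v v′ = 𝔼 ω (Q v v′)

      𝔼Q-hyper : ∀ v v′ → 𝔼Q v v′ ≡ ∑ (hyper i v) (λ e → ∑ (hyper i v′) (λ f → nk e f · 𝔼 ω (λ E → 𝟙 (E e) · 𝟙 (E f))))
      𝔼Q-hyper v v′ = trans (𝔼-∑ (hyper i v) _) (∑-cong (hyper i v) (λ e → trans (𝔼-∑ (hyper i v′) _) (∑-cong (hyper i v′) (λ f → 𝔼-· _ _))))

      𝔼Q-free : ∀ {v v′} → fix i v ≡ false → fix i v′ ≡ false → 𝔼Q v′ v ≡ 𝔼Q v v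
      𝔼Q-free {v} {v′} fv fv′ = trans (𝔼Q-hyper v′ v) (trans (sym (∑-hyper-move i v v′ _)) (trans (∑-congᴬ (hyper-at i v) (λ e p →
          ∑-cong (hyper i v) (λ f → go e f p))) (sym (𝔼Q-hyper v v))))
        where
        nk≢0 : ∀ {e f} → nk e f ≢ 0ℚ → lookup e k ≢ lookup f k
        nk≢0 {e} {f} nz q = nz (trans (cong (λ z → 1ℚ − z) (at-yes {k} {lookup f k} {e} q)) 1−1)
        go : ∀ e f → lookup e i ≡ v → nk (e [ i ]≔ v′) f · 𝔼 ω (λ E → 𝟙 (E (e [ i ]≔ v′)) · 𝟙 (E f)) ≡ nk e f · 𝔼 ω (λ E → 𝟙 (E e) · 𝟙 (E f))
        go e f p with nk e f ℚ.≟ 0ℚ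
        ... | yes z = trans (0·≡0· _ 0ℚ (trans (cong (λ x → 1ℚ − x) (same-indepˡ k≢i e f v′)) z)) (trans (*-zeroʳ _) (sym (0≡ z)))
          where 0≡ : ∀ {a x} → a ≡ 0ℚ → a · x ≡ 0ℚ
                0≡ refl = *-zeroˡ _
        ... | no nz = cong₂ _·_ (cong (λ x → 1ℚ − x) (same-indepˡ k≢i e f v′)) (free-pair ω-ext (move-free fv fv′) p
            (λ q → nk≢0 {e} {f} nz (cong (λ c → lookup c k) (sym q)))
            (λ q → nk≢0 {e} {f} nz (trans (sym (lookup∘update′ k≢i e v′)) (cong (λ c → lookup c k) (sym q)))))

      -- Two edges that differ in class k remain different when one of them moves within class i. So
      -- for a free v the first edge may be spread over all free vertices, and averaging replaces
      -- one factor of D · D by the mean d. This takes the place of a second-moment bound.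
      𝔼Q-diag : ∀ v → 𝔼Q v v ≤ℚ ι d · 𝔼D v
      𝔼Q-diag v = go (fix i v) refl
        where
        go : ∀ b → fix i v ≡ b → 𝔼Q v v ≤ℚ ι d · 𝔼D v
        go true q = ≤ℚ-trans (𝔼-mono ω-nonneg (λ E → Sum.map₂ (λ s → ≤ℚ-trans (Q-≤ v v E) (≡⇒≤ (cong (λ z → ι z · D E v) (proj₁ s i v q)))) (ω-supp E))) (≡⇒≤ (𝔼-· _ _))
        go false q = *-cancelˡ (frees-pos q) (≤ℚ-trans (≡⇒≤ (trans (sym (average q (λ v′ → 𝔼Q v′ v) (λ v′ q′ → 𝔼Q-free q q′)))
            (trans (∑-cong (allFin m) (λ v′ → sym (𝔼-· (free v′) _))) (sym (𝔼-∑ (allFin m) _)))))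
          (≤ℚ-trans (𝔼-mono ω-nonneg (λ E → Sum.map₂ (λ s → ≤ℚ-trans (∑-mono (allFin m) (λ v′ → *-monoˡ (𝟙-nonneg _) (Q-≤ v′ v E)))
              (≡⇒≤ (trans (∑-cong (allFin m) (λ v′ → sym (*-assoc _ _ _))) (trans (∑-*ʳ (allFin m) _ _) (trans (cong (_· D E v) (D-free E s)) (e _ _ _)))))) (ω-supp E)))
            (≡⇒≤ (trans (𝔼-· _ _) (cong (frees ·_) (𝔼-· _ _))))))
          where opaque
                  unfolding _+_
                  e : ∀ d f x → d · f · x ≡ f · (d · x)
                  e = solve-∀ ℚ-ring

      pairs-nk : 𝔼 ω (pairs (nk ∩same i)) ≤ℚ ι d · (ι m · ι d · N)
      pairs-nk = ≤ℚ-trans (≡⇒≤ (trans (𝔼-cong (λ E → sym (qpair-diag i nk E))) (𝔼-∑ (allFin m) _)))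
        (≤ℚ-trans (∑-mono (allFin m) 𝔼Q-diag) (≡⇒≤ (trans (∑-*ˡ (allFin m) (ι d) _) (cong (ι d ·_)
          (trans (∑-cong (allFin m) 𝔼D≡) (trans (∑-const (allFin m) _) (trans (cong (λ n → ι n · (ι d · N)) (length-allFin m)) (sym (*-assoc _ _ _)))))))))

      rest′ : List (Fin r)
      rest′ = others i (others k (allFin r))

      nk-kernel : ∀ {l} → l ≢ k → l ≢ i → Kernel l (nk ∩same i)
      nk-kernel {l} lk li = ∩same-kernel (λ z → li (sym z)) (record
        { indepˡ = λ e f x → cong (λ z → 1ℚ − z) (same-indepˡ (λ z → lk (sym z)) e f x)
        ; indepʳ = λ e f x → cong (λ z → 1ℚ − z) (same-indepʳ (λ z → lk (sym z)) e f x)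
        ; diag = λ e → trans (cong (λ z → 1ℚ − z) (at-yes {k} {lookup e k} {e} refl)) 1−1
        ; nonneg = nk-nonneg
        })

      -- Pairs differing exactly in class k are pairs within vertices of class i that agree in the r
      -- - 2 other classes. Only `chain-≤` enters, so the bound may be used to prove the reverse
      -- estimate.
      parallel-bound : ι (m ^ length rest′) · 𝔼 ω (parallel k) ≤ℚ ι d · (ι m · ι d · N)
      parallel-bound = ≤ℚ-trans (≡⇒≤ (cong₂ _·_ (sym (pw≡ rest′)) (𝔼-cong (λ E → parallel-pairs {i} {k} {rest′} sound complete E))))
        (≤ℚ-trans (Chain.chain-≤ ω-ext ω-nonneg (others-unique i (others-unique k (Unique.allFin⁺ r))) goods) pairs-nk)
        where
        in-rest′ : ∀ {l} → l ∈ rest′ → l ≢ i × l ≢ k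
        in-rest′ q = All.lookup (others-≢ i (others k (allFin r))) q ,
          All.lookup (others-≢ k (allFin r)) (proj₁ (Membership.∈-filter⁻ (λ l → ¬? (l ≟ᶠ i)) {xs = others k (allFin r)} q))
        sound : ∀ {l} → l ∈ i ∷ rest′ → l ≢ k
        sound (here refl) z = k≢i (sym z)
        sound (there q) = proj₂ (in-rest′ q)
        complete : ∀ {l} → l ≢ k → l ∈ i ∷ rest′
        complete {l} ne with l ≟ᶠ i
        ... | yes refl = here refl
        ... | no li = there (∈-others (∈-others (Membership.∈-allFin l) ne) li)
        goods : All (Chain.Good {ω} {d} ω-ext ω-nonneg {nk ∩same i}) rest′
        goods = All.tabulate (λ q → good-class fix uniform α (λ _ → 1ℚ) (λ _ → 0≤1) (proj₁ (in-rest′ q)) (nk-kernel (proj₂ (in-rest′ q)) (proj₁ (in-rest′ q))))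

-- The deviation of the line count, and the moves between α and the other free vertices

module StageBound (r m d : ℕ) (i : Fin r) (d≥1 : 1 ≤ d) (fix : Fin r → Fin m → Bool) (uniform : Stage.Uniform r m d i fix)
                  (α : Fin m) (α-free : fix i α ≡ false) (b : ℕ) (b≡ : ∑ (allFin m) (λ v → 𝟙 (not (fix i v))) ≡ ι b) where
  open Stage r m d i public

  S : Fin m → Bool
  S v = not (fix i v) ∧ not (does (v ≟ᶠ α))

  Sα : S α ≡ false
  Sα rewrite α-free | dec-true (α ≟ᶠ α) refl = refl

  open Base α S Sα public

  fix′ : Fix
  fix′ l v = fix l v ∨ (does (l ≟ᶠ i) ∧ does (v ≟ᶠ α))

  uniform′ : Uniform fix′
  uniform′ l ne = Sum.map (λ h v → trans (same-fix v) (h v)) (λ h v → trans (same-fix v) (h v)) (uniform l ne)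
    where same-fix : ∀ v → fix′ l v ≡ fix l v
          same-fix v with l ≟ᶠ i
          ... | yes p = contradiction p ne
          ... | no _ with fix l v
          ... | true = refl
          ... | false = refl

  fix′-α : fix′ i α ≡ true
  fix′-α rewrite dec-true (i ≟ᶠ i) refl | dec-true (α ≟ᶠ α) refl | α-free = refl

  satisfies′ : ∀ E → Satisfies fix′ E → Satisfies fix E
  satisfies′ E (h , s) = (λ l v q → h l v (cong (_∨ (does (l ≟ᶠ i) ∧ does (v ≟ᶠ α))) q)) , s

  satisfies″ : ∀ E → Satisfies fix E → deg E i α ≡ d → Satisfies fix′ E
  satisfies″ E (h , s) e = go , s
    where
    go : ∀ l v → fix l v ∨ (does (l ≟ᶠ i) ∧ does (v ≟ᶠ α)) ≡ true → deg E l v ≡ d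
    go l v q with l ≟ᶠ i | v ≟ᶠ α | fix l v in eq
    ... | _ | _ | true = h l v eq
    ... | yes refl | yes refl | false = e
    ... | yes _ | no _ | false with () ← q
    ... | no _ | _ | false with () ← q

  bd : ℚ
  bd = ι d · ι b

  𝟙S : ∀ v → 𝟙 (S v) ≡ 𝟙 (not (fix i v)) − 𝟙 (does (v ≟ᶠ α))
  𝟙S v with v ≟ᶠ α
  ... | yes refl rewrite α-free = trans 𝟙-false (sym (a−a _))
  ... | no _ with fix i v
  ... | true = sym (a−0 _)
    where opaque
            unfolding 𝟙 _+_
            a−0 : ∀ a → a − 𝟙 false ≡ a
            a−0 = solve-∀ ℚ-ring
  ... | false = sym (a−0 _)
    where opaque
            unfolding 𝟙 _+_
            a−0 : ∀ a → a − 𝟙 false ≡ a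
            a−0 = solve-∀ ℚ-ring

  ∑S : ∀ (X : Fin m → ℚ) → ∑ (allFin m) (λ v → 𝟙 (S v) · X v) ≡ ∑ (allFin m) (λ v → 𝟙 (not (fix i v)) · X v) − X α
  ∑S X = trans (∑-cong (allFin m) (λ v → trans (cong (_· X v) (𝟙S v)) (e _ _ _))) (trans (∑-− (allFin m) _ _) (cong (λ z → _ − z) (∑-δᶠ α X)))
    where opaque
            unfolding _+_
            e : ∀ a b x → (a − b) · x ≡ a · x − b · x
            e = solve-∀ ℚ-ring

  total≡ : ∀ E → Satisfies fix E → total E ≡ bd − D E α
  total≡ E s = trans (∑S (D E)) (cong (_− D E α) (trans (Unbiased.D-free fix uniform α E s) (cong (ι d ·_) b≡)))

  D≤bd : ∀ E → Satisfies fix E → D E α ≤ℚ bd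
  D≤bd E s = 0≤b−a⇒a≤b (subst (0ℚ ≤ℚ_) (total≡ E s) (∑-nonneg (allFin m) (λ v → *-nonneg (𝟙-nonneg _) (ι-nonneg _))))

  n : ℚ
  n = ι (m ^ length rest)

  -- n times the difference between the expected and the actual number of lines
  -- in direction i that meet E in α and in another free vertex.
  η : (Cell → Bool) → ℚ
  η E = D E α · (bd − D E α) − n · common E

  -- Agreement in each class is at most as likely as 1/m under every biased measure; that g is
  -- arbitrary is what replaces absolute values later.
  η-sign : ∀ g → (∀ t → 0ℚ ≤ℚ g t) → 0ℚ ≤ℚ 𝔼 (biased fix i α g) η
  η-sign g gnn = subst (0ℚ ≤ℚ_) (sym (trans (𝔼-− _ _) (cong₂ _−_
      (𝔼-supp (λ E → Sum.map₂ (λ s → cong (D E α ·_) (sym (total≡ E s))) (Biased.ω-supp fix i α g gnn E))) (𝔼-· n common))))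
    (0≤b−a (common-≤ fix uniform g gnn))

  length-rest : suc (length rest) ≡ r
  length-rest = trans (length-others (Unique.allFin⁺ r) (Membership.∈-allFin i)) (length-allFin r)

  length-rest′ : ∀ k → k ≢ i → suc (suc (length (others i (others k (allFin r))))) ≡ r
  length-rest′ k ne = trans (cong suc (length-others (others-unique k (Unique.allFin⁺ r)) (∈-others (Membership.∈-allFin i) (λ z → ne (sym z)))))
    (trans (length-others (Unique.allFin⁺ r) (Membership.∈-allFin k)) (length-allFin r))

  -- Two vertices of different classes lie in m^(r-2) common cells.
  base-bounded : ∀ k → k ≢ i → ∀ a f → ∑ (hyper k a) (λ e → base e f) ≤ℚ ι (m ^ (r ∸ 2))
  base-bounded k k≢i a f = ≤ℚ-trans (∑-mono (hyper k a) (λ e → ≤ℚ-trans (*-monoˡ (𝟙-nonneg _) (𝟙-≤1 _)) (≡⇒≤ (*-identityʳ _))))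
    (≡⇒≤ (*-cancelˡ-≡ mpos (*-cancelˡ-≡ mpos (begin
      ι m · (ι m · ∑ (hyper k a) (at i α))
        ≡⟨ cong (ι m ·_) (trans (∑-hyper-update k a _) (trans (∑-cong cells (λ e → trans (at-update {k} {i} {a} {α} {e} (λ z → k≢i (sym z))) (sym (*-identityʳ _)))) (sym (∑-hyper i α _)))) ⟩
      ι m · ∑ (hyper i α) (λ _ → 1ℚ)
        ≡⟨ ∑-hyper-update i α _ ⟩
      ∑ cells (λ _ → 1ℚ)
        ≡⟨ trans (∑-const cells 1ℚ) (trans (*-identityʳ _) (cong ι (length-allEdges r m))) ⟩
      ι (m ^ r)
        ≡⟨ cong (λ s → ι (m ^ s)) (sym lr) ⟩
      ι (m * (m * m ^ length (others i (others k (allFin r)))))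
        ≡⟨ trans (ι-* m _) (cong (ι m ·_) (ι-* m _)) ⟩
      ι m · (ι m · ι (m ^ length (others i (others k (allFin r)))))
        ≡⟨ cong (λ s → ι m · (ι m · ι (m ^ s))) (cong (λ s → s ∸ 2) lr) ⟩
      ι m · (ι m · ι (m ^ (r ∸ 2))) ∎))))
    where
    open ≡-Reasoning
    mpos = ι-m-pos α
    lr = length-rest′ k k≢i

  -- Each of the r - 1 other classes costs the number of pairs, at most bd · d · N, plus the
  -- contribution md · d · N of common neighbourhoods; one factor d has been divided out.
  η̄ : ℚ
  η̄ = ι (length rest) · (bd + ι m · ι d)

  -- To be used for `fix` and for `fix′`, in which α is prescribed too; the second use yields an
  -- error relative to N′. The factor m^(r-2) of `base-bounded` is the one that `parallel-bound`
  -- absorbs.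
  η-bound : ∀ fix° → (uniform° : Uniform fix°) → (∀ E → Satisfies fix° E → Satisfies fix E) →
    𝔼 (biased fix° i α (λ _ → 1ℚ)) η ≤ℚ η̄ · Unbiased.N fix° uniform° α
  η-bound fix° uniform° back = *-cancelˡ (ι-pos d≥1) (≤ℚ-trans (≡⇒≤ (cong (ι d ·_) (trans (𝔼-− _ _) (cong₂ _−_
        (sym pairs≡) (trans (𝔼-· n common) (cong₂ _·_ (sym (pw≡ rest)) (𝔼-cong (λ E → sym (common≡ E)))))))))
      (≤ℚ-trans (Chain.chain-≥ ω-ext ω-nonneg (ι-m-pos α) (ι (m ^ (r ∸ 2))) (ι-nonneg _) {Y = Y} rest-unique (good-rest fix° uniform° (λ _ → 1ℚ) (λ _ → 0≤1))
          (All.map (λ {k} ne → base-bounded k ne) (others-≢ i (allFin r)))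
          (All.map (λ {k} ne _ → subst (λ s → ι (m ^ s) · 𝔼 ω (parallel k) ≤ℚ Y) (cong (λ s → s ∸ 2) (length-rest′ k ne)) (parallel-bound k ne)) (others-≢ i (allFin r)))
          (*-nonneg (ι-nonneg d) (*-nonneg (*-nonneg (ι-nonneg m) (ι-nonneg d)) N-nonneg)))
        (≤ℚ-trans (*-monoˡ (ι-nonneg _) (+-mono pairs≤ (≤ℚ-refl {Y}))) (≡⇒≤ (e (ι (length rest)) bd (ι d) N (ι m))))))
    where
    open Unbiased fix° uniform° α
    Y = ι d · (ι m · ι d · N)
    pairs≡ : 𝔼 ω (pairs base) ≡ 𝔼 ω (λ E → D E α · (bd − D E α))
    pairs≡ = trans (𝔼-cong pairs-base) (𝔼-supp (λ E → Sum.map₂ (λ s → cong (D E α ·_) (total≡ E (back E s))) (ω-supp E)))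
    pairs≤ : 𝔼 ω (pairs base) ≤ℚ bd · (ι d · N)
    pairs≤ = ≤ℚ-trans (≡⇒≤ pairs≡) (≤ℚ-trans (𝔼-mono ω-nonneg (λ E → inj₂ (≤ℚ-trans (*-monoˡ (ι-nonneg _) (a−b≤a (ι-nonneg _))) (≡⇒≤ (*-comm _ _)))))
      (≡⇒≤ (trans (𝔼-· bd _) (cong (bd ·_) (𝔼D≡ α)))))
    opaque
      unfolding _+_
      e : ∀ l b d n m → l · (b · (d · n) + d · (m · d · n)) ≡ d · (l · (b + m · d) · n)
      e = solve-∀ ℚ-ring

  open Unbiased fix uniform α public

  t : (Cell → Bool) → ℕ
  t E = deg E i α

  -- Moving a cell from the vertex f_i to α raises the degree of α by one.
  flow-cell : ∀ (F : ℕ → ℚ) f → S (lookup f i) ≡ true →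
    𝔼 ω (λ E → 𝟙 (E f) · (1ℚ − 𝟙 (E (f [ i ]≔ α))) · F (suc (t E))) ≡ 𝔼 ω (λ E → (1ℚ − 𝟙 (E f)) · 𝟙 (E (f [ i ]≔ α)) · F (t E))
  flow-cell F f Sf = trans (𝔼-weight (λ E → cong₂ _·_ (sym (move-free f-free α-free E f refl)) (shift E)))
      (𝔼-τ {ω} {X} f f° (λ {E} {E′} h → cong₂ _·_ (ω-ext h) (cong₂ _·_ (cong₂ (λ x y → (1ℚ − 𝟙 x) · 𝟙 y) (h f) (h f°)) (cong F (deg-ext h i α)))))
    where
    f° = f [ i ]≔ α
    X : (Cell → Bool) → ℚ
    X E = (1ℚ − 𝟙 (E f)) · 𝟙 (E f°) · F (t E)
    split : ∀ a c → not a ∧ not c ≡ true → a ≡ false × c ≡ false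
    split false false _ = refl , refl
    f-free : fix i (lookup f i) ≡ false
    f-free = proj₁ (split _ _ Sf)
    f≢α : lookup f i ≢ α
    f≢α z with lookup f i ≟ᶠ α | proj₂ (split (fix i (lookup f i)) _ Sf)
    ... | no ne | _ = ne z
    up : ∀ E → E f ≡ true → E f° ≡ false → t (E ∘ τ f f°) ≡ suc (t E)
    up E e₁ e₂ = ι-inj (trans (ι-deg-τ E f f° i α) (trans (cong₂ (λ x y → ι (t E) + x · y)
        (cong₂ _−_ (at-no {i} {α} {f} f≢α) (at-yes {i} {α} {f°} (lookup-[]≔ f i α))) (cong₂ (λ x y → 𝟙 x − 𝟙 y) e₂ e₁)) (trans (e (ι (t E))) (sym (ι-suc _)))))
      where opaque
              unfolding _+_ 𝟙
              e : ∀ x → x + (0ℚ − 1ℚ) · (𝟙 false − 𝟙 true) ≡ 1ℚ + x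
              e = solve-∀ ℚ-ring
    shift : ∀ E → 𝟙 (E f) · (1ℚ − 𝟙 (E f°)) · F (suc (t E)) ≡ X (E ∘ τ f f°)
    shift E = trans (go (E f) (E f°) (up E)) (cong₂ (λ x y → (1ℚ − 𝟙 x) · 𝟙 y · F (t (E ∘ τ f f°))) (sym (cong E (τ-at refl))) (sym (cong E (τ-at′ refl))))
      where
      go : ∀ x y → (x ≡ true → y ≡ false → t (E ∘ τ f f°) ≡ suc (t E)) → 𝟙 x · (1ℚ − 𝟙 y) · F (suc (t E)) ≡ (1ℚ − 𝟙 y) · 𝟙 x · F (t (E ∘ τ f f°))
      go true false h = cong₂ _·_ (*-comm _ _) (cong F (sym (h refl refl)))
      go false y h = z (1ℚ − 𝟙 y) (F (suc (t E))) (F (t (E ∘ τ f f°)))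
        where opaque
                unfolding _+_ 𝟙
                z : ∀ y a b → 𝟙 false · y · a ≡ y · 𝟙 false · b
                z = solve-∀ ℚ-ring
      go true true h = z (F (suc (t E))) (F (t (E ∘ τ f f°)))
        where opaque
                unfolding _+_ 𝟙
                z : ∀ a b → 𝟙 true · (1ℚ − 𝟙 true) · a ≡ (1ℚ − 𝟙 true) · 𝟙 true · b
                z = solve-∀ ℚ-ring

  up-sum : ∀ E → ∑ cells (λ f → 𝟙 (S (lookup f i)) · (𝟙 (E f) · (1ℚ − 𝟙 (E (f [ i ]≔ α))))) ≡ total E − common E
  up-sum E = trans (∑-cong cells (λ f → e _ _ _)) (trans (∑-− cells _ _) (cong (_− common E)
      (trans (sym (∑-hyper-all i _)) (∑-cong (allFin m) (λ v → trans (∑-congᴬ (hyper-at i v) (λ f p → cong (λ y → 𝟙 (S y) · 𝟙 (E f)) p))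
        (trans (∑-*ˡ (hyper i v) _ _) (cong (𝟙 (S v) ·_) (sym (ι-deg′ E i v)))))))))
    where opaque
            unfolding _+_
            e : ∀ s x y → s · (x · (1ℚ − y)) ≡ s · x − s · (y · x)
            e = solve-∀ ℚ-ring

  -- An edge at α can go to each of the b - 1 other free vertices unless its target is occupied, and
  -- C counts the occupied targets.
  down-sum : ∀ E → ∑ cells (λ f → 𝟙 (S (lookup f i)) · ((1ℚ − 𝟙 (E f)) · 𝟙 (E (f [ i ]≔ α)))) ≡ (ι b − 1ℚ) · D E α − common E
  down-sum E = trans (∑-cong cells (λ f → e _ _ _)) (trans (∑-− cells _ _) (cong (_− common E)
      (trans (sym (∑-hyper-all i _)) (trans (∑-cong (allFin m) (λ v → trans (∑-congᴬ (hyper-at i v) (λ f p → cong (λ y → 𝟙 (S y) · 𝟙 (E (f [ i ]≔ α))) p))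
        (trans (∑-*ˡ (hyper i v) _ _) (cong (𝟙 (S v) ·_) (trans (∑-hyper-move i v α (𝟙 ∘ E)) (sym (ι-deg′ E i α)))))))
        (trans (∑S (λ _ → D E α)) (trans (cong (_− D E α) (trans (∑-*ʳ (allFin m) _ _) (cong (_· D E α) b≡))) (e′ _ _)))))))
    where opaque
            unfolding _+_
            e : ∀ s x y → s · ((1ℚ − x) · y) ≡ s · y − s · (y · x)
            e = solve-∀ ℚ-ring
            e′ : ∀ b x → b · x − x ≡ (b − 1ℚ) · x
            e′ = solve-∀ ℚ-ring

  flow : ∀ F → 𝔼 ω (λ E → (bd − D E α − common E) · F (suc (t E))) ≡ 𝔼 ω (λ E → ((ι b − 1ℚ) · D E α − common E) · F (t E))
  flow F = begin
    𝔼 ω (λ E → (bd − D E α − common E) · F (suc (t E)))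
      ≡⟨ 𝔼-supp (λ E → Sum.map₂ (λ s → trans (cong (λ z → (z − common E) · F (suc (t E))) (sym (total≡ E s))) (trans (cong (_· F (suc (t E))) (sym (up-sum E)))
           (trans (sym (∑-*ʳ cells _ _)) (∑-cong cells (λ f → *-assoc _ _ _))))) (ω-supp E)) ⟩
    𝔼 ω (λ E → ∑ cells (λ f → 𝟙 (S (lookup f i)) · (𝟙 (E f) · (1ℚ − 𝟙 (E (f [ i ]≔ α))) · F (suc (t E)))))
      ≡⟨ trans (𝔼-∑ cells _) (trans (∑-cong cells (λ f → go f (S (lookup f i)) refl)) (sym (𝔼-∑ cells _))) ⟩
    𝔼 ω (λ E → ∑ cells (λ f → 𝟙 (S (lookup f i)) · ((1ℚ − 𝟙 (E f)) · 𝟙 (E (f [ i ]≔ α)) · F (t E))))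
      ≡⟨ 𝔼-cong (λ E → trans (∑-cong cells (λ f → sym (*-assoc _ _ _))) (trans (∑-*ʳ cells _ _) (cong (_· F (t E)) (down-sum E)))) ⟩
    𝔼 ω (λ E → ((ι b − 1ℚ) · D E α − common E) · F (t E)) ∎
    where
    open ≡-Reasoning
    0·𝔼 : ∀ X → 𝔼 ω (λ E → 𝟙 false · X E) ≡ 0ℚ
    0·𝔼 X = trans (𝔼-· _ _) (trans (cong (_· 𝔼 ω X) 𝟙-false) (*-zeroˡ _))
    go : ∀ f s → S (lookup f i) ≡ s → 𝔼 ω (λ E → 𝟙 s · (𝟙 (E f) · (1ℚ − 𝟙 (E (f [ i ]≔ α))) · F (suc (t E)))) ≡ 𝔼 ω (λ E → 𝟙 s · ((1ℚ − 𝟙 (E f)) · 𝟙 (E (f [ i ]≔ α)) · F (t E)))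
    go f true q = trans (𝔼-· _ _) (trans (cong (𝟙 true ·_) (flow-cell F f q)) (sym (𝔼-· _ _)))
    go f false q = trans (0·𝔼 _) (sym (0·𝔼 _))

-- Comparison with the hypergeometric law by the Stein equation

module SteinStage (r m d : ℕ) (i : Fin r) (d≥1 : 1 ≤ d) (fix : Fin r → Fin m → Bool) (uniform : Stage.Uniform r m d i fix)
                  (α : Fin m) (α-free : fix i α ≡ false) (b : ℕ) (b≡ : ∑ (allFin m) (λ v → 𝟙 (not (fix i v))) ≡ ι b) where
  open StageBound r m d i d≥1 fix uniform α α-free b b≡ public

  -- The coefficients of the `flow` identity multiplied by n, with nC replaced by D(bd - D).
  X Y : ℕ → ℚ
  X t = (bd − ι t) · (n − ι t)
  Y t = ι t · (n · (ι b − 1ℚ) − (bd − ι t))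

  -- F solves the Stein equation of the law with up-rates X, down-rates Y and point probability A₀ / N₀ at d.
  record SteinSolution (F : ℕ → ℚ) (N₀ A₀ W Z : ℚ) : Set where
    field
      equation : ∀ t → ι t ≤ℚ n → ι t ≤ℚ bd → X t · F (suc t) − Y t · F t ≡ 𝟙 (t ℕ.≡ᵇ d) · N₀ − A₀
      decreasing : ∀ t → t ≢ d → 0ℚ ≤ℚ F t − F (suc t)
      slow : ∀ t → t ≢ d → F t − F (suc t) ≤ℚ W
      jump-nonneg : 0ℚ ≤ℚ F (suc d) − F d
      jump : F (suc d) − F d ≤ℚ Z

  hit : ℕ → ℚ
  hit t = 𝟙 (t ℕ.≡ᵇ d)

  N′ : ℚ
  N′ = Unbiased.N fix′ uniform′ α

  weight-hit : ∀ E → weight fix E · hit (t E) ≡ weight fix′ E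
  weight-hit E = trans (sym (𝟙-∧ _ _)) (cong 𝟙 (bool-≡
    (λ h → good-complete {fix′} {E} (satisfies″ E (good-sound {fix} {E} (proj₁ (∧-true h))) (≡ᵇ-sound (proj₂ (∧-true {good fix E} h)))))
    (λ h → cong₂ _∧_ (good-complete {fix} {E} (satisfies′ E (good-sound {fix′} {E} h))) (≡ᵇ-complete (proj₁ (good-sound {fix′} {E} h) i α fix′-α)))))

  private opaque
    unfolding _+_
    e₁ : ∀ w h x → w · 1ℚ · (h · x) ≡ (w · h) · 1ℚ · x
    e₁ = solve-∀ ℚ-ring
    e₂ : ∀ w h x → w · 1ℚ · (h · x) ≡ (w · h) · x
    e₂ = solve-∀ ℚ-ring

  𝔼-hit : ∀ Q → 𝔼 ω (λ E → hit (t E) · Q E) ≡ 𝔼 (biased fix′ i α (λ _ → 1ℚ)) Q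
  𝔼-hit Q = 𝔼-weight (λ E → trans (e₁ _ _ _) (cong (λ z → z · 1ℚ · Q E) (weight-hit E)))

  𝔼-bias : ∀ g Q → 𝔼 ω (λ E → g (t E) · Q E) ≡ 𝔼 (biased fix i α g) Q
  𝔼-bias g Q = 𝔼-weight (λ E → e₂ _ _ _)

  D≤n : ∀ E → D E α ≤ℚ n
  D≤n E = ≤ℚ-trans (≡⇒≤ (ι-deg′ E i α)) (≤ℚ-trans (∑-mono (hyper i α) (λ c → 𝟙-≤1 (E c))) (≡⇒≤ (*-cancelˡ-≡ (ι-m-pos α)
    (trans (∑-hyper-update i α _) (trans (∑-const cells 1ℚ) (trans (*-identityʳ _) (trans (cong ι (trans (length-allEdges r m) (cong (m ^_) (sym length-rest)))) (ι-* m _))))))))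

  module _ {F N₀ A₀ W Z} (sol : SteinSolution F N₀ A₀ W Z) where
    open SteinSolution sol

    private
      Δ = F (suc d) − F d

      -- The decrease of F away from d. The whole increment is recovered in `step` by adding the
      -- jump at d, which has the opposite sign.
      w : ℕ → ℚ
      w t = (1ℚ − hit t) · (F t − F (suc t))

      cases : ∀ (P : ℕ → ℚ → Set) → P d 1ℚ → (∀ t → t ≢ d → P t 0ℚ) → ∀ t → P t (hit t)
      cases P p q t with t ℕ.≟ d
      ... | yes refl = subst (P d) (sym (trans (cong 𝟙 (≡ᵇ-complete {d} refl)) 𝟙-true)) p
      ... | no ne = subst (P t) (sym (trans (cong 𝟙 (miss (t ℕ.≡ᵇ d) (λ h → ne (≡ᵇ-sound h)))) 𝟙-false)) (q t ne)
        where miss : ∀ b → (b ≡ true → ⊥) → b ≡ false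
              miss true h = ⊥-elim (h refl)
              miss false h = refl

      opaque
        unfolding _+_
        z₁ : ∀ x → (1ℚ − 1ℚ) · x ≡ 0ℚ
        z₁ = solve-∀ ℚ-ring
        z₀ : ∀ x → (1ℚ − 0ℚ) · x ≡ x
        z₀ = solve-∀ ℚ-ring
        s₁ : ∀ a b → b − a ≡ (1ℚ − 1ℚ) · (b − a) − 1ℚ · (a − b)
        s₁ = solve-∀ ℚ-ring
        s₀ : ∀ x y → x ≡ (1ℚ − 0ℚ) · x − 0ℚ · y
        s₀ = solve-∀ ℚ-ring
        key : ∀ bd D n C b F F′ → (bd − D) · (n − D) · F′ − D · (n · (b − 1ℚ) − (bd − D)) · F ≡
          (n · ((bd − D − C) · F′) − n · (((b − 1ℚ) · D − C) · F)) + (F − F′) · (D · (bd − D) − n · C)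
        key = solve-∀ ℚ-ring
        expand : ∀ w h δ e → (w − h · δ) · e ≡ w · e − δ · (h · e)
        expand = solve-∀ ℚ-ring
        rearr : ∀ a n x y z → a · n − x ≡ (z − z) + y → a · n ≡ x + y
        rearr a n x y z h = trans (sym (ring₁ (a · n) x)) (trans (cong (_+ x) h) (ring₂ x y z))
          where ring₁ : ∀ p x → (p − x) + x ≡ p
                ring₁ = solve-∀ ℚ-ring
                ring₂ : ∀ x y z → ((z − z) + y) + x ≡ x + y
                ring₂ = solve-∀ ℚ-ring

      w-nonneg : ∀ t → 0ℚ ≤ℚ w t
      w-nonneg t = cases (λ t h → 0ℚ ≤ℚ (1ℚ − h) · (F t − F (suc t))) (≡⇒≤ (sym (z₁ _))) (λ t ne → subst (0ℚ ≤ℚ_) (sym (z₀ _)) (decreasing t ne)) t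

      step : ∀ t → F t − F (suc t) ≡ w t − hit t · Δ
      step = cases (λ t h → F t − F (suc t) ≡ (1ℚ − h) · (F t − F (suc t)) − h · Δ) (s₁ _ _) (λ t ne → s₀ _ _)

    module _ (W-nonneg : 0ℚ ≤ℚ W) where

      private
        w≤W : ∀ t → w t ≤ℚ W
        w≤W = cases (λ t h → (1ℚ − h) · (F t − F (suc t)) ≤ℚ W) (subst (_≤ℚ W) (sym (z₁ _)) W-nonneg) (λ t ne → subst (_≤ℚ W) (sym (z₀ _)) (slow t ne))

        wη hη : ℚ
        wη = 𝔼 ω (λ E → w (t E) · η E)
        hη = 𝔼 ω (λ E → hit (t E) · η E)

        wη-nonneg : 0ℚ ≤ℚ wη
        wη-nonneg = subst (0ℚ ≤ℚ_) (sym (𝔼-bias w η)) (η-sign w w-nonneg)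

        hη-nonneg : 0ℚ ≤ℚ hη
        hη-nonneg = subst (0ℚ ≤ℚ_) (sym (𝔼-bias hit η)) (η-sign hit (λ t → 𝟙-nonneg _))

        -- W - w is a nonnegative bias as well, so `η-sign` allows w to be replaced by the constant
        -- W.
        wη≤ : wη ≤ℚ W · (η̄ · N)
        wη≤ = ≤ℚ-trans (0≤b−a⇒a≤b (subst (0ℚ ≤ℚ_) (trans (sym (𝔼-bias (λ t → W − w t) η)) (trans (𝔼-cong (λ E → e _ _ _)) (trans (𝔼-− _ _) (cong (_− wη) (𝔼-· W η)))))
            (η-sign (λ t → W − w t) (λ t → 0≤b−a (w≤W t)))))
          (*-monoˡ W-nonneg (η-bound fix uniform (λ E s → s)))
          where opaque
                  unfolding _+_
                  e : ∀ a b x → (a − b) · x ≡ a · x − b · x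
                  e = solve-∀ ℚ-ring

        -- Restricting to D = d turns the measure of `fix` into that of `fix′`.
        hη≤ : hη ≤ℚ η̄ · N′
        hη≤ = ≤ℚ-trans (≡⇒≤ (𝔼-hit η)) (η-bound fix′ uniform′ satisfies′)

        hits : 𝔼 ω (λ E → hit (t E)) ≡ N′
        hits = trans (𝔼-cong (λ E → sym (*-identityʳ _))) (𝔼-hit (λ _ → 1ℚ))

      -- Take the expectation of the Stein equation at D. By `flow` the main terms cancel, and what
      -- is left is the increment of F times `η`.
      balance : N′ · N₀ ≡ A₀ · N + (wη − Δ · hη)
      balance = rearr N′ N₀ (A₀ · N) (wη − Δ · hη) (n · 𝔼 ω (λ E → (bd − D E α − common E) · F (suc (t E)))) (begin
        N′ · N₀ − A₀ · N
          ≡⟨ sym (trans (𝔼-− _ _) (cong₂ _−_ (trans (𝔼-cong (λ E → *-comm _ _)) (trans (𝔼-· N₀ _) (trans (*-comm _ _) (cong (_· N₀) hits)))) (𝔼-const A₀))) ⟩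
        𝔼 ω (λ E → hit (t E) · N₀ − A₀)
          ≡⟨ 𝔼-supp (λ E → Sum.map₂ (λ s → trans (sym (equation (t E) (D≤n E) (D≤bd E s))) (key bd (D E α) n (common E) (ι b) (F (t E)) (F (suc (t E))))) (ω-supp E)) ⟩
        𝔼 ω (λ E → (n · ((bd − D E α − common E) · F (suc (t E))) − n · (((ι b − 1ℚ) · D E α − common E) · F (t E))) + (F (t E) − F (suc (t E))) · η E)
          ≡⟨ trans (𝔼-+ _ _) (cong₂ _+_ (trans (𝔼-− _ _) (cong₂ _−_ (𝔼-· n _) (trans (𝔼-· n _) (cong (n ·_) (sym (flow F))))))
               (trans (𝔼-cong (λ E → trans (cong (_· η E) (step (t E))) (expand _ _ _ _))) (trans (𝔼-− _ _) (cong (λ z → wη − z) (𝔼-· Δ _))))) ⟩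
        (n · 𝔼 ω (λ E → (bd − D E α − common E) · F (suc (t E))) − n · 𝔼 ω (λ E → (bd − D E α − common E) · F (suc (t E)))) + (wη − Δ · hη) ∎)
        where open ≡-Reasoning

      upper : N′ · N₀ ≤ℚ A₀ · N + W · (η̄ · N)
      upper = ≤ℚ-trans (≡⇒≤ balance) (+-mono (≤ℚ-refl {A₀ · N}) (≤ℚ-trans (a−b≤a (*-nonneg jump-nonneg hη-nonneg)) wη≤))

      -- Here the nonnegative term `wη` is dropped and only the jump remains, so the error is a
      -- multiple of N′; in `upper` it is the other way round.
      lower : A₀ · N ≤ℚ N′ · N₀ + Z · (η̄ · N′)
      lower = ≤ℚ-trans (0≤b−a⇒a≤b (subst (0ℚ ≤ℚ_) (e (A₀ · N) wη (Δ · hη)) wη-nonneg))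
          (+-mono (≡⇒≤ (sym balance)) (*-mono jump-nonneg (≤ℚ-trans hη-nonneg hη≤) jump hη≤))
        where opaque
                unfolding _+_
                e : ∀ x w j → w ≡ ((x + (w − j)) + j) − x
                e = solve-∀ ℚ-ring

σ : ℕ → (ℕ → ℚ) → ℚ
σ zero f = 0ℚ
σ (suc k) f = σ k f + f k

σ-cong : ∀ k {f g} → (∀ t → t ℕ.< k → f t ≡ g t) → σ k f ≡ σ k g
σ-cong zero h = refl
σ-cong (suc k) h = cong₂ _+_ (σ-cong k (λ t p → h t (ℕ.m<n⇒m<1+n p))) (h k (ℕ.n<1+n k))

σ-+ : ∀ k f g → σ k (λ t → f t + g t) ≡ σ k f + σ k g
σ-+ zero f g = sym (+-identityˡ 0ℚ)
σ-+ (suc k) f g = trans (cong (_+ (f k + g k)) (σ-+ k f g)) (+-interchange _ _ _ _)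

σ-front : ∀ k f → σ (suc k) f ≡ f 0 + σ k (f ∘ suc)
σ-front zero f = +-comm _ _
σ-front (suc k) f = trans (cong (_+ f (suc k)) (σ-front k f)) (+-assoc _ _ _)

σ-vanish : ∀ k j f → (∀ t → k ≤ t → f t ≡ 0ℚ) → σ (j ℕ.+ k) f ≡ σ k f
σ-vanish k zero f h = refl
σ-vanish k (suc j) f h = trans (cong₂ _+_ (σ-vanish k j f h) (h _ (ℕ.m≤n+m k j))) (+-identityʳ _)

-- The Stein equation of a birth-death chain

module Stein1D (a X Y : ℕ → ℚ) (T d : ℕ)
  (balanced : ∀ t → t ℕ.< T → a t · X t ≡ a (suc t) · Y (suc t))
  (X-dec : ∀ t → t ℕ.< T → X (suc t) ≤ℚ X t) (Y-inc : ∀ t → t ℕ.< T → Y t ≤ℚ Y (suc t))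
  (a-pos : ∀ t → t ≤ T → 0ℚ < a t) (Y-pos : ∀ t → suc t ≤ T → 0ℚ < Y (suc t))
  (X-top : X T ≡ 0ℚ) (Y-0 : Y 0 ≡ 0ℚ) (1≤d : 1 ≤ d) (d<T : d ℕ.< T) (X≡Y : X d ≡ Y d) where

  L : ℕ → ℚ
  L t = σ t a

  N₀ A₀ : ℚ
  N₀ = L (suc T)
  A₀ = a d

  U : ℕ → ℚ
  U t = N₀ − L t

  q : ℕ → ℚ
  q t = inv (a t · Y t)

  -- The value of a(t) Y(t) F(t). Multiplied by a(t), the Stein equation telescopes by detailed
  -- balance, so V is the sum of its right side over all s < t. Since the full sum is 0, it can be
  -- written with the head up to d and with the tail beyond, which shows its sign.
  V : ℕ → ℚ
  V t with t ℕ.≤? d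
  ... | yes _ = − (A₀ · L t)
  ... | no _ = A₀ · U t

  V-≤ : ∀ {t} → t ≤ d → V t ≡ − (A₀ · L t)
  V-≤ {t} p with t ℕ.≤? d
  ... | yes _ = refl
  ... | no np = contradiction p np

  V-> : ∀ {t} → d ℕ.< t → V t ≡ A₀ · U t
  V-> {t} p with t ℕ.≤? d
  ... | yes q = contradiction q (ℕ.<⇒≱ p)
  ... | no _ = refl

  -- The equation does not involve the values of F outside 1, …, T; clamping makes F constant there.
  clamp : ℕ → ℕ
  clamp t = (t ℕ.⊔ 1) ℕ.⊓ T

  F : ℕ → ℚ
  F t = V (clamp t) · q (clamp t)

  clamp-in : ∀ {t} → suc t ≤ T → clamp (suc t) ≡ suc t
  clamp-in {t} p = trans (cong (ℕ._⊓ T) (ℕ.m≥n⇒m⊔n≡m (s≤s z≤n))) (ℕ.m≤n⇒m⊓n≡m p)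

  clamp-out : ∀ {t} → T ≤ t → clamp t ≡ T
  clamp-out p = ℕ.m≥n⇒m⊓n≡n (ℕ.≤-trans p (ℕ.m≤m⊔n _ 1))

  F-in : ∀ {t} → suc t ≤ T → F (suc t) ≡ V (suc t) · q (suc t)
  F-in p = cong (λ t → V t · q t) (clamp-in p)

  A₀-pos : 0ℚ < A₀
  A₀-pos = a-pos d (ℕ.<⇒≤ d<T)

  A₀-nonneg = <ℚ⇒≤ℚ A₀-pos

  a-nonneg : ∀ t → t ≤ T → 0ℚ ≤ℚ a t
  a-nonneg t p = <ℚ⇒≤ℚ (a-pos t p)

  private opaque
    unfolding _+_
    e₁ : ∀ a y v q → a · (y · (v · q)) ≡ v · (a · y · q)
    e₁ = solve-∀ ℚ-ring
    e₂ : ∀ a x y f g → a · (x · f − y · g) ≡ a · (x · f) − a · (y · g)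
    e₂ = solve-∀ ℚ-ring
    e₃ : ∀ A N l a → − (A · (l + a)) − (− (A · l)) ≡ a · (0ℚ · N − A)
    e₃ = solve-∀ ℚ-ring
    e₄ : ∀ A N l → A · (N − (l + A)) − (− (A · l)) ≡ A · (1ℚ · N − A)
    e₄ = solve-∀ ℚ-ring
    e₅ : ∀ A N l a → A · (N − (l + a)) − A · (N − l) ≡ a · (0ℚ · N − A)
    e₅ = solve-∀ ℚ-ring
    e₆ : ∀ l x a → (l + a) · x ≡ l · x + a · x
    e₆ = solve-∀ ℚ-ring
    e₇ : ∀ n l a → n − l ≡ a + (n − (l + a))
    e₇ = solve-∀ ℚ-ring

  aYq : ∀ t → suc t ≤ T → a (suc t) · Y (suc t) · q (suc t) ≡ 1ℚ
  aYq t p = *-inv (0<⇒≢0 (*-pos (a-pos (suc t) p) (Y-pos t p)))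

  aYF : ∀ t → t ≤ T → a t · (Y t · F t) ≡ V t
  aYF zero p = trans (trans (cong (λ z → a 0 · (z · F 0)) Y-0) (trans (cong (a 0 ·_) (*-zeroˡ _)) (*-zeroʳ _))) (sym (trans (V-≤ z≤n) (z A₀)))
    where opaque
            unfolding _+_
            z : ∀ A → − (A · 0ℚ) ≡ 0ℚ
            z = solve-∀ ℚ-ring
  aYF (suc t) p = trans (cong (λ z → a (suc t) · (Y (suc t) · z)) (F-in p)) (trans (e₁ _ _ _ _) (trans (cong (V (suc t) ·_) (aYq t p)) (*-identityʳ _)))

  aXF : ∀ t → t ≤ T → a t · (X t · F (suc t)) ≡ V (suc t)
  aXF t p with ℕ.m≤n⇒m<n∨m≡n p
  ... | inj₁ t<T = trans (sym (*-assoc _ _ _)) (trans (cong (_· F (suc t)) (balanced t t<T)) (trans (*-assoc _ _ _) (aYF (suc t) t<T)))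
  ... | inj₂ refl = trans (trans (cong (λ z → a t · (z · F (suc t))) X-top) (trans (cong (a t ·_) (*-zeroˡ _)) (*-zeroʳ _)))
      (sym (trans (V-> (ℕ.m<n⇒m<1+n d<T)) (trans (cong (A₀ ·_) (a−a _)) (*-zeroʳ _))))

  V-step : ∀ t → V (suc t) − V t ≡ a t · (𝟙 (t ℕ.≡ᵇ d) · N₀ − A₀)
  V-step t with ℕ.<-cmp t d
  ... | Tri.tri< t<d t≢d _ = trans (cong₂ _−_ (V-≤ t<d) (V-≤ (ℕ.<⇒≤ t<d))) (trans (e₃ A₀ N₀ (L t) (a t)) (cong (λ z → a t · (z · N₀ − A₀)) (sym (trans (cong 𝟙 (miss t≢d)) 𝟙-false))))
    where miss : t ≢ d → (t ℕ.≡ᵇ d) ≡ false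
          miss ne = bool-≡ (λ h → contradiction (≡ᵇ-sound h) ne) (λ ())
  ... | Tri.tri≈ _ refl _ = trans (cong₂ _−_ (V-> (ℕ.n<1+n t)) (V-≤ ℕ.≤-refl)) (trans (e₄ A₀ N₀ (L t)) (cong (λ z → a t · (z · N₀ − A₀)) (sym (trans (cong 𝟙 (≡ᵇ-complete {t} refl)) 𝟙-true))))
  ... | Tri.tri> _ t≢d d<t = trans (cong₂ _−_ (V-> (ℕ.m<n⇒m<1+n d<t)) (V-> d<t)) (trans (e₅ A₀ N₀ (L t) (a t)) (cong (λ z → a t · (z · N₀ − A₀)) (sym (trans (cong 𝟙 (miss t≢d)) 𝟙-false))))
    where miss : t ≢ d → (t ℕ.≡ᵇ d) ≡ false
          miss ne = bool-≡ (λ h → contradiction (≡ᵇ-sound h) ne) (λ ())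

  equation : ∀ t → t ≤ T → X t · F (suc t) − Y t · F t ≡ 𝟙 (t ℕ.≡ᵇ d) · N₀ − A₀
  equation t p = *-cancelˡ-≡ (a-pos t p) (trans (e₂ _ _ _ _ _) (trans (cong₂ _−_ (aXF t p) (aYF t p)) (V-step t)))

  L-nonneg : ∀ t → t ≤ suc T → 0ℚ ≤ℚ L t
  L-nonneg zero p = ≤ℚ-refl
  L-nonneg (suc t) (s≤s p) = +-nonneg (L-nonneg t (ℕ.m≤n⇒m≤1+n p)) (a-nonneg t p)

  U-suc : ∀ t → U t ≡ a t + U (suc t)
  U-suc t = e₇ N₀ (L t) (a t)

  U-nonneg : ∀ s t → s ℕ.+ t ≡ suc T → 0ℚ ≤ℚ U t
  U-nonneg zero t refl = ≡⇒≤ (sym (a−a _))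
  U-nonneg (suc s) t e = subst (0ℚ ≤ℚ_) (sym (U-suc t)) (+-nonneg (a-nonneg t (ℕ.≤-trans (ℕ.m≤n+m t s) (ℕ.≤-reflexive (ℕ.suc-injective e)))) (U-nonneg s (suc t) (trans (ℕ.+-suc s t) e)))

  -- Below d this inequality is the decrease of F with denominators cleared. In the induction the
  -- falling X and the rising Y handle the old terms, and detailed balance the new one. `U-slow` is
  -- its mirror image above d.
  L-slow : ∀ t → t ≤ T → L t · X t ≤ℚ L (suc t) · Y t
  L-slow zero p = ≡⇒≤ (trans (*-zeroˡ _) (sym (trans (cong (L 1 ·_) Y-0) (*-zeroʳ _))))
  L-slow (suc t) p = ≤ℚ-trans (≡⇒≤ (e₆ _ _ _)) (≤ℚ-trans (+-mono
      (≤ℚ-trans (*-monoˡ (L-nonneg t (ℕ.m≤n⇒m≤1+n (ℕ.<⇒≤ p))) (X-dec t p)) (≤ℚ-trans (L-slow t (ℕ.<⇒≤ p)) (*-monoˡ (L-nonneg (suc t) (s≤s (ℕ.<⇒≤ p))) (Y-inc t p))))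
      (≤ℚ-trans (*-monoˡ (a-nonneg t (ℕ.<⇒≤ p)) (X-dec t p)) (≡⇒≤ (balanced t p))))
    (≡⇒≤ (sym (e₆ (L (suc t)) (Y (suc t)) (a (suc t))))))

  U-slow : ∀ s t → s ℕ.+ t ≡ T → U (suc t) · Y t ≤ℚ U t · X t
  U-slow zero t refl = ≡⇒≤ (trans (cong (_· Y t) (a−a _)) (trans (*-zeroˡ _) (sym (trans (cong (U t ·_) X-top) (*-zeroʳ _)))))
  U-slow (suc s) t e = ≤ℚ-trans (*-monoˡ U⁺ (Y-inc t p)) (≤ℚ-trans (≡⇒≤ (trans (cong (_· Y (suc t)) (U-suc (suc t))) (e′ _ _ _)))
      (≤ℚ-trans (+-mono (≡⇒≤ (sym (balanced t p))) (≤ℚ-trans (U-slow s (suc t) (trans (ℕ.+-suc s t) e)) (*-monoˡ U⁺ (X-dec t p))))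
        (≡⇒≤ (sym (trans (cong (_· X t) (U-suc t)) (e′ _ _ _))))))
    where
    p : t ℕ.< T
    p = subst (t ℕ.<_) e (s≤s (ℕ.m≤n+m t s))
    U⁺ : 0ℚ ≤ℚ U (suc t)
    U⁺ = U-nonneg (suc s) (suc t) (cong suc (trans (ℕ.+-suc s t) e))
    opaque
      unfolding _+_
      e′ : ∀ a u x → (a + u) · x ≡ a · x + u · x
      e′ = solve-∀ ℚ-ring

  X-pos : ∀ t → t ℕ.< T → 0ℚ < X t
  X-pos t p with X t ℚ.≤? 0ℚ
  ... | no h = ℚ.≰⇒> h
  ... | yes h = ⊥-elim (ℚ.<-irrefl refl (ℚ.<-≤-trans (*-pos (a-pos (suc t) p) (Y-pos t p))
    (≤ℚ-trans (≡⇒≤ (sym (balanced t p))) (≤ℚ-trans (*-monoˡ (a-nonneg t (ℕ.<⇒≤ p)) h) (≡⇒≤ (*-zeroʳ _))))))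

  F-step : ∀ t → suc t ℕ.< T → a (suc t) · (X (suc t) · (Y (suc t) · (F (suc t) − F (suc (suc t))))) ≡ V (suc t) · X (suc t) − V (suc (suc t)) · Y (suc t)
  F-step t p = trans (e _ _ _ _ _) (cong₂ _−_ (cong (_· X (suc t)) (aYF (suc t) (ℕ.<⇒≤ p))) (cong (_· Y (suc t)) (aXF (suc t) (ℕ.<⇒≤ p))))
    where opaque
            unfolding _+_
            e : ∀ a x y f g → a · (x · (y · (f − g))) ≡ a · (y · f) · x − a · (x · g) · y
            e = solve-∀ ℚ-ring

  F-dec-in : ∀ t → suc t ℕ.< T → suc t ≢ d → 0ℚ ≤ℚ F (suc t) − F (suc (suc t))
  F-dec-in t p ne = *-cancelˡ (*-pos (a-pos (suc t) (ℕ.<⇒≤ p)) (*-pos (X-pos (suc t) p) (Y-pos t (ℕ.<⇒≤ p))))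
      (subst₂ _≤ℚ_ (sym (*-zeroʳ _)) (trans (sym (F-step t p)) (assoc₃ _ _ _ _)) (V-dec (ℕ.<-cmp (suc t) d)))
    where
    opaque
      unfolding _+_
      assoc₃ : ∀ a x y z → a · (x · (y · z)) ≡ a · (x · y) · z
      assoc₃ = solve-∀ ℚ-ring
      f₁ : ∀ A l x m y → A · (m · y − l · x) ≡ (− (A · l)) · x − (− (A · m)) · y
      f₁ = solve-∀ ℚ-ring
      f₂ : ∀ A u x v y → A · (u · x − v · y) ≡ (A · u) · x − (A · v) · y
      f₂ = solve-∀ ℚ-ring
    V-dec : Tri.Tri (suc t ℕ.< d) (suc t ≡ d) (suc t ℕ.> d) → 0ℚ ≤ℚ V (suc t) · X (suc t) − V (suc (suc t)) · Y (suc t)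
    V-dec (Tri.tri< t<d _ _) = subst (0ℚ ≤ℚ_) (trans (f₁ A₀ (L (suc t)) _ (L (suc (suc t))) _) (cong₂ (λ v w → v · X (suc t) − w · Y (suc t)) (sym (V-≤ (ℕ.<⇒≤ t<d))) (sym (V-≤ t<d))))
      (*-nonneg A₀-nonneg (0≤b−a (L-slow (suc t) (ℕ.<⇒≤ p))))
    V-dec (Tri.tri≈ _ e _) = contradiction e ne
    V-dec (Tri.tri> _ _ d<t) = subst (0ℚ ≤ℚ_) (trans (f₂ A₀ (U (suc t)) _ (U (suc (suc t))) _) (cong₂ (λ v w → v · X (suc t) − w · Y (suc t)) (sym (V-> d<t)) (sym (V-> (ℕ.m<n⇒m<1+n d<t)))))
      (*-nonneg A₀-nonneg (0≤b−a (U-slow (T ∸ suc t) (suc t) (ℕ.m∸n+n≡m (ℕ.<⇒≤ p)))))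

  F-cases : (P : ℚ → Set) → P 0ℚ → (∀ t → suc t ℕ.< T → suc t ≢ d → P (F (suc t) − F (suc (suc t)))) → ∀ t → t ≢ d → P (F t − F (suc t))
  F-cases P z h zero ne = subst P (sym (a−a _)) z
  F-cases P z h (suc t) ne with suc t ℕ.<? T
  ... | yes p = h t p ne
  ... | no np = subst P (sym (trans (cong (λ s → F (suc t) − V s · q s) (clamp-out (ℕ.m≤n⇒m≤1+n (ℕ.≮⇒≥ np)))) (trans (cong (λ s → V s · q s − V T · q T) (clamp-out (ℕ.≮⇒≥ np))) (a−a _)))) z

  decreasing : ∀ t → t ≢ d → 0ℚ ≤ℚ F t − F (suc t)
  decreasing = F-cases (0ℚ ≤ℚ_) ≤ℚ-refl F-dec-in

  X-mono : ∀ s {t} → s ℕ.+ t ≤ T → X (s ℕ.+ t) ≤ℚ X t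
  X-mono zero p = ≤ℚ-refl
  X-mono (suc s) p = ≤ℚ-trans (X-dec _ p) (X-mono s (ℕ.<⇒≤ p))

  Y-mono : ∀ s {t} → s ℕ.+ t ≤ T → Y t ≤ℚ Y (s ℕ.+ t)
  Y-mono zero p = ≤ℚ-refl
  Y-mono (suc s) p = ≤ℚ-trans (Y-mono s (ℕ.<⇒≤ p)) (Y-inc _ p)

  X-≤ : ∀ {s t} → s ≤ t → t ≤ T → X t ≤ℚ X s
  X-≤ {s} {t} p q = subst (λ u → X u ≤ℚ X s) (ℕ.m∸n+n≡m p) (X-mono (t ∸ s) (subst (_≤ T) (sym (ℕ.m∸n+n≡m p)) q))

  Y-≤ : ∀ {s t} → s ≤ t → t ≤ T → Y s ≤ℚ Y t
  Y-≤ {s} {t} p q = subst (λ u → Y s ≤ℚ Y u) (ℕ.m∸n+n≡m p) (Y-mono (t ∸ s) (subst (_≤ T) (sym (ℕ.m∸n+n≡m p)) q))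

  Xd-pos : 0ℚ < X d
  Xd-pos = X-pos d d<T

  q-nonneg : ∀ t → suc t ≤ T → 0ℚ ≤ℚ q (suc t)
  q-nonneg t p = inv-nonneg (<ℚ⇒≤ℚ (*-pos (a-pos (suc t) p) (Y-pos t p)))

  ≤-inv : ∀ {w c} → X d · w ≤ℚ c → w ≤ℚ c · inv (X d)
  ≤-inv {w} {c} h = *-cancelˡ Xd-pos (≤ℚ-trans h (≡⇒≤ (sym (trans (e (X d) c (inv (X d))) (trans (cong (c ·_) (*-inv (0<⇒≢0 Xd-pos))) (*-identityʳ c))))))
    where opaque
            unfolding _+_
            e : ∀ x c i → x · (c · i) ≡ c · (x · i)
            e = solve-∀ ℚ-ring

  -- Away from d the equation reads X F(t+1) - Y F(t) = -A₀. Below d one has X ≥ Y and F ≤ 0, so X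
  -- times the decrease is at most A₀; above d the roles of X and Y change and F ≥ 0. Monotonicity
  -- and X(d) = Y(d) replace the rate by X(d).
  slow : ∀ t → t ≢ d → F t − F (suc t) ≤ℚ A₀ · inv (X d)
  slow = F-cases (_≤ℚ A₀ · inv (X d)) (*-nonneg A₀-nonneg (inv-nonneg (<ℚ⇒≤ℚ Xd-pos))) (λ t p ne → ≤-inv (go t p ne (ℕ.<-cmp (suc t) d)))
    where
    opaque
      unfolding _+_
      g₁ : ∀ x y f g A N → x · g − y · f ≡ 0ℚ · N − A → y · (f − g) ≡ A − (y − x) · g
      g₁ x y f g A N h = trans (r x y f g) (trans (cong (λ z → − z − (y − x) · g) h) (r′ x y g A N))
        where r : ∀ x y f g → y · (f − g) ≡ − (x · g − y · f) − (y − x) · g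
              r = solve-∀ ℚ-ring
              r′ : ∀ x y g A N → − (0ℚ · N − A) − (y − x) · g ≡ A − (y − x) · g
              r′ = solve-∀ ℚ-ring
      g₂ : ∀ x y f g A N → x · g − y · f ≡ 0ℚ · N − A → x · (f − g) ≡ A − (x − y) · (− f)
      g₂ x y f g A N h = trans (r x y f g) (trans (cong (λ z → − z − (x − y) · (− f)) h) (r′ x y f A N))
        where r : ∀ x y f g → x · (f − g) ≡ − (x · g − y · f) − (x − y) · (− f)
              r = solve-∀ ℚ-ring
              r′ : ∀ x y f A N → − (0ℚ · N − A) − (x − y) · (− f) ≡ A − (x − y) · (− f)
              r′ = solve-∀ ℚ-ring
      g₃ : ∀ A l q → − ((− (A · l)) · q) ≡ A · l · q
      g₃ = solve-∀ ℚ-ring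
    eq : ∀ t → t ≤ T → t ≢ d → X t · F (suc t) − Y t · F t ≡ 0ℚ · N₀ − A₀
    eq t p ne = trans (equation t p) (cong (λ z → z · N₀ − A₀) (trans (cong 𝟙 (bool-≡ (λ h → contradiction (≡ᵇ-sound h) ne) (λ ()))) 𝟙-false))
    go : ∀ t → suc t ℕ.< T → suc t ≢ d → Tri.Tri (suc t ℕ.< d) (suc t ≡ d) (suc t ℕ.> d) → X d · (F (suc t) − F (suc (suc t))) ≤ℚ A₀
    go t p ne (Tri.tri≈ _ e _) = contradiction e ne
    go t p ne (Tri.tri< t<d _ _) = ≤ℚ-trans (*-monoʳ (F-dec-in t p ne) (X-≤ (ℕ.<⇒≤ t<d) (ℕ.<⇒≤ d<T)))
      (≤ℚ-trans (≡⇒≤ (g₂ _ _ _ _ _ _ (eq (suc t) (ℕ.<⇒≤ p) ne)))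
        (a−b≤a (*-nonneg (0≤b−a (≤ℚ-trans (Y-≤ (ℕ.<⇒≤ t<d) (ℕ.<⇒≤ d<T)) (≤ℚ-trans (≡⇒≤ (sym X≡Y)) (X-≤ (ℕ.<⇒≤ t<d) (ℕ.<⇒≤ d<T)))))
          (subst (0ℚ ≤ℚ_) (sym (trans (cong −_ (trans (F-in (ℕ.<⇒≤ p)) (cong (_· q (suc t)) (V-≤ (ℕ.<⇒≤ t<d))))) (g₃ _ _ _)))
            (*-nonneg (*-nonneg A₀-nonneg (L-nonneg (suc t) (ℕ.m≤n⇒m≤1+n (ℕ.<⇒≤ p)))) (q-nonneg t (ℕ.<⇒≤ p)))))))
    go t p ne (Tri.tri> _ _ d<t) = ≤ℚ-trans (*-monoʳ (F-dec-in t p ne) (≤ℚ-trans (≡⇒≤ X≡Y) (Y-≤ (ℕ.<⇒≤ d<t) (ℕ.<⇒≤ p))))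
      (≤ℚ-trans (≡⇒≤ (g₁ _ _ _ _ _ _ (eq (suc t) (ℕ.<⇒≤ p) ne)))
        (a−b≤a (*-nonneg (0≤b−a (≤ℚ-trans (X-≤ (ℕ.<⇒≤ d<t) (ℕ.<⇒≤ p)) (≤ℚ-trans (≡⇒≤ X≡Y) (Y-≤ (ℕ.<⇒≤ d<t) (ℕ.<⇒≤ p)))))
          (subst (0ℚ ≤ℚ_) (sym (trans (F-in p) (cong (_· q (suc (suc t))) (V-> (ℕ.m<n⇒m<1+n d<t)))))
            (*-nonneg (*-nonneg A₀-nonneg (U-nonneg (T ∸ suc t) (suc (suc t)) (trans (ℕ.+-suc (T ∸ suc t) (suc t)) (cong suc (ℕ.m∸n+n≡m (ℕ.<⇒≤ p)))))) (q-nonneg (suc t) p))))))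

  A₀≤N₀ : A₀ ≤ℚ N₀
  A₀≤N₀ = 0≤b−a⇒a≤b (subst (0ℚ ≤ℚ_) (e N₀ (L d) A₀) (+-nonneg (U-nonneg (T ∸ d) (suc d) (trans (ℕ.+-suc (T ∸ d) d) (cong suc (ℕ.m∸n+n≡m (ℕ.<⇒≤ d<T))))) (L-nonneg d (ℕ.m≤n⇒m≤1+n (ℕ.<⇒≤ d<T)))))
    where opaque
            unfolding _+_
            e : ∀ n l a → (n − (l + a)) + l ≡ n − a
            e = solve-∀ ℚ-ring

  -- At d both rates coincide, so the Stein equation at d is itself a formula for the jump.
  jump≡ : X d · (F (suc d) − F d) ≡ N₀ − A₀
  jump≡ = trans (e (X d) (Y d) _ _ X≡Y) (trans (equation d (ℕ.<⇒≤ d<T)) (trans (cong (λ z → z · N₀ − A₀) (trans (cong 𝟙 (≡ᵇ-complete {d} refl)) 𝟙-true)) (cong (_− A₀) (*-identityˡ N₀))))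
    where opaque
            unfolding _+_
            e : ∀ x y g f → x ≡ y → x · (g − f) ≡ x · g − y · f
            e x .x g f refl = e′ x g f
              where e′ : ∀ x g f → x · (g − f) ≡ x · g − x · f
                    e′ = solve-∀ ℚ-ring

  jump-nonneg : 0ℚ ≤ℚ F (suc d) − F d
  jump-nonneg = *-cancelˡ Xd-pos (≤ℚ-trans (≡⇒≤ (*-zeroʳ _)) (≤ℚ-trans (0≤b−a A₀≤N₀) (≡⇒≤ (sym jump≡))))

  jump : F (suc d) − F d ≤ℚ N₀ · inv (X d)
  jump = ≤-inv (≤ℚ-trans (≡⇒≤ jump≡) (a−b≤a A₀-nonneg))

-- Binomial coefficients

nC0≡1 : ∀ n → n C 0 ≡ 1
nC0≡1 n = trans (nCk≡nC[n∸k] {0} {n} z≤n) (nCn≡1 n)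

-- The absorption identity (k + 1) C(n, k + 1) = (n - k) C(n, k), freed of the subtraction so that
-- it holds for all n and k.
C-absorb : ∀ n k → suc k * (n C suc k) ℕ.+ k * (n C k) ≡ n * (n C k)
C-absorb zero zero = refl
C-absorb zero (suc k) = cong₂ ℕ._+_ (z (suc (suc k)) (k>n⇒nCk≡0 {0} {suc (suc k)} (s≤s z≤n))) (z (suc k) (k>n⇒nCk≡0 {0} {suc k} (s≤s z≤n)))
  where z : ∀ a {x} → x ≡ 0 → a * x ≡ 0
        z a refl = ℕ.*-zeroʳ a
C-absorb (suc n) zero = begin
  1 * (suc n C 1) ℕ.+ 0 ≡⟨ trans (ℕ.+-identityʳ _) (ℕ.*-identityˡ _) ⟩
  suc n C 1 ≡⟨ nC1≡n (suc n) ⟩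
  suc n ≡⟨ sym (ℕ.*-identityʳ (suc n)) ⟩
  suc n * 1 ≡⟨ cong (suc n *_) (sym (nC0≡1 (suc n))) ⟩
  suc n * (suc n C 0) ∎
  where open ≡-Reasoning
C-absorb (suc n) (suc k) = begin
  suc (suc k) * (suc n C suc (suc k)) ℕ.+ suc k * (suc n C suc k)
    ≡⟨ cong₂ (λ x y → suc (suc k) * x ℕ.+ suc k * y) (sym (nCk+nC[k+1]≡[n+1]C[k+1] n (suc k))) (sym (nCk+nC[k+1]≡[n+1]C[k+1] n k)) ⟩
  suc (suc k) * (v ℕ.+ w) ℕ.+ suc k * (u ℕ.+ v)
    ≡⟨ solve 4 (λ k u v w → (con 2 :+ k) :* (v :+ w) :+ (con 1 :+ k) :* (u :+ v) :=
         ((con 2 :+ k) :* w :+ (con 1 :+ k) :* v) :+ (((con 1 :+ k) :* v :+ k :* u) :+ (v :+ u))) refl k u v w ⟩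
  (suc (suc k) * w ℕ.+ suc k * v) ℕ.+ ((suc k * v ℕ.+ k * u) ℕ.+ (v ℕ.+ u))
    ≡⟨ cong₂ (λ x y → x ℕ.+ (y ℕ.+ (v ℕ.+ u))) (C-absorb n (suc k)) (C-absorb n k) ⟩
  n * v ℕ.+ (n * u ℕ.+ (v ℕ.+ u))
    ≡⟨ solve 3 (λ n u v → n :* v :+ (n :* u :+ (v :+ u)) := (con 1 :+ n) :* (u :+ v)) refl n u v ⟩
  suc n * (u ℕ.+ v)
    ≡⟨ cong (suc n *_) (nCk+nC[k+1]≡[n+1]C[k+1] n k) ⟩
  suc n * (suc n C suc k) ∎
  where
  open ≡-Reasoning
  open ℕ.+-*-Solver
  u = n C k
  v = n C suc k
  w = n C suc (suc k)

C-pos : ∀ {n k} → k ≤ n → 1 ≤ n C k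
C-pos {n} {zero} p = ℕ.≤-reflexive (sym (nC0≡1 n))
C-pos {suc n} {suc k} (s≤s p) = ℕ.≤-trans (C-pos p) (ℕ.≤-trans (ℕ.m≤m+n _ _) (ℕ.≤-reflexive (nCk+nC[k+1]≡[n+1]C[k+1] n k)))

ι-absorb : ∀ n k → ι (n C suc k) · ι (suc k) ≡ ι (n C k) · (ι n − ι k)
ι-absorb n k = e _ _ _ _ _ (trans (cong₂ _+_ (sym (ι-* _ _)) (sym (ι-* _ _))) (trans (sym (ι-+ _ _)) (trans (cong ι (C-absorb n k)) (ι-* _ _))))
  where opaque
          unfolding _+_
          e : ∀ c s k c′ n → s · c + k · c′ ≡ n · c′ → c · s ≡ c′ · (n − k)
          e c s k c′ n h = trans (r₁ c s k c′) (trans (cong (_− k · c′) h) (r₂ n k c′))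
            where r₁ : ∀ c s k c′ → c · s ≡ s · c + k · c′ − k · c′
                  r₁ = solve-∀ ℚ-ring
                  r₂ : ∀ n k c′ → n · c′ − k · c′ ≡ c′ · (n − k)
                  r₂ = solve-∀ ℚ-ring

vandermonde : ∀ n q s → σ (suc s) (λ t → ι (n C t) · ι (q C (s ∸ t))) ≡ ι ((n ℕ.+ q) C s)
vandermonde zero q s = trans (σ-front s _) (trans (cong₂ _+_
    (trans (cong (_· ι (q C s)) (trans (cong ι (nC0≡1 0)) ι-1)) (*-identityˡ _))
    (trans (cong (λ k → σ k (λ t → ι (0 C suc t) · ι (q C (s ∸ suc t)))) (sym (ℕ.+-identityʳ s))) (σ-vanish 0 s _ (λ t _ → trans (cong (_· ι (q C (s ∸ suc t))) (trans (cong ι (k>n⇒nCk≡0 {0} {suc t} (s≤s z≤n))) ι-0)) (*-zeroˡ (ι (q C (s ∸ suc t)))))))) (+-identityʳ _))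
vandermonde (suc n) q zero = trans (+-identityˡ _) (trans (cong₂ _·_ (trans (cong ι (nC0≡1 (suc n))) ι-1) (trans (cong ι (nC0≡1 q)) ι-1))
  (trans (*-identityˡ _) (sym (trans (cong ι (nC0≡1 (suc n ℕ.+ q))) ι-1))))
vandermonde (suc n) q (suc s) = begin
  σ (suc (suc s)) (λ t → ι (suc n C t) · ι (q C (suc s ∸ t)))
    ≡⟨ σ-front (suc s) _ ⟩
  ι (suc n C 0) · ι (q C suc s) + σ (suc s) (λ t → ι (suc n C suc t) · ι (q C (s ∸ t)))
    ≡⟨ cong₂ _+_ (cong (λ z → ι z · ι (q C suc s)) (trans (nC0≡1 (suc n)) (sym (nC0≡1 n))))
        (trans (σ-cong (suc s) (λ t _ → trans (cong (_· ι (q C (s ∸ t))) (trans (cong ι (sym (nCk+nC[k+1]≡[n+1]C[k+1] n t))) (ι-+ _ _))) (distribʳ _ _ _))) (σ-+ (suc s) _ _)) ⟩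
  ι (n C 0) · ι (q C suc s) + (σ (suc s) (λ t → ι (n C t) · ι (q C (s ∸ t))) + σ (suc s) (λ t → ι (n C suc t) · ι (q C (s ∸ t))))
    ≡⟨ e _ _ _ ⟩
  σ (suc s) (λ t → ι (n C t) · ι (q C (s ∸ t))) + (ι (n C 0) · ι (q C suc s) + σ (suc s) (λ t → ι (n C suc t) · ι (q C (s ∸ t))))
    ≡⟨ cong₂ _+_ (vandermonde n q s) (trans (sym (σ-front (suc s) (λ t → ι (n C t) · ι (q C (suc s ∸ t))))) (vandermonde n q (suc s))) ⟩
  ι ((n ℕ.+ q) C s) + ι ((n ℕ.+ q) C suc s)
    ≡⟨ trans (sym (ι-+ _ _)) (cong ι (nCk+nC[k+1]≡[n+1]C[k+1] (n ℕ.+ q) s)) ⟩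
  ι ((suc n ℕ.+ q) C suc s) ∎
  where
  open ≡-Reasoning
  opaque
    unfolding _+_
    e : ∀ a b c → a + (b + c) ≡ b + (a + c)
    e = solve-∀ ℚ-ring

-- The law of the degree of a vertex among b vertices of total degree d b.

module Hypergeometric (n b′ d : ℕ) (1≤d : 1 ≤ d) (1≤b′ : 1 ≤ b′) (2d≤n : 2 * d ≤ n) where

  b M q T : ℕ
  b = suc b′
  M = d * b
  q = n * b′
  T = M ℕ.⊓ n

  bd : ℚ
  bd = ι d · ι b

  M≡ : ι M ≡ bd
  M≡ = ι-* d b

  ιq : ι q ≡ ι n · (ι b − 1ℚ)
  ιq = trans (ι-* n b′) (cong (ι n ·_) (trans (e (ι b′)) (cong (_− 1ℚ) (sym (ι-suc b′)))))
    where opaque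
            unfolding _+_
            e : ∀ x → x ≡ (1ℚ + x) − 1ℚ
            e = solve-∀ ℚ-ring

  a X Y : ℕ → ℚ
  a t = ι (n C t) · ι (q C (M ∸ t))
  X t = (bd − ι t) · (ι n − ι t)
  Y t = ι t · (ι n · (ι b − 1ℚ) − (bd − ι t))

  T≤M : T ≤ M
  T≤M = ℕ.m⊓n≤m M n

  T≤n : T ≤ n
  T≤n = ℕ.m⊓n≤n M n

  d≤n : d ≤ n
  d≤n = ℕ.≤-trans (ℕ.m≤m+n d _) 2d≤n

  -- Here db = d + db′ ≤ 2db′ ≤ nb′. The other b - 1 vertices could hold all edges, so the law
  -- charges every degree from 0 to T.
  M≤q : M ≤ q
  M≤q = ℕ.≤-trans (ℕ.≤-reflexive (ℕ.*-suc d b′)) (ℕ.≤-trans (ℕ.+-monoˡ-≤ (d * b′) (ℕ.≤-trans (ℕ.≤-reflexive (sym (ℕ.*-identityʳ d))) (ℕ.*-monoʳ-≤ d 1≤b′)))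
    (ℕ.≤-trans (ℕ.≤-reflexive (sym (trans (ℕ.*-distribʳ-+ b′ d (d ℕ.+ 0)) (cong (λ z → d * b′ ℕ.+ z * b′) (ℕ.+-identityʳ d))))) (ℕ.*-monoˡ-≤ b′ 2d≤n)))

  d<T : d ℕ.< T
  d<T = ℕ.⊓-glb (ℕ.≤-trans (ℕ.≤-trans (s≤s (ℕ.≤-reflexive (sym (ℕ.+-identityʳ d)))) (ℕ.+-monoˡ-≤ (d ℕ.+ 0) 1≤d)) (ℕ.≤-trans (ℕ.≤-reflexive (ℕ.*-comm 2 d)) (ℕ.*-monoʳ-≤ d (s≤s 1≤b′))))
    (ℕ.≤-trans (ℕ.≤-trans (s≤s (ℕ.≤-reflexive (sym (ℕ.+-identityʳ d)))) (ℕ.+-monoˡ-≤ (d ℕ.+ 0) 1≤d)) 2d≤n)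

  bd−t : ∀ {t} → t ≤ M → bd − ι t ≡ ι (M ∸ t)
  bd−t p = trans (cong (_− ι _) (sym M≡)) (sym (ι-∸ p))

  balanced : ∀ t → t ℕ.< T → a t · X t ≡ a (suc t) · Y (suc t)
  balanced t p = begin
    ι (n C t) · ι (q C (M ∸ t)) · ((bd − ι t) · (ι n − ι t))
      ≡⟨ cong₂ (λ x y → ι (n C t) · ι (q C x) · (y · (ι n − ι t))) s≡ (trans (bd−t (ℕ.<⇒≤ t<M)) (cong ι s≡)) ⟩
    ι (n C t) · ι (q C suc s) · (ι (suc s) · (ι n − ι t))
      ≡⟨ e₁ _ _ _ _ ⟩
    (ι (n C t) · (ι n − ι t)) · (ι (q C suc s) · ι (suc s))
      ≡⟨ cong₂ _·_ (sym (ι-absorb n t)) (ι-absorb q s) ⟩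
    (ι (n C suc t) · ι (suc t)) · (ι (q C s) · (ι q − ι s))
      ≡⟨ e₂ _ _ _ _ ⟩
    ι (n C suc t) · ι (q C s) · (ι (suc t) · (ι q − ι s))
      ≡⟨ cong (λ y → ι (n C suc t) · ι (q C s) · (ι (suc t) · y)) (cong₂ _−_ ιq (sym (bd−t t<M))) ⟩
    a (suc t) · Y (suc t) ∎
    where
    open ≡-Reasoning
    t<M = ℕ.≤-trans p T≤M
    s = M ∸ suc t
    s≡ : M ∸ t ≡ suc s
    s≡ = sym (trans (sym (ℕ.+-∸-assoc 1 t<M)) refl)
    opaque
      unfolding _+_
      e₁ : ∀ x y s n → x · y · (s · n) ≡ (x · n) · (y · s)
      e₁ = solve-∀ ℚ-ring
      e₂ : ∀ x t y q → (x · t) · (y · q) ≡ x · y · (t · q)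
      e₂ = solve-∀ ℚ-ring

  ι≤ : ∀ {x t} → t ≤ x → 0ℚ ≤ℚ ι x − ι t
  ι≤ p = 0≤b−a (ι-mono p)

  −-mono : ∀ {x y} z → x ≤ℚ y → z − y ≤ℚ z − x
  −-mono {x} {y} z h = 0≤b−a⇒a≤b (subst (0ℚ ≤ℚ_) (e x y z) (0≤b−a h))
    where opaque
            unfolding _+_
            e : ∀ x y z → y − x ≡ (z − x) − (z − y)
            e = solve-∀ ℚ-ring

  X-dec : ∀ t → t ℕ.< T → X (suc t) ≤ℚ X t
  X-dec t p = *-mono (subst (0ℚ ≤ℚ_) (sym (bd−t (ℕ.≤-trans p T≤M))) (ι-nonneg _)) (ι≤ (ℕ.≤-trans (ℕ.n≤1+n t) (ℕ.≤-trans p T≤n)))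
    (−-mono bd (ι-mono (ℕ.n≤1+n t))) (−-mono (ι n) (ι-mono (ℕ.n≤1+n t)))

  Y-factor : ∀ t → ι t ≤ℚ ι n · (ι b − 1ℚ) − (bd − ι t)
  Y-factor t = subst₂ _≤ℚ_ (+-identityˡ _) (trans (e (ι q) (ι M) (ι t)) (cong₂ (λ x y → x − (y − ι t)) ιq M≡)) (+-mono (ι≤ M≤q) (≤ℚ-refl {ι t}))
    where opaque
            unfolding _+_
            e : ∀ q m t → (q − m) + t ≡ q − (m − t)
            e = solve-∀ ℚ-ring

  Y-inc : ∀ t → t ℕ.< T → Y t ≤ℚ Y (suc t)
  Y-inc t p = *-mono (ι-nonneg t) (≤ℚ-trans (ι-nonneg (suc t)) (Y-factor (suc t))) (ι-mono (ℕ.n≤1+n t)) (−-mono _ (−-mono bd (ι-mono (ℕ.n≤1+n t))))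

  a-pos : ∀ t → t ≤ T → 0ℚ < a t
  a-pos t p = *-pos (ι-pos (C-pos (ℕ.≤-trans p T≤n))) (ι-pos (C-pos (ℕ.≤-trans (ℕ.m∸n≤m M t) M≤q)))

  Y-pos : ∀ t → suc t ≤ T → 0ℚ < Y (suc t)
  Y-pos t p = *-pos (ι-pos (s≤s z≤n)) (ℚ.<-≤-trans (ι-pos (s≤s z≤n)) (Y-factor (suc t)))

  X-top : X T ≡ 0ℚ
  X-top with ℕ.⊓-sel M n
  ... | inj₁ e = trans (cong (_· (ι n − ι T)) (trans (cong₂ (λ x y → x − ι y) (sym M≡) e) (a−a _))) (*-zeroˡ _)
  ... | inj₂ e = trans (cong ((bd − ι T) ·_) (trans (cong (λ y → ι n − ι y) e) (a−a _))) (*-zeroʳ _)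

  Y-0 : Y 0 ≡ 0ℚ
  Y-0 = trans (cong (_· (ι n · (ι b − 1ℚ) − (bd − ι 0))) ι-0) (*-zeroˡ _)

  -- The mean degree d is the balance point of the two rates, which makes both Stein bounds
  -- multiples of 1/X(d).
  X≡Y : X d ≡ Y d
  X≡Y = e (ι d) (ι b) (ι n)
    where opaque
            unfolding _+_
            e : ∀ d b n → (d · b − d) · (n − d) ≡ d · (n · (b − 1ℚ) − (d · b − d))
            e = solve-∀ ℚ-ring

  open Stein1D a X Y T d balanced X-dec Y-inc a-pos Y-pos X-top Y-0 1≤d d<T X≡Y public
    using (F; N₀; A₀; equation; decreasing; slow; jump; jump-nonneg; A₀-nonneg; Xd-pos)

  n+q : n ℕ.+ q ≡ n * b
  n+q = sym (ℕ.*-suc n b′)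

  N₀≡ : N₀ ≡ ι ((n * b) C M)
  N₀≡ = trans (sym full) (trans (vandermonde n q M) (cong (λ z → ι (z C M)) n+q))
    where
    full : σ (suc M) a ≡ σ (suc T) a
    full with ℕ.≤-total M n
    ... | inj₁ p = cong (λ z → σ (suc z) a) (sym (ℕ.m≤n⇒m⊓n≡m p))
    ... | inj₂ p = trans (cong (λ z → σ z a) (trans (cong suc (sym (ℕ.m∸n+n≡m p))) (sym (ℕ.+-suc (M ∸ n) n))))
      (trans (σ-vanish (suc n) (M ∸ n) a (λ t h → trans (cong (_· ι (q C (M ∸ t))) (trans (cong ι (k>n⇒nCk≡0 h)) ι-0)) (*-zeroˡ _)))
        (cong (λ z → σ (suc z) a) (sym (ℕ.m≥n⇒m⊓n≡n p))))

  A₀≡ : A₀ ≡ ι (n C d) · ι ((n * b′) C (d * b′))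
  A₀≡ = cong (λ z → ι (n C d) · ι (q C z)) (trans (cong (_∸ d) (ℕ.*-suc d b′)) (ℕ.m+n∸m≡n d (d * b′)))

-- Relative error without division

record _≈[_]_ (x e y : ℚ) : Set where
  field
    to : x − e · x ≤ℚ y
    from : y − e · y ≤ℚ x

open _≈[_]_ public

opaque
  unfolding _+_
  −·-assoc : ∀ c e x → c · x − e · (c · x) ≡ c · (x − e · x)
  −·-assoc = solve-∀ ℚ-ring
  −·-split : ∀ e f x → (1ℚ − f) · (x − e · x) ≡ (x − (e + f) · x) + (e · f) · x
  −·-split = solve-∀ ℚ-ring
  −·-split′ : ∀ e f x → (x − (e + f) · x) + e · x ≡ (1ℚ − f) · x
  −·-split′ = solve-∀ ℚ-ring
  1−·-expand : ∀ f y → (1ℚ − f) · y ≡ y − f · y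
  1−·-expand = solve-∀ ℚ-ring
  neg-mono : ∀ {a b} → a ≤ℚ b → (− b) ≤ℚ (− a)
  neg-mono = ℚ.neg-antimono-≤

≤-drop : ∀ {x y z} → x + y ≤ℚ z → 0ℚ ≤ℚ y → x ≤ℚ z
≤-drop {x} h y = ≤ℚ-trans (≤ℚ-trans (≡⇒≤ (sym (+-identityʳ x))) (+-mono (≤ℚ-refl {x}) y)) h

≤+⇒−≤ : ∀ {x y z} → x ≤ℚ y + z → x − z ≤ℚ y
≤+⇒−≤ {x} {y} {z} h = ≤ℚ-trans (subst₂ _≤ℚ_ (sym (−-def _ _)) (sym (−-def _ _)) (+-mono h (≤ℚ-refl { − z }))) (≡⇒≤ (a+b−b y z))

one-way : ∀ {x y e} → 0ℚ ≤ℚ e → 0ℚ ≤ℚ x → x ≤ℚ y + e · y → x − e · x ≤ℚ y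
one-way {x} {y} {e} he hx h with ℚ.≤-total x y
... | inj₁ p = ≤ℚ-trans (a−b≤a (*-nonneg he hx)) p
... | inj₂ p = ≤+⇒−≤ (≤ℚ-trans h (+-mono (≤ℚ-refl {y}) (*-monoˡ he p)))

two-way : ∀ {x y e} → 0ℚ ≤ℚ e → 0ℚ ≤ℚ x → 0ℚ ≤ℚ y → x ≤ℚ y + e · y → y ≤ℚ x + e · x → x ≈[ e ] y
two-way he hx hy h h′ = record { to = one-way he hx h ; from = one-way he hy h′ }

≈-scale : ∀ {x y e} c → 0ℚ ≤ℚ c → x ≈[ e ] y → (c · x) ≈[ e ] (c · y)
≈-scale {x} {y} {e} c hc h = record
  { to = ≤ℚ-trans (≡⇒≤ (−·-assoc c e x)) (*-monoˡ hc (to h))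
  ; from = ≤ℚ-trans (≡⇒≤ (−·-assoc c e y)) (*-monoˡ hc (from h))
  }

≈-cancel : ∀ {x y e c} → 0ℚ < c → (c · x) ≈[ e ] (c · y) → x ≈[ e ] y
≈-cancel {x} {y} {e} {c} hc h = record
  { to = *-cancelˡ hc (≤ℚ-trans (≡⇒≤ (sym (−·-assoc c e x))) (to h))
  ; from = *-cancelˡ hc (≤ℚ-trans (≡⇒≤ (sym (−·-assoc c e y))) (from h))
  }

≈-resp : ∀ {x y e x′ y′} → x ≡ x′ → y ≡ y′ → x ≈[ e ] y → x′ ≈[ e ] y′
≈-resp refl refl h = h

≈-refl : ∀ x → x ≈[ 0ℚ ] x
≈-refl x = record { to = h ; from = h }
  where h : x − 0ℚ · x ≤ℚ x
        h = a−b≤a (≡⇒≤ (sym (*-zeroˡ x)))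

≈-weaken : ∀ {x y e f} → 0ℚ ≤ℚ x → 0ℚ ≤ℚ y → e ≤ℚ f → x ≈[ e ] y → x ≈[ f ] y
≈-weaken {x} {y} {e} {f} hx hy p h = record { to = ≤ℚ-trans (go x hx) (to h) ; from = ≤ℚ-trans (go y hy) (from h) }
  where go : ∀ z → 0ℚ ≤ℚ z → z − f · z ≤ℚ z − e · z
        go z hz = subst₂ _≤ℚ_ (sym (−-def _ _)) (sym (−-def _ _)) (+-mono (≤ℚ-refl {z}) (neg-mono (*-monoʳ hz p)))

-- Errors add, since (1 - e)(1 - f) ≥ 1 - (e + f). That there is no cross term is the reason for
-- measuring each error against its own side. For f ≥ 1 the first inequality cannot be scaled by 1 -
-- f, but then the claim is trivial.
trans-way : ∀ {x y z e f} → 0ℚ ≤ℚ e → 0ℚ ≤ℚ f → 0ℚ ≤ℚ x → 0ℚ ≤ℚ z → x − e · x ≤ℚ y → y − f · y ≤ℚ z → x − (e + f) · x ≤ℚ z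
trans-way {x} {y} {z} {e} {f} he hf hx hz h h′ with ℚ.≤-total 0ℚ (1ℚ − f)
... | inj₁ p = ≤-drop (≤ℚ-trans (≡⇒≤ (sym (−·-split e f x))) (≤ℚ-trans (*-monoˡ p h) (≤ℚ-trans (≡⇒≤ (1−·-expand f y)) h′))) (*-nonneg (*-nonneg he hf) hx)
... | inj₂ p = ≤-drop (≤ℚ-trans (≡⇒≤ (−·-split′ e f x)) (≤ℚ-trans (*-monoʳ hx p) (≤ℚ-trans (≡⇒≤ (*-zeroˡ x)) hz))) (*-nonneg he hx)

≈-trans : ∀ {x y z e f} → 0ℚ ≤ℚ e → 0ℚ ≤ℚ f → 0ℚ ≤ℚ x → 0ℚ ≤ℚ z → x ≈[ e ] y → y ≈[ f ] z → x ≈[ e + f ] z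
≈-trans {x} {y} {z} {e} {f} he hf hx hz h h′ = record
  { to = trans-way he hf hx hz (to h) (to h′)
  ; from = subst (λ g → z − g · z ≤ℚ x) (+-comm f e) (trans-way hf he hz hx (from h′) (from h))
  }

-- The relative error of one stage

module _ (r m d : ℕ) (i : Fin r) (d≥1 : 1 ≤ d) (fix : Fin r → Fin m → Bool) (uniform : Stage.Uniform r m d i fix)
         (α : Fin m) (α-free : fix i α ≡ false) (b′ : ℕ) (1≤b′ : 1 ≤ b′) (b≤m : suc b′ ≤ m)
         (b≡ : ∑ (allFin m) (λ v → 𝟙 (not (fix i v))) ≡ ι (suc b′)) (2d≤n : 2 * d ≤ m ^ (r ∸ 1)) where

  private
    nℕ = m ^ (r ∸ 1)
    b = suc b′

    module H = Hypergeometric nℕ b′ d d≥1 1≤b′ 2d≤n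
    module S = SteinStage r m d i d≥1 fix uniform α α-free b b≡

    n≡ : S.n ≡ ι nℕ
    n≡ = cong (λ k → ι (m ^ k)) (cong (_∸ 1) S.length-rest)

    error : ℚ
    error = inv (H.X d) · S.η̄

    solution : S.SteinSolution H.F H.N₀ H.A₀ (H.A₀ · inv (H.X d)) (H.N₀ · inv (H.X d))
    solution = record
      { equation = λ t p q → subst (λ n → (S.bd − ι t) · (n − ι t) · H.F (suc t) − ι t · (n · (ι b − 1ℚ) − (S.bd − ι t)) · H.F t ≡ 𝟙 (t ℕ.≡ᵇ d) · H.N₀ − H.A₀) (sym n≡)
          (H.equation t (ℕ.⊓-glb (ι-cancel (≤ℚ-trans q (≡⇒≤ (sym H.M≡)))) (ι-cancel (≤ℚ-trans p (≡⇒≤ n≡)))))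
      ; decreasing = H.decreasing
      ; slow = H.slow
      ; jump-nonneg = H.jump-nonneg
      ; jump = H.jump
      }

    opaque
      unfolding _+_
      e₁ : ∀ a n i η → a · n + a · i · (η · n) ≡ n · a + i · η · (n · a)
      e₁ = solve-∀ ℚ-ring
      e₂ : ∀ x n i η → x · n + n · i · (η · x) ≡ x · n + i · η · (x · n)
      e₂ = solve-∀ ℚ-ring

    N-nonneg : 0ℚ ≤ℚ S.N
    N-nonneg = S.N-nonneg

    N′-nonneg : 0ℚ ≤ℚ S.N′
    N′-nonneg = Stage.Unbiased.N-nonneg r m d i S.fix′ S.uniform′ α

    η̄-nonneg : 0ℚ ≤ℚ S.η̄
    η̄-nonneg = *-nonneg (ι-nonneg _) (+-nonneg (*-nonneg (ι-nonneg d) (ι-nonneg b)) (*-nonneg (ι-nonneg m) (ι-nonneg d)))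

    Xd-nonneg : 0ℚ ≤ℚ inv (H.X d)
    Xd-nonneg = inv-nonneg (<ℚ⇒≤ℚ H.Xd-pos)

    N₀-nonneg : 0ℚ ≤ℚ H.N₀
    N₀-nonneg = subst (0ℚ ≤ℚ_) (sym H.N₀≡) (ι-nonneg _)

  -- The two Stein bounds are A₀/X(d) against N and N₀/X(d) against N′; relative to N · A₀ and N′ ·
  -- N₀ both amount to `error`.
  stage : (S.N′ · H.N₀) ≈[ error ] (S.N · H.A₀)
  stage = two-way (*-nonneg Xd-nonneg η̄-nonneg) (*-nonneg N′-nonneg N₀-nonneg) (*-nonneg N-nonneg H.A₀-nonneg)
    (≤ℚ-trans (S.upper solution (*-nonneg H.A₀-nonneg Xd-nonneg)) (≡⇒≤ (e₁ _ _ _ _)))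
    (≤ℚ-trans (≡⇒≤ (*-comm _ _)) (≤ℚ-trans (S.lower solution (*-nonneg H.A₀-nonneg Xd-nonneg)) (≡⇒≤ (e₂ _ _ _ _))))

inv-bound : ∀ {x y c X} → 0ℚ < X → 0ℚ < y → x · y ≤ℚ c · X → inv X · x ≤ℚ c · inv y
inv-bound {x} {y} {c} {X} hX hy h = *-cancelˡ (*-pos hX hy) (≤ℚ-trans (≡⇒≤ (trans (e₁ X y (inv X) x) (trans (cong (_· (x · y)) (*-inv (0<⇒≢0 hX))) (*-identityˡ _))))
    (≤ℚ-trans h (≡⇒≤ (sym (trans (e₂ X y (inv y) c) (trans (cong (_· (c · X)) (*-inv (0<⇒≢0 hy))) (*-identityˡ _)))))))
  where
  opaque
    unfolding _+_
    e₁ : ∀ X y i x → X · y · (i · x) ≡ X · i · (x · y)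
    e₁ = solve-∀ ℚ-ring
    e₂ : ∀ X y i c → X · y · (c · i) ≡ y · i · (c · X)
    e₂ = solve-∀ ℚ-ring

-- From measures to counts

module Counts (r m d : ℕ) where
  open Weights r m d public

  count : Fix → ℚ
  count fix = 𝔼 (weight fix) (λ _ → 1ℚ)

  count-nonneg : ∀ fix → 0ℚ ≤ℚ count fix
  count-nonneg fix = 𝔼-nonneg (weight-nonneg fix) (λ _ → inj₂ 0≤1)

  count-cong : ∀ {fix fix′} → (∀ E → Satisfies fix E → Satisfies fix′ E) → (∀ E → Satisfies fix′ E → Satisfies fix E) → count fix ≡ count fix′
  count-cong {fix} {fix′} f g = 𝔼-weight (λ E → cong (λ b → 𝟙 b · 1ℚ) (bool-≡ (λ h → good-complete {fix′} {E} (f E (good-sound {fix} {E} h))) (λ h → good-complete {fix} {E} (g E (good-sound {fix′} {E} h)))))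

  -- Bounds the relative error of prescribing the degree of one vertex while b are free.
  ε : ℕ → ℚ
  ε b = ι (8 * (r * m)) · inv (ι (b * m ^ (r ∸ 1)))

  ε-nonneg : ∀ b → 0ℚ ≤ℚ ε b
  ε-nonneg b = *-nonneg (ι-nonneg _) (inv-nonneg (ι-nonneg _))

  c : ℕ → ℚ
  c b = ι ((m ^ (r ∸ 1) * b) C (d * b))

  module _ (i : Fin r) (d≥1 : 1 ≤ d) (fix : Fix) (uniform : Stage.Uniform r m d i fix)
           (α : Fin m) (α-free : fix i α ≡ false) (b′ : ℕ) (1≤b′ : 1 ≤ b′) (b≤m : suc b′ ≤ m)
           (b≡ : ∑ (allFin m) (λ v → 𝟙 (not (fix i v))) ≡ ι (suc b′)) (2d≤n : 2 * d ≤ m ^ (r ∸ 1)) where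

    private
      n = m ^ (r ∸ 1)
      b = suc b′
      module H = Hypergeometric n b′ d d≥1 1≤b′ 2d≤n
      module B = StageBound r m d i d≥1 fix uniform α α-free b b≡

      -- The numerator is at most 2rmd, and X(d) = d b′ (n - d) with b ≤ 2b′ and n ≤ 2(n - d). The
      -- three factors 2 make the 8 in `ε`.
      error-bound : inv (H.X d) · B.η̄ ≤ℚ ε b
      error-bound = inv-bound H.Xd-pos (ι-pos (ℕ.*-mono-≤ {1} {b} (s≤s z≤n) (ℕ.≤-trans d≥1 H.d≤n))) (≤ℚ-trans
          (*-monoʳ (ι-nonneg _) (*-mono (ι-nonneg _) (ι-nonneg (m * d ℕ.+ m * d)) (ι-mono (ℕ.≤-trans (ℕ.n≤1+n _) (ℕ.≤-reflexive B.length-rest)))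
            (≤ℚ-trans (+-mono (≤ℚ-trans (≡⇒≤ (sym (ι-* d b))) (ι-mono (ℕ.≤-trans (ℕ.*-monoʳ-≤ d b≤m) (ℕ.≤-reflexive (ℕ.*-comm d m))))) (≡⇒≤ (sym (ι-* m d)))) (≡⇒≤ (sym (ι-+ _ _))))))
          (≤ℚ-trans (≡⇒≤ (trans (cong (_· ι (b * n)) (sym (ι-* r _))) (sym (ι-* _ _))))
            (≤ℚ-trans (ι-mono arith) (≡⇒≤ (trans (ι-* _ _) (cong (ι (8 * (r * m)) ·_) (trans (ι-* _ _) (sym Xd))))))))
        where
        Xd : H.X d ≡ ι (d * b′) · ι (n ∸ d)
        Xd = cong₂ _·_ (trans (cong (_− ι d) (sym H.M≡)) (trans (sym (ι-∸ (ℕ.m≤m*n d b))) (cong ι (trans (cong (_∸ d) (ℕ.*-suc d b′)) (ℕ.m+n∸m≡n d _))))) (sym (ι-∸ H.d≤n))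
        b≤2b′ : b ≤ 2 * b′
        b≤2b′ = ℕ.≤-trans (ℕ.+-monoˡ-≤ b′ 1≤b′) (ℕ.≤-reflexive (cong (b′ ℕ.+_) (sym (ℕ.+-identityʳ b′))))
        n≤2n−d : n ≤ 2 * (n ∸ d)
        n≤2n−d = ℕ.≤-trans (ℕ.≤-trans (ℕ.≤-reflexive (trans (sym (ℕ.m∸n+n≡m H.d≤n)) refl)) (ℕ.+-monoʳ-≤ (n ∸ d)
          (ℕ.≤-trans (ℕ.≤-reflexive (sym (trans (cong (_∸ d) (cong (d ℕ.+_) (ℕ.+-identityʳ d))) (ℕ.m+n∸m≡n d d)))) (ℕ.∸-monoˡ-≤ d 2d≤n)))) (ℕ.≤-reflexive (cong (n ∸ d ℕ.+_) (sym (ℕ.+-identityʳ _))))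
        arith : r * (m * d ℕ.+ m * d) * (b * n) ≤ 8 * (r * m) * (d * b′ * (n ∸ d))
        arith = ℕ.≤-trans (ℕ.*-monoʳ-≤ (r * (m * d ℕ.+ m * d)) (ℕ.*-mono-≤ b≤2b′ n≤2n−d)) (ℕ.≤-reflexive
          (solve 5 (λ r m d b k → r :* (m :* d :+ m :* d) :* ((con 2 :* b) :* (con 2 :* k)) := con 8 :* (r :* m) :* (d :* b :* k)) refl r m d b′ (n ∸ d)))
          where open ℕ.+-*-Solver

    stage-counts : (count B.fix′ · c b) ≈[ ε b ] (count fix · (ι (n C d) · c b′))
    stage-counts = ≈-weaken (*-nonneg (count-nonneg _) (ι-nonneg _)) (*-nonneg (count-nonneg _) (*-nonneg (ι-nonneg _) (ι-nonneg _))) error-bound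
      (≈-resp (cong₂ _·_ (unit B.fix′) H.N₀≡) (cong₂ _·_ (unit fix) H.A₀≡)
        (stage r m d i d≥1 fix uniform α α-free b′ 1≤b′ b≤m b≡ 2d≤n))
      where unit : ∀ fix → 𝔼 (biased fix i α (λ _ → 1ℚ)) (λ _ → 1ℚ) ≡ count fix
            unit fix = 𝔼-weight (λ E → cong (_· 1ℚ) (*-identityʳ _))

∑-allFin-suc : ∀ m (f : Fin (suc m) → ℚ) → ∑ (allFin (suc m)) f ≡ f zero + ∑ (allFin m) (f ∘ suc)
∑-allFin-suc m f = cong (f zero +_) (trans (cong (λ xs → ∑ xs f) (sym (List.map-tabulate id suc))) (∑-map suc (allFin m) f))

∑-unfixed : ∀ m j → ∑ (allFin m) (λ v → 𝟙 (not (toℕ v ℕ.<ᵇ j))) ≡ ι (m ∸ j)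
∑-unfixed zero j = trans (sym ι-0) (cong ι (sym (ℕ.0∸n≡0 j)))
∑-unfixed (suc m) zero = trans (∑-allFin-suc m _) (trans (cong₂ _+_ 𝟙-true (∑-unfixed m zero)) (sym (ι-suc m)))
∑-unfixed (suc m) (suc j) = trans (∑-allFin-suc m _) (trans (cong₂ _+_ 𝟙-false (∑-unfixed m j)) (+-identityˡ _))

<ᵇ-true : ∀ {a b} → a ℕ.< b → (a ℕ.<ᵇ b) ≡ true
<ᵇ-true {zero} {suc b} h = refl
<ᵇ-true {suc a} {suc b} (s≤s h) = <ᵇ-true h

<ᵇ-sound : ∀ {a b} → (a ℕ.<ᵇ b) ≡ true → a ℕ.< b
<ᵇ-sound {zero} {suc b} h = s≤s z≤n
<ᵇ-sound {suc a} {suc b} h = s≤s (<ᵇ-sound h)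

¬true⇒false : ∀ {b} → (b ≡ true → ⊥) → b ≡ false
¬true⇒false {true} h = ⊥-elim (h refl)
¬true⇒false {false} h = refl

-- Prescribing the vertices in order

module Process (r m d : ℕ) where
  open Counts r m d public

  prefix : ℕ → ℕ → Fix
  prefix p j l v = (toℕ l ℕ.<ᵇ p) ∨ ((toℕ l ℕ.≡ᵇ p) ∧ (toℕ v ℕ.<ᵇ j))

  prefix-sound : ∀ {p j l v} → prefix p j l v ≡ true → toℕ l ℕ.< p ⊎ (toℕ l ≡ p × toℕ v ℕ.< j)
  prefix-sound {p} {j} {l} {v} h = go (toℕ l ℕ.<ᵇ p) (toℕ l ℕ.≡ᵇ p) (toℕ v ℕ.<ᵇ j) h <ᵇ-sound ≡ᵇ-sound <ᵇ-sound
    where go : ∀ {P Q R : Set} a b c → a ∨ (b ∧ c) ≡ true → (a ≡ true → P) → (b ≡ true → Q) → (c ≡ true → R) → P ⊎ (Q × R)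
          go true b c h f g k = inj₁ (f refl)
          go false true true h f g k = inj₂ (g refl , k refl)

  prefix-< : ∀ {p j l v} → toℕ l ℕ.< p → prefix p j l v ≡ true
  prefix-< {p} {j} {l} {v} h = cong (_∨ ((toℕ l ℕ.≡ᵇ p) ∧ (toℕ v ℕ.<ᵇ j))) (<ᵇ-true h)

  prefix-≡ : ∀ {p j l v} → toℕ l ≡ p → prefix p j l v ≡ (toℕ v ℕ.<ᵇ j)
  prefix-≡ {p} {j} {l} {v} h = cong₂ (λ a b → a ∨ (b ∧ (toℕ v ℕ.<ᵇ j))) (¬true⇒false (λ q → ℕ.<-irrefl h (<ᵇ-sound q))) (≡ᵇ-complete h)

  module _ {p : ℕ} (i : Fin r) (i≡p : toℕ i ≡ p) where

    prefix-uniform : ∀ j → Stage.Uniform r m d i (prefix p j)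
    prefix-uniform j l ne with ℕ.<-cmp (toℕ l) p
    ... | Tri.tri< h _ _ = inj₁ (λ v → prefix-< {p} {j} {l} {v} h)
    ... | Tri.tri≈ _ h _ = contradiction (Fin.toℕ-injective (trans h (sym i≡p))) ne
    ... | Tri.tri> h₁ h₂ _ = inj₂ (λ v → ¬true⇒false (λ q → Sum.[ h₁ , (λ x → h₂ (proj₁ x)) ] (prefix-sound {p} {j} {l} {v} q)))

    unfixed : ∀ j → ∑ (allFin m) (λ v → 𝟙 (not (prefix p j i v))) ≡ ι (m ∸ j)
    unfixed j = trans (∑-cong (allFin m) (λ v → cong (λ b → 𝟙 (not b)) (prefix-≡ {p} {j} {i} {v} i≡p))) (∑-unfixed m j)

    stage-step : (d≥1 : 1 ≤ d) (2d≤n : 2 * d ≤ m ^ (r ∸ 1)) → ∀ {j} → suc (suc j) ≤ m → (count (prefix p (suc j)) · c (m ∸ j)) ≈[ ε (m ∸ j) ] (count (prefix p j) · (ι ((m ^ (r ∸ 1)) C d) · c (m ∸ suc j)))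
    stage-step d≥1 2d≤n {j} jm = subst (λ b → (count (prefix p (suc j)) · c b) ≈[ ε b ] (count (prefix p j) · (ι ((m ^ (r ∸ 1)) C d) · c (m ∸ suc j)))) b≡
      (≈-resp (cong (_· c (suc (m ∸ suc j))) (count-cong {fix′} {prefix p (suc j)} to′ from′)) refl
        (stage-counts i d≥1 (prefix p j) (prefix-uniform j) α α-free (m ∸ suc j) 1≤b′ b≤m (trans (unfixed j) (cong ι (sym b≡))) 2d≤n))
      where
      j<m = ℕ.<⇒≤ jm
      α = fromℕ< j<m
      α-free : prefix p j i α ≡ false
      α-free = trans (prefix-≡ {p} {j} {i} {α} i≡p) (¬true⇒false (λ q → ℕ.<-irrefl (Fin.toℕ-fromℕ< j<m) (<ᵇ-sound q)))
      b≡ : suc (m ∸ suc j) ≡ m ∸ j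
      b≡ = sym (ℕ.+-∸-assoc 1 j<m)
      1≤b′ : 1 ≤ m ∸ suc j
      1≤b′ = ℕ.m<n⇒0<n∸m jm
      b≤m : suc (m ∸ suc j) ≤ m
      b≤m = ℕ.≤-trans (ℕ.≤-reflexive b≡) (ℕ.m∸n≤m m j)
      fix′ : Fix
      fix′ = StageBound.fix′ r m d i d≥1 (prefix p j) (prefix-uniform j) α α-free (suc (m ∸ suc j)) (trans (unfixed j) (cong ι (sym b≡)))
      ∨-right : ∀ a {b} → b ≡ true → a ∨ b ≡ true
      ∨-right true q = refl
      ∨-right false q = q
      to′ : ∀ E → Satisfies fix′ E → Satisfies (prefix p (suc j)) E
      to′ E (h , s) = (λ l v q → h l v (go l v (prefix-sound {p} {suc j} {l} {v} q))) , s
        where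
        go : ∀ l v → toℕ l ℕ.< p ⊎ (toℕ l ≡ p × toℕ v ℕ.< suc j) → fix′ l v ≡ true
        go l v (inj₁ q) = cong (_∨ (does (l ≟ᶠ i) ∧ does (v ≟ᶠ α))) (prefix-< {p} {j} {l} {v} q)
        go l v (inj₂ (q , s≤s v≤j)) with ℕ.m≤n⇒m<n∨m≡n v≤j
        ... | inj₁ v<j = cong (_∨ (does (l ≟ᶠ i) ∧ does (v ≟ᶠ α))) (trans (prefix-≡ {p} {j} {l} {v} q) (<ᵇ-true v<j))
        ... | inj₂ v≡j = ∨-right (prefix p j l v) (cong₂ _∧_ (dec-true (l ≟ᶠ i) (Fin.toℕ-injective (trans q (sym i≡p)))) (dec-true (v ≟ᶠ α) (Fin.toℕ-injective (trans v≡j (sym (Fin.toℕ-fromℕ< j<m))))))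
      from′ : ∀ E → Satisfies (prefix p (suc j)) E → Satisfies fix′ E
      from′ E (h , s) = (λ l v q → h l v (go l v q)) , s
        where
        go : ∀ l v → fix′ l v ≡ true → prefix p (suc j) l v ≡ true
        go l v q with prefix p j l v in eq
        ... | true = Sum.[ (λ x → prefix-< {p} {suc j} {l} {v} x) , (λ x → trans (prefix-≡ {p} {suc j} {l} {v} (proj₁ x)) (<ᵇ-true (ℕ.m<n⇒m<1+n (proj₂ x)))) ] (prefix-sound {p} {j} {l} {v} eq)
        ... | false with l ≟ᶠ i | v ≟ᶠ α
        ... | yes refl | yes refl = trans (prefix-≡ {p} {suc j} {i} {α} i≡p) (<ᵇ-true (s≤s (ℕ.≤-reflexive (Fin.toℕ-fromℕ< j<m))))
        ... | yes _ | no _ with () ← q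
        go l v q | false | no _ | _ with () ← q

    -- The number md of edges forces the degree of the last vertex of a class, so this vertex costs
    -- no error. It would be the stage b = 1, which the Stein argument excludes.
    last-vertex : ∀ {m′} → m ≡ suc m′ → count (prefix p m′) ≡ count (prefix (suc p) 0)
    last-vertex {m′} refl = count-cong {prefix p m′} {prefix (suc p) 0} to′ from′
      where
      α = fromℕ< (ℕ.n<1+n m′)
      last? : ∀ v → not (prefix p m′ i v) ≡ does (v ≟ᶠ α)
      last? v = trans (cong not (prefix-≡ {p} {m′} {i} {v} i≡p)) (go (v ≟ᶠ α))
        where go : (q : Dec (v ≡ α)) → not (toℕ v ℕ.<ᵇ m′) ≡ does q
              go (yes refl) = cong not (¬true⇒false (λ q → ℕ.<-irrefl (Fin.toℕ-fromℕ< (ℕ.n<1+n m′)) (<ᵇ-sound q)))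
              go (no ne) = cong not (<ᵇ-true (ℕ.≤∧≢⇒< (ℕ.≤-pred (Fin.toℕ<n v)) (λ q → ne (Fin.toℕ-injective (trans q (sym (Fin.toℕ-fromℕ< (ℕ.n<1+n m′))))))))
      from′ : ∀ E → Satisfies (prefix (suc p) 0) E → Satisfies (prefix p m′) E
      from′ E (h , s) = (λ l v q → h l v (prefix-< {suc p} {0} {l} {v} (Sum.[ ℕ.m<n⇒m<1+n , (λ x → s≤s (ℕ.≤-reflexive (proj₁ x))) ] (prefix-sound {p} {m′} {l} {v} q)))) , s
      to′ : ∀ E → Satisfies (prefix p m′) E → Satisfies (prefix (suc p) 0) E
      to′ E sat@(h , s) = (λ l v q → go l v (prefix-sound {suc p} {0} {l} {v} q)) , s
        where
        last : deg E i α ≡ d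
        last = ι-inj (begin
          ι (deg E i α)
            ≡⟨ sym (∑-δᶠ α (λ v → ι (deg E i v))) ⟩
          ∑ (allFin m) (λ v → 𝟙 (does (v ≟ᶠ α)) · ι (deg E i v))
            ≡⟨ ∑-cong (allFin m) (λ v → cong (λ b → 𝟙 b · ι (deg E i v)) (sym (last? v))) ⟩
          ∑ (allFin m) (λ v → 𝟙 (not (prefix p m′ i v)) · ι (deg E i v))
            ≡⟨ Stage.Unbiased.D-free r m d i (prefix p m′) (prefix-uniform m′) α E sat ⟩
          ι d · ∑ (allFin m) (λ v → 𝟙 (not (prefix p m′ i v)))
            ≡⟨ cong (ι d ·_) (trans (unfixed m′) (trans (cong ι (ℕ.m+n∸n≡m 1 m′)) ι-1)) ⟩
          ι d · 1ℚ
            ≡⟨ *-identityʳ _ ⟩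
          ι d ∎)
          where open ≡-Reasoning
        go : ∀ l v → toℕ l ℕ.< suc p ⊎ (toℕ l ≡ suc p × toℕ v ℕ.< 0) → deg E l v ≡ d
        go l v (inj₁ (s≤s l≤p)) with ℕ.m≤n⇒m<n∨m≡n l≤p
        ... | inj₁ l<p = h l v (prefix-< {p} {m′} {l} {v} l<p)
        ... | inj₂ l≡p with Fin.toℕ-injective {i = l} {i} (trans l≡p (sym i≡p)) | v ≟ᶠ α
        ... | refl | yes refl = last
        ... | refl | no ne = h i v (trans (prefix-≡ {p} {m′} {i} {v} i≡p) (not-not (trans (cong not (sym (prefix-≡ {p} {m′} {i} {v} i≡p))) (trans (last? v) (dec-false (v ≟ᶠ α) ne)))))
          where not-not : ∀ {b} → not b ≡ false → b ≡ true
                not-not {true} _ = refl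

-- Identification with the lists of the definitions

module Sublists {A : Set} (_≟_ : (x y : A) → Dec (x ≡ y)) where
  open Subsets _≟_

  -- Holds for sublists of a duplicate-free list. It translates sums over all cells weighted by the
  -- predicate `ind ys` into sums over `ys`, and so its degrees into those of the definition.
  record Represents (xs ys : List A) : Set where
    constructor _⨾_
    field
      sums : ∀ g → ∑ xs (λ c → 𝟙 (ind ys c) · g c) ≡ ∑ ys g
      mem : ∀ {c} → ind ys c ≡ true → c ∈ xs

  subsets-represent : ∀ {xs} → Unique xs → All (Represents xs) (subsets xs)
  subsets-represent [] = ((λ g → refl) ⨾ λ ()) ∷ []
  subsets-represent {x ∷ xs} (u ∷ us) = All.++⁺ (All.map old (subsets-represent us)) (All.map⁺ (All.map new (subsets-represent us)))
    where
    x∉ : x ∉ xs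
    x∉ q = All.lookup u q refl
    old : ∀ {ys} → Represents xs ys → Represents (x ∷ xs) ys
    old {ys} (s ⨾ mem) = (λ g → trans (cong₂ _+_ (trans (cong (λ b → 𝟙 b · g x) (¬true⇒false (λ q → x∉ (mem q)))) (trans (cong (_· g x) 𝟙-false) (*-zeroˡ _))) (s g)) (+-identityˡ _)) ⨾ λ q → there (mem q)
    new : ∀ {ys} → Represents xs ys → Represents (x ∷ xs) (x ∷ ys)
    new {ys} (s ⨾ mem) = (λ g → cong₂ _+_ (trans (cong (λ b → 𝟙 (b ∨ ind ys x) · g x) (dec-true (x ≟ x) refl)) (trans (cong (_· g x) 𝟙-true) (*-identityˡ _)))
        (trans (∑-congᴬ u (λ c ne → cong (λ b → 𝟙 (b ∨ ind ys c) · g c) (dec-false (c ≟ x) (λ e → ne (sym e))))) (s g)))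
      ⨾ mem′
      where mem′ : ∀ {c} → does (c ≟ x) ∨ ind ys c ≡ true → c ∈ x ∷ xs
            mem′ {c} q with c ≟ x
            ... | yes refl = here refl
            ... | no _ = there (mem q)

subsets-count : {A : Set} (xs : List A) (k : ℕ) → ∑ (subsets xs) (λ ys → 𝟙 (length ys ℕ.≡ᵇ k)) ≡ ι (length xs C k)
subsets-count [] zero = trans (+-identityʳ _) (trans 𝟙-true (sym (trans (cong ι (nC0≡1 0)) ι-1)))
subsets-count [] (suc k) = trans (+-identityʳ _) (trans 𝟙-false (sym (trans (cong ι (k>n⇒nCk≡0 {0} {suc k} (s≤s z≤n))) ι-0)))
subsets-count (x ∷ xs) zero = trans (∑-++ (subsets xs) _ _) (trans (cong₂ _+_ (subsets-count xs zero)
    (trans (∑-map (x ∷_) (subsets xs) _) (trans (∑-cong (subsets xs) (λ _ → 𝟙-false)) (∑-0 (subsets xs))))) (trans (+-identityʳ _) (cong ι (trans (nC0≡1 (length xs)) (sym (nC0≡1 (suc (length xs))))))))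
subsets-count (x ∷ xs) (suc k) = trans (∑-++ (subsets xs) _ _) (trans (cong₂ _+_ (subsets-count xs (suc k)) (trans (∑-map (x ∷_) (subsets xs) _) (subsets-count xs k)))
    (trans (+-comm _ _) (trans (sym (ι-+ _ _)) (cong ι (nCk+nC[k+1]≡[n+1]C[k+1] (length xs) k)))))

module Counting (r m d : ℕ) where
  open Process r m d public
  open Sublists _≟ᶜ_

  opaque
    unfolding 𝔼
    count-lists : ∀ fix → count fix ≡ ∑ (subsets cells) (λ ys → weight fix (ind ys))
    count-lists fix = ∑-cong (subsets cells) (λ ys → *-identityʳ _)

  represent : All (Represents cells) (subsets cells)
  represent = subsets-represent (allEdges-unique r m)

  size-ind : ∀ {ys} → Represents cells ys → size (ind ys) ≡ length ys
  size-ind {ys} (s ⨾ _) = ι-inj (trans (ι-size _) (trans (∑-cong cells (λ c → sym (*-identityʳ _))) (trans (s (λ _ → 1ℚ)) (trans (∑-const ys 1ℚ) (*-identityʳ _)))))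

  deg-ind : ∀ {ys} → Represents cells ys → ∀ l v → deg (ind ys) l v ≡ degree ys l v
  deg-ind {ys} (s ⨾ _) l v = ι-inj (trans (ι-deg _ l v) (trans (s (at l v)) (trans (∑-cong ys (λ e → sym (*-identityʳ _)))
    (trans (sym (∑-filter? (λ e → lookup e l ≟ᶠ v) ys (λ _ → 1ℚ))) (trans (∑-const (filter (λ e → lookup e l ≟ᶠ v) ys) 1ℚ) (*-identityʳ _))))))

  count-none : count (prefix 0 0) ≡ ι ((m ^ r) C (m * d))
  count-none = trans (count-lists (prefix 0 0)) (trans (∑-congᴬ represent (λ ys R → cong 𝟙 (bool-≡
      (λ h → ≡ᵇ-complete (trans (sym (size-ind R)) (proj₂ (good-sound {prefix 0 0} {ind ys} h))))
      (λ h → good-complete {prefix 0 0} {ind ys} ((λ l v q → ⊥-elim (none {l} {v} (prefix-sound {0} {0} {l} {v} q))) , trans (size-ind R) (≡ᵇ-sound h))))))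
    (trans (subsets-count cells (m * d)) (cong (λ k → ι (k C (m * d))) (length-allEdges r m))))
    where none : ∀ {l : Fin r} {v : Fin m} → toℕ l ℕ.< 0 ⊎ (toℕ l ≡ 0 × toℕ v ℕ.< 0) → ⊥
          none (inj₁ ())
          none (inj₂ (_ , ()))

  -- The size condition of `good` follows from regularity by summing the degrees of one class, which
  -- r ≥ 1 provides.
  count-all : 1 ≤ r → count (prefix r 0) ≡ ι (H r d m)
  count-all r≥1 = trans (count-lists (prefix r 0)) (trans (∑-congᴬ represent (λ ys R → cong 𝟙 (bool-≡ (λ h → regular R (good-sound {prefix r 0} {ind ys} h)) (λ h → good-complete {prefix r 0} {ind ys} (satisfies R h)))))
      (∑-filter (isRegularᵇ d) (subsets cells)))
    where
    i₀ : Fin r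
    i₀ = fromℕ< r≥1
    regular : ∀ {ys} → Represents cells ys → Satisfies (prefix r 0) (ind ys) → isRegularᵇ d ys ≡ true
    regular {ys} R (h , _) = ∈-all {xs = allFin r} {λ l → all (λ v → degree ys l v ℕ.≡ᵇ d) (allFin m)} (λ {l} _ → ∈-all {xs = allFin m} {λ v → degree ys l v ℕ.≡ᵇ d}
      (λ {v} _ → ≡ᵇ-complete (trans (sym (deg-ind R l v)) (h l v (prefix-< {r} {0} {l} {v} (Fin.toℕ<n l))))))
    satisfies : ∀ {ys} → Represents cells ys → isRegularᵇ d ys ≡ true → Satisfies (prefix r 0) (ind ys)
    satisfies {ys} R h = (λ l v _ → degs l v) , ι-inj (trans (ι-size-deg (ind ys) i₀) (trans (∑-cong (allFin m) (λ v → cong ι (degs i₀ v)))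
        (trans (∑-const (allFin m) (ι d)) (trans (cong (λ k → ι k · ι d) (length-allFin m)) (sym (ι-* m d))))))
      where degs : ∀ l v → deg (ind ys) l v ≡ d
            degs l v = trans (deg-ind R l v) (≡ᵇ-sound (all-∈ {xs = allFin m} {λ v → degree ys l v ℕ.≡ᵇ d}
              (all-∈ {xs = allFin r} {λ l → all (λ v → degree ys l v ℕ.≡ᵇ d) (allFin m)} h (Membership.∈-allFin l)) (Membership.∈-allFin v)))

-- The product over all stages

module Products (r m d : ℕ) (d≥1 : 1 ≤ d) (2d≤n : 2 * d ≤ m ^ (r ∸ 1)) where
  open Counting r m d public

  private
    n = m ^ (r ∸ 1)

  nCd : ℕ
  nCd = n C d

  err : ℕ → ℚ
  err j = σ j (λ i → ε (m ∸ i))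

  err-nonneg : ∀ j → 0ℚ ≤ℚ err j
  err-nonneg zero = ≤ℚ-refl
  err-nonneg (suc j) = +-nonneg (err-nonneg j) (ε-nonneg (m ∸ j))

  d≤n : d ≤ n
  d≤n = ℕ.≤-trans (ℕ.m≤m+n d _) 2d≤n

  c-pos : ∀ b → 0ℚ < c b
  c-pos b = ι-pos (C-pos (ℕ.*-monoˡ-≤ b d≤n))

  c-nonneg : ∀ b → 0ℚ ≤ℚ c b
  c-nonneg b = ι-nonneg _

  private opaque
    unfolding _+_
    e₁ : ∀ x y z → x · (y · z) ≡ z · (y · x)
    e₁ = solve-∀ ℚ-ring
    e₂ : ∀ a b x y → a · (x · (y · b)) ≡ (y · b) · (x · a)
    e₂ = solve-∀ ℚ-ring
    e₃ : ∀ nCd b x y z → (nCd · b) · (x · (y · z)) ≡ z · (x · ((nCd · y) · b))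
    e₃ = solve-∀ ℚ-ring
    e₄ : ∀ x y z → z · (x · y) ≡ x · (y · z)
    e₄ = solve-∀ ℚ-ring
    e₅ : ∀ x y z → z · (x · y) ≡ y · (x · z)
    e₅ = solve-∀ ℚ-ring
    e₆ : ∀ x y z → z · (x · y) ≡ x · (z · y)
    e₆ = solve-∀ ℚ-ring

  module _ {p : ℕ} (i : Fin r) (i≡p : toℕ i ≡ p) where

    -- The binomial coefficients of consecutive stages telescope, so only the first and the last of
    -- them survive.
    class-steps : ∀ j → suc j ≤ m → (count (prefix p j) · c m) ≈[ err j ] (count (prefix p 0) · (ι (nCd ^ j) · c (m ∸ j)))
    class-steps zero _ = ≈-resp refl (cong (count (prefix p 0) ·_) (sym (trans (cong (_· c m) ι-1) (*-identityˡ _)))) (≈-refl _)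
    class-steps (suc j) jm = ≈-cancel (c-pos (m ∸ j)) (subst (λ e → (c (m ∸ j) · (count (prefix p (suc j)) · c m)) ≈[ e ] (c (m ∸ j) · (count (prefix p 0) · (ι (nCd ^ suc j) · c (m ∸ suc j))))) (+-comm _ _)
      (≈-trans (ε-nonneg (m ∸ j)) (err-nonneg j) (*-nonneg (c-nonneg (m ∸ j)) (*-nonneg (count-nonneg _) (c-nonneg m))) (*-nonneg (c-nonneg (m ∸ j)) (*-nonneg (count-nonneg _) (*-nonneg (ι-nonneg _) (c-nonneg (m ∸ suc j)))))
        (≈-resp (e₁ _ _ _) refl (≈-scale (c m) (c-nonneg m) (stage-step i i≡p d≥1 2d≤n jm)))
        (≈-resp (sym (e₂ _ _ _ _)) (trans (e₃ _ _ _ _ _) (cong (λ z → c (m ∸ j) · (count (prefix p 0) · (z · c (m ∸ suc j)))) (sym (ι-* nCd (nCd ^ j)))))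
          (≈-scale (ι nCd · c (m ∸ suc j)) (*-nonneg (ι-nonneg nCd) (c-nonneg (m ∸ suc j))) (class-steps j (ℕ.<⇒≤ jm))))))

    -- Only m - 1 vertices are prescribed by stages; the remaining binomial `c 1` is C(n, d) itself
    -- and supplies the m-th factor.
    class-step : ∀ {m′} → m ≡ suc m′ → (count (prefix (suc p) 0) · c m) ≈[ err m′ ] (count (prefix p 0) · ι (nCd ^ m))
    class-step {m′} m≡ = ≈-resp (cong (_· c m) (last-vertex i i≡p m≡)) (cong (count (prefix p 0) ·_) last-factor) (class-steps m′ (ℕ.≤-reflexive (sym m≡)))
      where last-factor : ι (nCd ^ m′) · c (m ∸ m′) ≡ ι (nCd ^ m)
            last-factor = trans (cong (ι (nCd ^ m′) ·_) (trans (cong c (trans (cong (_∸ m′) m≡) (ℕ.m+n∸n≡m 1 m′))) (cong₂ (λ x y → ι (x C y)) (ℕ.*-identityʳ n) (ℕ.*-identityʳ d))))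
              (trans (sym (ι-* (nCd ^ m′) nCd)) (cong ι (trans (ℕ.*-comm (nCd ^ m′) nCd) (cong (nCd ^_) (sym m≡)))))

  cℕ : ℕ
  cℕ = (n * m) C (d * m)

  classes : ∀ {m′} → m ≡ suc m′ → ∀ p → p ≤ r → (count (prefix p 0) · ι (cℕ ^ p)) ≈[ ι p · err m′ ] (count (prefix 0 0) · ι (nCd ^ (p * m)))
  classes {m′} m≡ zero _ = subst (λ e → (count (prefix 0 0) · ι 1) ≈[ e ] (count (prefix 0 0) · ι 1)) (sym (trans (cong (_· err m′) ι-0) (*-zeroˡ _))) (≈-refl _)
  classes {m′} m≡ (suc p) p<r = subst (λ e → (count (prefix (suc p) 0) · ι (cℕ ^ suc p)) ≈[ e ] (count (prefix 0 0) · ι (nCd ^ (suc p * m)))) (trans (suc-· (err m′) (ι p)) (cong (_· err m′) (sym (ι-suc p))))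
    (≈-trans (err-nonneg m′) (*-nonneg (ι-nonneg p) (err-nonneg m′)) (*-nonneg (count-nonneg _) (ι-nonneg _)) (*-nonneg (count-nonneg _) (ι-nonneg _))
      (≈-resp (trans (e₄ _ _ _) (cong (count (prefix (suc p) 0) ·_) (sym (ι-* cℕ (cℕ ^ p))))) refl (≈-scale (ι (cℕ ^ p)) (ι-nonneg _) (class-step i i≡p m≡)))
      (≈-resp (sym (e₅ _ _ _)) (trans (e₆ _ _ _) (cong (count (prefix 0 0) ·_) (trans (sym (ι-* (nCd ^ m) (nCd ^ (p * m)))) (cong ι (sym (ℕ.^-distribˡ-+-* nCd m (p * m)))))))
        (≈-scale (ι (nCd ^ m)) (ι-nonneg _) (classes m≡ p (ℕ.<⇒≤ p<r)))))
    where
    i = fromℕ< p<r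
    i≡p = Fin.toℕ-fromℕ< p<r

  cℕ≡ : 1 ≤ r → (m ^ r) C (m * d) ≡ cℕ
  cℕ≡ h = cong₂ _C_ (trans (cong (m ^_) (sym (ℕ.m+[n∸m]≡n h))) (ℕ.*-comm m n)) (ℕ.*-comm m d)

  -- The r classes contribute r factors C(m^r, md). One of them cancels against the number of all
  -- sets of md cells, which leaves the exponent r - 1.
  approximation : ∀ {m′} → m ≡ suc m′ → 1 ≤ r → (ι (H r d m) · ι (Hden r d m)) ≈[ ι r · err m′ ] ι (Hnum r d m)
  approximation m≡ h = ≈-cancel (c-pos m) (≈-resp
      (trans (cong (_· ι (cℕ ^ r)) (count-all h)) (trans (cong (λ s → ι (H r d m) · ι (cℕ ^ s)) (sym (ℕ.m+[n∸m]≡n h))) (trans (cong (ι (H r d m) ·_) (ι-* cℕ (cℕ ^ (r ∸ 1)))) (trans (e₆ _ _ _) (cong (λ z → c m · (ι (H r d m) · ι (z ^ (r ∸ 1)))) (sym (cℕ≡ h)))))))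
      (cong (_· ι (nCd ^ (r * m))) (trans count-none (cong ι (cℕ≡ h))))
      (classes m≡ r ℕ.≤-refl))

-- Complementary edge sets

module Complement {A : Set} (_≟_ : (x y : A) → Dec (x ≡ y)) where
  open Subsets _≟_
  open Sublists _≟_

  infixl 4 _∖_

  _∖_ : List A → (A → Bool) → (A → Bool)
  (xs ∖ E) c = ind xs c ∧ not (E c)

  ind-sound : ∀ xs {c} → ind xs c ≡ true → c ∈ xs
  ind-sound (x ∷ xs) {c} h with c ≟ x
  ... | yes refl = here refl
  ... | no _ = there (ind-sound xs h)

  ind-complete : ∀ {xs c} → c ∈ xs → ind xs c ≡ true
  ind-complete {x ∷ xs} (here refl) = cong (_∨ ind xs x) (dec-true (x ≟ x) refl)
  ind-complete {x ∷ xs} {c} (there q) with does (c ≟ x)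
  ... | true = refl
  ... | false = ind-complete q

  -- In the induction complementation exchanges the subsets containing x with those avoiding it, so
  -- the two halves of the sum change places.
  𝕊-∖ : ∀ {xs} → Unique xs → ∀ {F} → Ext F → 𝕊 xs (λ E → F (xs ∖ E)) ≡ 𝕊 xs F
  𝕊-∖ [] ext = cong (_+ 0ℚ) (ext (λ c → refl))
  𝕊-∖ {x ∷ xs} (u ∷ us) {F} ext = begin
    𝕊 (x ∷ xs) (λ E → F (x ∷ xs ∖ E))
      ≡⟨ 𝕊-∷ x xs (λ E → F (x ∷ xs ∖ E)) ⟩
    𝕊 xs (λ E → F (x ∷ xs ∖ E)) + 𝕊 xs (λ E → F (x ∷ xs ∖ (x ⊕ E)))
      ≡⟨ cong₂ _+_ (∑-congᴬ (subsets-represent us) (λ ys R → ext (out ys R))) (∑-cong (subsets xs) (λ ys → ext (inn ys))) ⟩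
    𝕊 xs (λ E → F (x ⊕ (xs ∖ E))) + 𝕊 xs (λ E → F (xs ∖ E))
      ≡⟨ trans (cong₂ _+_ (𝕊-∖ us (⊕-ext x ext)) (𝕊-∖ us ext)) (+-comm _ _) ⟩
    𝕊 xs F + 𝕊 xs (λ E → F (x ⊕ E))
      ≡⟨ sym (𝕊-∷ x xs F) ⟩
    𝕊 (x ∷ xs) F ∎
    where
    open ≡-Reasoning
    x∉ : x ∉ xs
    x∉ q = All.lookup u q refl
    out : ∀ ys → Represents xs ys → ∀ c → (x ∷ xs ∖ ind ys) c ≡ (x ⊕ (xs ∖ ind ys)) c
    out ys R c with c ≟ x
    ... | yes refl = cong not (¬true⇒false (λ q → x∉ (Represents.mem R q)))
    ... | no _ = refl
    inn : ∀ ys c → (x ∷ xs ∖ (x ⊕ ind ys)) c ≡ (xs ∖ ind ys) c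
    inn ys c with c ≟ x
    ... | yes refl = cong (_∧ not (ind ys x)) (sym (¬true⇒false (λ q → x∉ (ind-sound xs q))))
    ... | no _ = refl

module Duality (r m d d′ : ℕ) (r≥1 : 1 ≤ r) (d+d′ : d ℕ.+ d′ ≡ m ^ (r ∸ 1)) where
  open Space r m using (Cell; cells; _≟ᶜ_; deg; size; ι-deg′; ι-size; hyper; ∑-hyper-update; ι-m-pos)
  private
    module P = Counting r m d
    module P′ = Counting r m d′
  open Complement _≟ᶜ_

  private opaque
    unfolding _+_
    e : ∀ x → (1ℚ − x) + x ≡ 1ℚ
    e = solve-∀ ℚ-ring

  mn : m ^ r ≡ m * m ^ (r ∸ 1)
  mn = cong (m ^_) (sym (ℕ.m+[n∸m]≡n r≥1))

  degrees : ∀ E l v → deg (not ∘ E) l v ℕ.+ deg E l v ≡ m ^ (r ∸ 1)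
  degrees E l v = ι-inj (trans (ι-+ _ _) (trans (cong₂ _+_ (ι-deg′ (not ∘ E) l v) (ι-deg′ E l v)) (trans (sym (∑-+ (hyper l v) _ _))
    (trans (∑-cong (hyper l v) (λ c → trans (cong (_+ 𝟙 (E c)) (𝟙-not (E c))) (e _))) (*-cancelˡ-≡ (ι-m-pos v)
      (trans (∑-hyper-update l v _) (trans (∑-const cells 1ℚ) (trans (*-identityʳ _) (trans (cong ι (trans (length-allEdges r m) mn)) (ι-* m _)))))))))) 

  sizes : ∀ E → size (not ∘ E) ℕ.+ size E ≡ m ^ r
  sizes E = ι-inj (trans (ι-+ _ _) (trans (cong₂ _+_ (ι-size (not ∘ E)) (ι-size E)) (trans (sym (∑-+ cells _ _))
    (trans (∑-cong cells (λ c → trans (cong (_+ 𝟙 (E c)) (𝟙-not (E c))) (e _))) (trans (∑-const cells 1ℚ) (trans (*-identityʳ _) (cong ι (length-allEdges r m))))))))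

  complement-edges : m * d ℕ.+ m * d′ ≡ m ^ r
  complement-edges = trans (sym (ℕ.*-distribˡ-+ m d d′)) (trans (cong (m *_) d+d′) (sym mn))

  H-complement : H r d m ≡ H r d′ m
  H-complement = ι-inj (begin
    ι (H r d m)
      ≡⟨ trans (sym (P.count-all r≥1)) (P.count-lists (P.prefix r 0)) ⟩
    ∑ (subsets cells) (λ ys → P.weight (P.prefix r 0) (P.ind ys))
      ≡⟨ sym (𝕊-∖ (allEdges-unique r m) (P.weight-ext (P.prefix r 0))) ⟩
    ∑ (subsets cells) (λ ys → P.weight (P.prefix r 0) (cells ∖ P.ind ys))
      ≡⟨ ∑-cong (subsets cells) (λ ys → trans (P.weight-ext (P.prefix r 0) (λ c → cong (_∧ not (P.ind ys c)) (ind-complete (allEdges-complete c)))) (dual (P.ind ys))) ⟩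
    ∑ (subsets cells) (λ ys → P′.weight (P′.prefix r 0) (P.ind ys))
      ≡⟨ trans (sym (P′.count-lists (P′.prefix r 0))) (P′.count-all r≥1) ⟩
    ι (H r d′ m) ∎)
    where
    open ≡-Reasoning
    dual : ∀ E → P.weight (P.prefix r 0) (not ∘ E) ≡ P′.weight (P′.prefix r 0) E
    dual E = cong 𝟙 (bool-≡
      (λ h → let (g , s) = P.good-sound {P.prefix r 0} {not ∘ E} h in P′.good-complete {P′.prefix r 0} {E}
        ( (λ l v q → ℕ.+-cancelˡ-≡ d _ _ (trans (cong (ℕ._+ deg E l v) (sym (g l v (P.prefix-< {r} {0} {l} {v} (Fin.toℕ<n l))))) (trans (degrees E l v) (sym d+d′))))
        , ℕ.+-cancelˡ-≡ (m * d) _ _ (trans (cong (ℕ._+ size E) (sym s)) (trans (sizes E) (sym complement-edges)))))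
      (λ h → let (g , s) = P′.good-sound {P′.prefix r 0} {E} h in P.good-complete {P.prefix r 0} {not ∘ E}
        ( (λ l v q → ℕ.+-cancelʳ-≡ d′ _ _ (trans (cong (deg (not ∘ E) l v ℕ.+_) (sym (g l v (P′.prefix-< {r} {0} {l} {v} (Fin.toℕ<n l))))) (trans (degrees E l v) (sym d+d′))))
        , ℕ.+-cancelʳ-≡ (m * d′) _ _ (trans (cong (size (not ∘ E) ℕ.+_) (sym s)) (trans (sizes E) (sym complement-edges))))))

  C-dual : ∀ {a b n} → a ℕ.+ b ≡ n → n C a ≡ n C b
  C-dual {a} {b} refl = trans (nCk≡nC[n∸k] {a} {a ℕ.+ b} (ℕ.m≤m+n a b)) (cong ((a ℕ.+ b) C_) (ℕ.m+n∸m≡n a b))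

  Hnum-complement : Hnum r d m ≡ Hnum r d′ m
  Hnum-complement = cong (_^ (r * m)) (C-dual {d} {d′} d+d′)

  Hden-complement : Hden r d m ≡ Hden r d′ m
  Hden-complement = cong (_^ (r ∸ 1)) (C-dual {m * d} {m * d′} complement-edges)

module Empty (r m : ℕ) (r≥1 : 1 ≤ r) where
  open Counting r m 0

  -- The stages divide by d, so d = 0 is treated directly: size 0 already forces every degree to be
  -- 0.
  H-empty : H r 0 m ≡ 1
  H-empty = ι-inj (trans (sym (count-all r≥1)) (trans (count-cong {prefix r 0} {prefix 0 0} (λ E s → (λ l v q → ⊥-elim (none {l} {v} (prefix-sound {0} {0} {l} {v} q))) , proj₂ s)
      (λ E s → (λ l v _ → ℕ.n≤0⇒n≡0 (ι-cancel (≤ℚ-trans (≡⇒≤ (ι-deg E l v)) (≤ℚ-trans (∑-mono cells (λ c → ≤ℚ-trans (*-monoˡ (𝟙-nonneg _) (𝟙-≤1 _)) (≡⇒≤ (*-identityʳ _))))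
        (≡⇒≤ (trans (sym (ι-size E)) (cong ι (trans (proj₂ s) (ℕ.*-zeroʳ m))))))))) , proj₂ s))
    (trans count-none (cong ι (trans (cong ((m ^ r) C_) (ℕ.*-zeroʳ m)) (nC0≡1 (m ^ r)))))))
    where none : ∀ {l : Fin r} {v : Fin m} → toℕ l ℕ.< 0 ⊎ (toℕ l ≡ 0 × toℕ v ℕ.< 0) → ⊥
          none (inj₁ ())
          none (inj₂ (_ , ()))

  Hnum-empty : Hnum r 0 m ≡ 1
  Hnum-empty = trans (cong (_^ (r * m)) (nC0≡1 (m ^ (r ∸ 1)))) (ℕ.^-zeroˡ (r * m))

  Hden-empty : Hden r 0 m ≡ 1
  Hden-empty = trans (cong (_^ (r ∸ 1)) (trans (cong ((m ^ r) C_) (ℕ.*-zeroʳ m)) (nC0≡1 (m ^ r)))) (ℕ.^-zeroˡ (r ∸ 1))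

-- The total error

totalError : (r m m′ : ℕ) → ℚ
totalError r m m′ = ι r · σ m′ (λ i → ι (8 * (r * m)) · inv (ι ((m ∸ i) * m ^ (r ∸ 1))))

totalError-nonneg : ∀ r m m′ → 0ℚ ≤ℚ totalError r m m′
totalError-nonneg r m m′ = *-nonneg (ι-nonneg r) (go m′)
  where go : ∀ k → 0ℚ ≤ℚ σ k (λ i → ι (8 * (r * m)) · inv (ι ((m ∸ i) * m ^ (r ∸ 1))))
        go zero = ≤ℚ-refl
        go (suc k) = +-nonneg (go k) (*-nonneg (ι-nonneg _) (inv-nonneg (ι-nonneg ((m ∸ k) * m ^ (r ∸ 1)))))

approximation-≤half : ∀ r m′ d → 1 ≤ r → 2 * d ≤ suc m′ ^ (r ∸ 1) →
  (ι (H r d (suc m′)) · ι (Hden r d (suc m′))) ≈[ totalError r (suc m′) m′ ] ι (Hnum r d (suc m′))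
approximation-≤half r m′ zero r≥1 _ = ≈-weaken (*-nonneg (ι-nonneg _) (ι-nonneg _)) (ι-nonneg _) (totalError-nonneg r (suc m′) m′)
  (≈-resp (sym (trans (sym (ι-* _ _)) (cong ι (cong₂ _*_ H-empty Hden-empty)))) (cong ι (sym Hnum-empty)) (≈-refl (ι 1)))
  where open Empty r (suc m′) r≥1
approximation-≤half r m′ (suc d) r≥1 h = Products.approximation r (suc m′) (suc d) (s≤s z≤n) h refl r≥1

approximation : ∀ r m′ d → 1 ≤ r → d ≤ suc m′ ^ (r ∸ 1) →
  (ι (H r d (suc m′)) · ι (Hden r d (suc m′))) ≈[ totalError r (suc m′) m′ ] ι (Hnum r d (suc m′))
approximation r m′ d r≥1 d≤n with ℕ.≤-total (2 * d) (suc m′ ^ (r ∸ 1))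
... | inj₁ h = approximation-≤half r m′ d r≥1 h
... | inj₂ h = ≈-resp (cong₂ (λ x y → ι x · ι y) (sym D.H-complement) (sym D.Hden-complement)) (cong ι (sym D.Hnum-complement)) (approximation-≤half r m′ d′ r≥1 2d′≤n)
  where
  n = suc m′ ^ (r ∸ 1)
  d′ = n ∸ d
  module D = Duality r (suc m′) d d′ r≥1 (ℕ.m+[n∸m]≡n d≤n)
  2d′≤n : 2 * d′ ≤ n
  2d′≤n = ℕ.≤-trans (ℕ.≤-reflexive (cong (d′ ℕ.+_) (ℕ.+-identityʳ d′))) (ℕ.≤-trans (ℕ.+-monoʳ-≤ d′ d′≤d) (ℕ.≤-reflexive (ℕ.m∸n+n≡m d≤n)))
    where d′≤d : d′ ≤ d
          d′≤d = ℕ.≤-trans (ℕ.∸-monoˡ-≤ d h) (ℕ.≤-reflexive (trans (cong (_∸ d) (cong (d ℕ.+_) (ℕ.+-identityʳ d))) (ℕ.m+n∸m≡n d d)))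

σ-*ʳ : ∀ k f c → σ k f · c ≡ σ k (λ t → f t · c)
σ-*ʳ zero f c = *-zeroˡ c
σ-*ʳ (suc k) f c = trans (distribʳ c (σ k f) (f k)) (cong (_+ f k · c) (σ-*ʳ k f c))

σ-*ˡ : ∀ k f c → σ k (λ t → c · f t) ≡ c · σ k f
σ-*ˡ zero f c = sym (*-zeroʳ c)
σ-*ˡ (suc k) f c = trans (cong (_+ c · f k) (σ-*ˡ k f c)) (sym (distribˡ c (σ k f) (f k)))

-- 1/2 + ⋯ + 1/(k+1)
harmonic : ℕ → ℚ
harmonic k = σ k (λ i → inv (ι (suc k ∸ i)))

harmonic-suc : ∀ k → harmonic (suc k) ≡ inv (ι (suc (suc k))) + harmonic k
harmonic-suc k = σ-front k (λ i → inv (ι (suc (suc k) ∸ i)))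

inv-ι : ∀ b → ι (suc b) · inv (ι (suc b)) ≡ 1ℚ
inv-ι b = *-inv (0<⇒≢0 (ι-pos (s≤s z≤n)))

inv-ι·≤1 : ∀ {b k} → k ≤ suc b → inv (ι (suc b)) · ι k ≤ℚ 1ℚ
inv-ι·≤1 {b} {k} h = ≤ℚ-trans (*-monoˡ (inv-nonneg (ι-nonneg _)) (ι-mono h)) (≡⇒≤ (trans (*-comm _ _) (inv-ι b)))

harmonic-≤ : ∀ k → harmonic k ≤ℚ ι k
harmonic-≤ zero = ι-nonneg 0
harmonic-≤ (suc k) = ≤ℚ-trans (≡⇒≤ (harmonic-suc k)) (≤ℚ-trans (+-mono (≤ℚ-trans (≡⇒≤ (sym (trans (cong (inv (ι (suc (suc k))) ·_) ι-1) (*-identityʳ _)))) (inv-ι·≤1 (s≤s z≤n))) (harmonic-≤ k)) (≡⇒≤ (sym (ι-suc k))))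

-- The terms 1/b with b ≥ K contribute at most 1/K each, the others at most K in total.
harmonic-split : ∀ K k → harmonic k · ι K ≤ℚ ι (k ℕ.+ K * K)
harmonic-split K zero = ≤ℚ-trans (≡⇒≤ (*-zeroˡ _)) (ι-nonneg _)
harmonic-split K (suc k) with ℕ.≤-total K (suc (suc k))
... | inj₁ h = ≤ℚ-trans (≡⇒≤ (trans (cong (_· ι K) (harmonic-suc k)) (distribʳ _ _ _))) (≤ℚ-trans (+-mono (inv-ι·≤1 h) (harmonic-split K k)) (≡⇒≤ (sym (ι-suc (k ℕ.+ K * K)))))
... | inj₂ h = ≤ℚ-trans (*-monoʳ (ι-nonneg K) (≤ℚ-trans (harmonic-≤ (suc k)) (ι-mono (ℕ.<⇒≤ h)))) (≤ℚ-trans (≡⇒≤ (sym (ι-* K K))) (ι-mono (ℕ.m≤n+m (K * K) (suc k))))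

-- The quotient r³ / 2^(r-3) has its maximum 32 at r = 4; from there on the cube at most doubles
-- when r grows by one.
cube-≤ : ∀ s → (3 ℕ.+ s) * ((3 ℕ.+ s) * (3 ℕ.+ s)) ≤ 32 * 2 ^ s
cube-≤ zero = ℕ.≤ᵇ⇒≤ 27 32 _
cube-≤ (suc zero) = ℕ.≤ᵇ⇒≤ 64 64 _
cube-≤ (suc (suc t)) = ℕ.≤-trans (ℕ.m≤m+n _ (t * (t * t) ℕ.+ 9 * (t * t) ℕ.+ 21 * t ℕ.+ 3)) (ℕ.≤-trans (ℕ.≤-reflexive
    (solve 1 (λ t → (con 5 :+ t) :* ((con 5 :+ t) :* (con 5 :+ t)) :+ (t :* (t :* t) :+ con 9 :* (t :* t) :+ con 21 :* t :+ con 3)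
      := con 2 :* ((con 4 :+ t) :* ((con 4 :+ t) :* (con 4 :+ t)))) refl t))
    (ℕ.≤-trans (ℕ.*-monoʳ-≤ 2 (cube-≤ (suc t))) (ℕ.≤-reflexive (solve 1 (λ x → con 2 :* (con 32 :* (con 2 :* x)) := con 32 :* (con 2 :* (con 2 :* x))) refl (2 ^ t)))))
  where open ℕ.+-*-Solver

-- The total error is 8r²m/n times a harmonic sum, which `harmonic-split` bounds without logarithms.
-- As m ≥ 2, `cube-≤` absorbs r³ into 32 m^(r-3), and 256 = 8 · 32. The parameter K stays open so
-- that it can suit both large m and large r.
totalError-bound : ∀ s k K → totalError (3 ℕ.+ s) (2 ℕ.+ k) (suc k) · ι ((3 ℕ.+ s) * (K * (2 ℕ.+ k))) ≤ℚ ι (256 * (2 ℕ.+ k ℕ.+ K * K))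
totalError-bound s k K = *-cancelˡ (ι-pos w≥1) (begin
  ι (m * m ^ s) · (ι r · err · ι (r * (K * m)))
    ≡⟨ cong₂ (λ x y → x · (ι r · err · y)) (ι-* m (m ^ s)) (trans (ι-* r _) (cong (ι r ·_) (ι-* K m))) ⟩
  (ι m · ι (m ^ s)) · (ι r · err · (ι r · (ι K · ι m)))
    ≡⟨ e₁ _ _ _ _ _ ⟩
  (ι r · ι r) · ((err · (ι m · (ι m · ι (m ^ s)))) · ι K)
    ≡⟨ cong₂ (λ x y → x · (y · ι K)) (sym (ι-* r r)) (trans (cong (err ·_) (sym n≡)) err·n) ⟩
  ι (r * r) · (ι (8 * (r * m)) · harmonic (suc k) · ι K)
    ≤⟨ *-monoˡ (ι-nonneg _) (≤ℚ-trans (≡⇒≤ (*-assoc _ _ _)) (*-monoˡ (ι-nonneg _) (≤ℚ-trans (harmonic-split K (suc k)) (ι-mono (ℕ.n≤1+n _))))) ⟩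
  ι (r * r) · (ι (8 * (r * m)) · ι (m ℕ.+ K * K))
    ≡⟨ trans (cong (ι (r * r) ·_) (sym (ι-* _ _))) (sym (ι-* _ _)) ⟩
  ι (r * r * (8 * (r * m) * (m ℕ.+ K * K)))
    ≤⟨ ι-mono arith ⟩
  ι (m * m ^ s * (256 * (m ℕ.+ K * K)))
    ≡⟨ ι-* _ _ ⟩
  ι (m * m ^ s) · ι (256 * (m ℕ.+ K * K)) ∎)
  where
  open ℚ.≤-Reasoning
  r = 3 ℕ.+ s
  m = 2 ℕ.+ k
  n = m ^ (2 ℕ.+ s)
  err = σ (suc k) (λ i → ι (8 * (r * m)) · inv (ι ((m ∸ i) * n)))
  w≥1 : 1 ≤ m * m ^ s
  w≥1 = ℕ.*-mono-≤ {1} {m} (s≤s z≤n) (ℕ.m^n>0 m s)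
  n≡ : ι n ≡ ι m · (ι m · ι (m ^ s))
  n≡ = trans (ι-* m _) (cong (ι m ·_) (ι-* m _))
  n-pos : 0ℚ < ι n
  n-pos = ι-pos (ℕ.m^n>0 m (2 ℕ.+ s))
  opaque
    unfolding _+_
    e₁ : ∀ m w r e K → (m · w) · (r · e · (r · (K · m))) ≡ (r · r) · ((e · (m · (m · w))) · K)
    e₁ = solve-∀ ℚ-ring
    e₂ : ∀ b i n → b · (i · n) ≡ (b · n) · i
    e₂ = solve-∀ ℚ-ring
  inv-·n : ∀ b → inv (ι (suc b * n)) · ι n ≡ inv (ι (suc b))
  inv-·n b = *-cancelˡ-≡ (ι-pos {suc b} (s≤s z≤n)) (trans (e₂ _ _ _) (trans (cong (_· inv (ι (suc b * n))) (sym (ι-* (suc b) n)))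
    (trans (*-inv (0<⇒≢0 (subst (0ℚ <_) (sym (ι-* (suc b) n)) (*-pos (ι-pos (s≤s z≤n)) n-pos)))) (sym (inv-ι b)))))
  err·n : err · ι n ≡ ι (8 * (r * m)) · harmonic (suc k)
  err·n = trans (σ-*ʳ (suc k) _ (ι n)) (trans (σ-cong (suc k) (λ t p → trans (*-assoc _ _ _) (cong (ι (8 * (r * m)) ·_) (trans (cong (λ b → inv (ι (b * n)) · ι n) (b≡ t p)) (trans (inv-·n (suc k ∸ t)) (cong (λ b → inv (ι b)) (sym (b≡ t p))))))))
    (σ-*ˡ (suc k) _ _))
    where b≡ : ∀ t → t ℕ.< suc k → m ∸ t ≡ suc (suc k ∸ t)
          b≡ t p = ℕ.+-∸-assoc 1 (ℕ.<⇒≤ p)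
  arith : r * r * (8 * (r * m) * (m ℕ.+ K * K)) ≤ m * m ^ s * (256 * (m ℕ.+ K * K))
  arith = ℕ.≤-trans (ℕ.≤-reflexive (solve 3 (λ r m x → r :* r :* (con 8 :* (r :* m) :* x) := (r :* (r :* r)) :* (con 8 :* m :* x)) refl r m (m ℕ.+ K * K)))
    (ℕ.≤-trans (ℕ.*-monoˡ-≤ (8 * m * (m ℕ.+ K * K)) (ℕ.≤-trans (cube-≤ s) (ℕ.*-monoʳ-≤ 32 (ℕ.^-monoˡ-≤ s (s≤s (s≤s z≤n))))))
      (ℕ.≤-reflexive (solve 3 (λ w m x → con 32 :* w :* (con 8 :* m :* x) := m :* w :* (con 256 :* x)) refl (m ^ s) m (m ℕ.+ K * K))))
    where open ℕ.+-*-Solver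

-- Put K = 1024Q, so that rm ≥ K³. If m ≥ K², the bound with parameter K gives an error of at most
-- 512/(rK); otherwise r ≥ K, and the bound with parameter 1 gives at most 512/r. Both are at most
-- 512/K = 1/(2Q).
small-error : ∀ Q r m′ → 3 ≤ r → (1024 * Q) * ((1024 * Q) * (1024 * Q)) ≤ r * suc m′ → 1 ≤ Q →
  totalError r (suc m′) m′ · ι (2 * Q) ≤ℚ 1ℚ
-- For m = 1 each class has a single vertex, which is always the last one, and the error sum is
-- empty.
small-error Q r zero _ _ _ = ≤ℚ-trans (≡⇒≤ (trans (cong (_· ι (2 * Q)) (*-zeroʳ (ι r))) (*-zeroˡ _))) 0≤1
small-error Q r (suc k) 3≤r big Q≥1 = *-cancelˡ (ι-pos w≥1) (≤ℚ-trans (≡⇒≤ (trans (e₁ _ _ _) (cong (err ·_) (sym (ι-* (512 * (r * m)) (2 * Q))))))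
    (≤ℚ-trans (go (ℕ.≤-total (K * K) m)) (≡⇒≤ (sym (*-identityʳ _)))))
  where
  m = 2 ℕ.+ k
  K = 1024 * Q
  err = totalError r m (suc k)
  err-nonneg = totalError-nonneg r m (suc k)
  r-pos : 1 ≤ r
  r-pos = ℕ.≤-trans (s≤s z≤n) 3≤r
  w≥1 : 1 ≤ 512 * (r * m)
  w≥1 = ℕ.*-mono-≤ {1} {512} (s≤s z≤n) (ℕ.*-mono-≤ {1} {r} {1} {m} r-pos (s≤s z≤n))
  opaque
    unfolding _+_
    e₁ : ∀ w e q → w · (e · q) ≡ e · (w · q)
    e₁ = solve-∀ ℚ-ring
  bound : ∀ K → err · ι (r * (K * m)) ≤ℚ ι (256 * (m ℕ.+ K * K))
  bound K = subst (λ r → totalError r m (suc k) · ι (r * (K * m)) ≤ℚ ι (256 * (m ℕ.+ K * K))) (ℕ.m+[n∸m]≡n 3≤r) (totalError-bound (r ∸ 3) k K)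
  open ℕ.+-*-Solver
  go : K * K ≤ m ⊎ m ≤ K * K → err · ι (512 * (r * m) * (2 * Q)) ≤ℚ ι (512 * (r * m))
  go (inj₁ K²≤m) = ≤ℚ-trans (≡⇒≤ (cong (λ x → err · ι x) (solve 3 (λ r m Q → con 512 :* (r :* m) :* (con 2 :* Q) := r :* ((con 1024 :* Q) :* m)) refl r m Q)))
    (≤ℚ-trans (bound K) (ι-mono (ℕ.≤-trans (ℕ.*-monoʳ-≤ 256 (ℕ.+-monoʳ-≤ m K²≤m))
      (ℕ.≤-trans (ℕ.≤-reflexive (solve 1 (λ m → con 256 :* (m :+ m) := con 512 :* (con 1 :* m)) refl m)) (ℕ.*-monoʳ-≤ 512 (ℕ.*-monoˡ-≤ m r-pos))))))
  go (inj₂ m≤K²) = ≤ℚ-trans (≡⇒≤ (trans (cong (λ x → err · ι x) (solve 3 (λ r m Q → con 512 :* (r :* m) :* (con 2 :* Q) := r :* (con 1 :* m) :* (con 1024 :* Q)) refl r m Q)) (trans (cong (err ·_) (ι-* (r * (1 * m)) K)) (sym (*-assoc _ _ _)))))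
    (≤ℚ-trans (*-monoʳ (ι-nonneg K) (bound 1)) (≤ℚ-trans (≡⇒≤ (sym (ι-* _ K))) (ι-mono (ℕ.≤-trans (ℕ.*-mono-≤ (ℕ.*-monoʳ-≤ 256 (ℕ.+-monoʳ-≤ m {1} {m} (s≤s z≤n))) K≤r)
      (ℕ.≤-reflexive (solve 2 (λ r m → con 256 :* (m :+ m) :* r := con 512 :* (r :* m)) refl r m))))))
    where
    K≤r : K ≤ r
    K≤r = ℕ.*-cancelʳ-≤ K r (K * K) {{ℕ.>-nonZero (ℕ.*-mono-≤ {1} {K} {1} {K} K≥1 K≥1)}} (ℕ.≤-trans big (ℕ.*-monoʳ-≤ r m≤K²))
      where K≥1 : 1 ≤ K
            K≥1 = ℕ.*-mono-≤ {1} {1024} (s≤s z≤n) Q≥1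

-- From the relative error to the stated inequality

opaque
  unfolding _+_

  -- The denominator of ε serves as Q, since the numerator of a positive fraction is at least 1.
  archimedean : ∀ ε → 0ℚ < ε → Σ ℕ (λ Q → 1 ≤ Q × 1ℚ ≤ℚ ι Q · ε)
  archimedean ε@(ℚ.mkℚ (ℤ.+ suc k) dm _) h = suc dm , s≤s z≤n , ℚ.toℚᵘ-cancel-≤ (ℚᵘ.≤-respʳ-≃
      (ℚᵘ.≃-sym (ℚᵘ.≃-trans (ℚ.toℚᵘ-homo-* (ι (suc dm)) ε) (ℚᵘ.*-cong (toℚᵘ-ι (suc dm)) (ℚᵘ.≃-refl {ℚᵘ.mkℚᵘ (ℤ.+ suc k) dm}))))
      (ℚᵘ.*≤* (ℤ.+≤+ (ℕ.≤-trans (ℕ.≤-reflexive (solve 1 (λ d → con 1 :* (con 1 :* d) := d) refl (suc dm)))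
        (ℕ.≤-trans (ℕ.m≤m*n (suc dm) (suc k)) (ℕ.≤-reflexive (sym (ℕ.*-identityʳ _))))))))
    where open ℕ.+-*-Solver
  archimedean (ℚ.mkℚ (ℤ.+ zero) dm _) (ℚ.*<* (ℤ.+<+ h)) = ⊥-elim (ℕ.<-irrefl refl (ℕ.≤-trans h (ℕ.≤-reflexive refl)))
  archimedean (ℚ.mkℚ ℤ.-[1+ k ] dm _) (ℚ.*<* ())

  ∣-∣-≤ : ∀ {x y z} → x − y ≤ℚ z → y − x ≤ℚ z → ∣ x - y ∣ ≤ℚ z
  ∣-∣-≤ {x} {y} {z} h h′ with ℚ.∣p∣≡p∨∣p∣≡-p (x - y)
  ... | inj₁ e = ≤ℚ-trans (≡⇒≤ e) h
  ... | inj₂ e = ≤ℚ-trans (≡⇒≤ (trans e (flip x y))) h′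
    where flip : ∀ x y → − (x − y) ≡ y − x
          flip = solve-∀ ℚ-ring

-- The factor 2Q gives both 2e ≤ ε and 2e ≤ 1. The latter yields x ≤ 2y, which turns the error e · x
-- measured against x into one measured against y.
≈⇒∣−∣ : ∀ {x y e ε Q} → 0ℚ ≤ℚ e → 0ℚ ≤ℚ x → 0ℚ ≤ℚ y → 1 ≤ Q → 1ℚ ≤ℚ ι Q · ε → e · ι (2 * Q) ≤ℚ 1ℚ → 0ℚ ≤ℚ ε → x ≈[ e ] y → ∣ x - y ∣ ≤ℚ ε · y
≈⇒∣−∣ {x} {y} {e} {ε} {Q} he hx hy Q≥1 hQ small hε h = ∣-∣-≤ x−y y−x
  where
  opaque
    unfolding _+_
    e₁ : ∀ e q ε → (e + e) · (q · ε) ≡ (e · ((1ℚ + 1ℚ) · q)) · ε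
    e₁ = solve-∀ ℚ-ring
    e₂ : ∀ e x → (x − e · x) + (x − e · x) ≡ (x + x) − (e + e) · x
    e₂ = solve-∀ ℚ-ring
    e₄ : ∀ e y → e · (y + y) ≡ (e + e) · y
    e₄ = solve-∀ ℚ-ring
    e₇ : ∀ e q → (e + e) · q ≡ e · ((1ℚ + 1ℚ) · q)
    e₇ = solve-∀ ℚ-ring
    two : ι (2 * Q) ≡ (1ℚ + 1ℚ) · ι Q
    two = ι-* 2 Q
  ee≤ε : e + e ≤ℚ ε
  ee≤ε = ≤ℚ-trans (≡⇒≤ (sym (*-identityʳ _))) (≤ℚ-trans (*-monoˡ (+-nonneg he he) hQ) (≤ℚ-trans (≡⇒≤ (trans (e₁ e (ι Q) ε) (cong (λ z → e · z · ε) (sym two))))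
    (≤ℚ-trans (*-monoʳ hε small) (≡⇒≤ (*-identityˡ ε)))))
  ee≤1 : e + e ≤ℚ 1ℚ
  ee≤1 = ≤ℚ-trans (≡⇒≤ (sym (*-identityʳ _))) (≤ℚ-trans (*-monoˡ (+-nonneg he he) (≤ℚ-trans (≡⇒≤ (sym ι-1)) (ι-mono Q≥1))) (≤ℚ-trans (≡⇒≤ (trans (e₇ e (ι Q)) (cong (e ·_) (sym two)))) small))
  e≤ε : e ≤ℚ ε
  e≤ε = ≤-drop ee≤ε he
  y−x : y − x ≤ℚ ε · y
  y−x = ≤ℚ-trans (≤+⇒−≤ (subst₂ _≤ℚ_ (a−b+b y (e · y)) (+-comm _ _) (+-mono (from h) (≤ℚ-refl {e · y})))) (*-monoʳ hy e≤ε)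
  x≤2y : x ≤ℚ y + y
  x≤2y = ≤ℚ-trans (0≤b−a⇒a≤b (subst (0ℚ ≤ℚ_) (trans (e₈ x ((e + e) · x)) (cong (_− x) (sym (e₂ e x)))) (0≤b−a (≤ℚ-trans (*-monoʳ hx ee≤1) (≡⇒≤ (*-identityˡ x)))))) (+-mono (to h) (to h))
    where opaque
            unfolding _+_
            e₈ : ∀ x z → x − z ≡ (x + x − z) − x
            e₈ = solve-∀ ℚ-ring
  x−y : x − y ≤ℚ ε · y
  x−y = ≤ℚ-trans (≤+⇒−≤ (subst₂ _≤ℚ_ (a−b+b x (e · x)) (+-comm _ _) (+-mono (to h) (≤ℚ-refl {e · x}))))
    (≤ℚ-trans (*-monoˡ he x≤2y) (≤ℚ-trans (≡⇒≤ (e₄ e y)) (*-monoʳ hy ee≤ε)))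

opaque
  unfolding _+_

  threshold : (ε : ℚ) → 0ℚ < ε → ℕ
  threshold ε h = let Q = proj₁ (archimedean ε h) in (1024 * Q) * ((1024 * Q) * (1024 * Q))

  estimate : ∀ ε (h : 0ℚ < ε) r m d → 3 ≤ r → 1 ≤ m → threshold ε h ≤ r * m → d ≤ m ^ (r ∸ 1) →
    ∣ ℕtoℚ (H r d m) *ℚ ℕtoℚ (Hden r d m) - ℕtoℚ (Hnum r d m) ∣ ≤ℚ ε *ℚ ℕtoℚ (Hnum r d m)
  estimate ε h r (suc m′) d 3≤r _ big d≤n = let (Q , Q≥1 , hQ) = archimedean ε h in
    ≈⇒∣−∣ {ι (H r d (suc m′)) · ι (Hden r d (suc m′))} {ι (Hnum r d (suc m′))} {totalError r (suc m′) m′} {ε} {Q}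
      (totalError-nonneg r (suc m′) m′) (*-nonneg (ι-nonneg (H r d (suc m′))) (ι-nonneg (Hden r d (suc m′)))) (ι-nonneg (Hnum r d (suc m′))) Q≥1 hQ
      (small-error Q r m′ 3≤r big Q≥1) (<ℚ⇒≤ℚ h) (approximation r m′ d (ℕ.≤-trans (s≤s z≤n) 3≤r) d≤n)

theorem1p1 : (ε : ℚ) → 0ℚ < ε →
    Σ ℕ (λ N → (r m d : ℕ) → 3 ≤ r → 1 ≤ m → N ≤ r * m → d ≤ m ^ (r ∸ 1) →
    ∣ ℕtoℚ (H r d m) *ℚ ℕtoℚ (Hden r d m) - ℕtoℚ (Hnum r d m) ∣ ≤ℚ ε *ℚ ℕtoℚ (Hnum r d m))
theorem1p1 ε h = threshold ε h , estimate ε h
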